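{- The class of injective prefix trees of unbounded depth is P-TIME robust: every computable injective prefix tree of unbounded depth is isomorphic to a fully P-TIME injective prefix tree.
   Context: A prefix tree is a structure $\mathcal T=(T,R_1,R_2,R_3,\dots;r)$ where each $R_n$ is an $n$-ary relation and $r\in T$, with (1) $R_1=\{r\}$ and (2) if $R_n(a_1,\dots,a_n)$ and $1\le i\le n$ then $R_i(a_1,\dots,a_i)$; $R_n$ is the set of paths of length $n$ starting at the root. It is injective if whenever $R_{n+1}(a_1,\dots,a_n,c)$ and $R_{k+1}(b_1,\dots,b_k,c)$ then $n=k$ and $a_i=b_i$ for all $i\le n$. It has unbounded depth if it has root-paths of arbitrarily large length, i.e. $R_n\ne\emptyset$ for all $n$. Computable means: domain a computable subset of $\mathbb N$ and relations uniformly computable. With $\mathbb B=\{0,1\}^{<\omega}$, such a structure is fully P-TIME if its domain is $\mathbb B$, all relations and constants are uniformly P-TIME, and the function assigning to the index of a relation its arity is P-TIME; here uniformity means a single machine decides, on an input over alphabet $\{0,1,a,b,c,d\}$ consisting of $a^n$ (the index of the relation $R_n$) followed by the arguments separated by $d$ (or $c^k$ followed by an element for constants), the answer within $P(\ell)$ steps for a fixed polynomial $P$, where $\ell$ is the input length. -}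

module Defs where

open import Data.Nat using (ℕ; zero; suc; _+_; _*_)
open import Data.Bool using (Bool; true; false)
open import Data.Fin using (Fin)
open import Data.Maybe using (Maybe; just; nothing)
open import Data.Sum using (_⊎_; inj₁; inj₂)
open import Data.Product using (Σ; _×_; _,_)
open import Data.List using (List; []; _∷_; replicate; length; concatMap) renaming (map to lmap; _++_ to _+++_)
open import Data.Vec using (Vec; []; _∷_; _++_; _∷ʳ_; map; toList)
open import Data.Vec.Relation.Unary.All using (All)
open import Relation.Binary.PropositionalEquality using (_≡_; subst)

_⇔_ : Set → Set → Set
P ⇔ Q = (P → Q) × (Q → P)

𝔹 : Set
𝔹 = List Bool

data Sym : Set where
  s0 s1 sa sb sc sd : Sym

-- tape alphabet: blank (nothing), the input symbols, and finitely many
-- extra working symbols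
Γ : ℕ → Set
Γ e = Maybe (Sym ⊎ Fin e)

data Move : Set where
  left right : Move

data Action (q e : ℕ) : Set where
  halt : Bool → Action q e
  step : Fin (suc q) → Γ e → Move → Action q e

record TM : Set where
  field
    nStates : ℕ          -- states are Fin (suc nStates); Fin.zero is the start state
    nExtra  : ℕ
    δ       : Fin (suc nStates) → Γ nExtra → Action nStates nExtra

record Config (M : TM) : Set where
  constructor conf
  open TM M
  field
    state : Fin (suc nStates)
    lefts : List (Γ nExtra)     -- cells left of the head, nearest first
    here  : Γ nExtra
    rights : List (Γ nExtra)    -- cells right of the head, nearest first

initConfig : (M : TM) → List Sym → Config M
initConfig M []       = conf Fin.zero [] nothing []
initConfig M (x ∷ xs) = conf Fin.zero [] (just (inj₁ x)) (lmap (λ y → just (inj₁ y)) xs)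

moveHead : {M : TM} → Fin (suc (TM.nStates M)) → List (Γ (TM.nExtra M)) → Γ (TM.nExtra M)
         → List (Γ (TM.nExtra M)) → Move → Config M
moveHead q []       w rs left  = conf q [] w rs            -- head stays at the left end
moveHead q (l ∷ ls) w rs left  = conf q ls l (w ∷ rs)
moveHead q ls       w []       right = conf q (w ∷ ls) nothing []
moveHead q ls       w (r ∷ rs) right = conf q (w ∷ ls) r rs

run : (M : TM) → ℕ → Config M → Maybe Bool
run M zero    c = nothing
run M (suc t) (conf q ls h rs) with TM.δ M q h
... | halt b       = just b
... | step q' w mv = run M t (moveHead {M} q' ls w rs mv)

HaltsWithin : TM → ℕ → List Sym → Bool → Set
HaltsWithin M t w b = run M t (initConfig M w) ≡ just b

Halts : TM → List Sym → Bool → Set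
Halts M w b = Σ ℕ λ t → HaltsWithin M t w b

-- Polynomials with natural coefficients (list of coefficients, lowest first)

Poly : Set
Poly = List ℕ

evalPoly : Poly → ℕ → ℕ
evalPoly []       x = 0
evalPoly (a ∷ as) x = a + x * evalPoly as x

encℕ : ℕ → List Sym
encℕ x = replicate x s1

encBit : Bool → Sym
encBit false = s0
encBit true  = s1

enc𝔹 : 𝔹 → List Sym
enc𝔹 = lmap encBit

encQuery : {A : Set} → (A → List Sym) → (n : ℕ) → Vec A (suc n) → List Sym
encQuery e n xs = replicate (suc n) sa +++ concatMap (λ x → sd ∷ e x) (toList xs)

encConstQuery : 𝔹 → List Sym
encConstQuery x = sc ∷ enc𝔹 x

-- Prefix trees.  R n is the (n+1)-ary relation R_{n+1}, so the family
-- R_1, R_2, R_3, … is R 0, R 1, R 2, …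

record PrefixTree (A : Set) : Set₁ where
  field
    Dom     : A → Set
    R       : (n : ℕ) → Vec A (suc n) → Set
    root    : A
    root-dom : Dom root
    R-dom   : ∀ n (xs : Vec A (suc n)) → R n xs → All Dom xs
    R₁-root : ∀ x → R 0 (x ∷ []) ⇔ (x ≡ root)
    prefix  : ∀ i j (xs : Vec A (suc i)) (ys : Vec A j) → R (i + j) (xs ++ ys) → R i xs

module _ {A : Set} (S : PrefixTree A) where
  open PrefixTree S

  Injective : Set
  Injective = ∀ n k (as : Vec A n) (bs : Vec A k) (c : A)
    → R n (as ∷ʳ c) → R k (bs ∷ʳ c) → Σ (n ≡ k) λ e → subst (Vec A) e as ≡ bs

  UnboundedDepth : Set
  UnboundedDepth = ∀ n → Σ (Vec A (suc n)) λ xs → R n xs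

Computable : PrefixTree ℕ → Set
Computable S =
  Σ TM λ Mdom → Σ TM λ Mrel →
    (∀ x → Σ Bool λ b → Halts Mdom (encℕ x) b × ((b ≡ true) ⇔ Dom x))
  × (∀ n (xs : Vec ℕ (suc n)) → All Dom xs →
       Σ Bool λ b → Halts Mrel (encQuery encℕ n xs) b × ((b ≡ true) ⇔ R n xs))
  where open PrefixTree S

FullyPTime : PrefixTree 𝔹 → Set
FullyPTime S =
  (∀ x → Dom x)
  × (Σ TM λ M → Σ Poly λ P →
      (∀ n (xs : Vec 𝔹 (suc n)) →
         let w = encQuery enc𝔹 n xs in
         Σ Bool λ b → HaltsWithin M (evalPoly P (length w)) w b × ((b ≡ true) ⇔ R n xs))
    × (∀ x →
         let w = encConstQuery x in
         Σ Bool λ b → HaltsWithin M (evalPoly P (length w)) w b × ((b ≡ true) ⇔ (x ≡ root))))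
  where open PrefixTree S

record Iso {A B : Set} (S : PrefixTree A) (S' : PrefixTree B) : Set where
  module S = PrefixTree S
  module S' = PrefixTree S'
  field
    to      : A → B
    from    : B → A
    to-dom  : ∀ x → S.Dom x → S'.Dom (to x)
    from-dom : ∀ y → S'.Dom y → S.Dom (from y)
    from-to : ∀ x → S.Dom x → from (to x) ≡ x
    to-from : ∀ y → S'.Dom y → to (from y) ≡ y
    to-root : to S.root ≡ S'.root
    to-R    : ∀ n (xs : Vec A (suc n)) → All S.Dom xs → S.R n xs ⇔ S'.R n (map to xs)

{-# OPTIONS --safe #-}
module Submission where

-- Let T be the domain of the tree.  By unbounded depth there are nodes c₀ < c₁ < … of T, each at an odd depth and
-- each with parent p k, such that p₀ < p₁ < … as well; let b₀ < b₁ < … be the remaining nodes.  By injectivity every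
-- path through c k passes through p k, which is some b i with i ≥ k, because the p k lie at even depth.
--
-- In stage j = 0, 1, 2, … a fixed program first computes all paths through nodes of index at most j, then sets
-- m j to the number of steps it has made so far, and finally lists these paths once more.  The node b j receives
-- the name 1^(m j), and the c k receive the remaining strings, the k-th of them known after k stages.  A path with
-- largest index j contains b j, so its encoding is longer than the time the program needs to list it, up to a
-- polynomial.  A query w is therefore decided by running the program for |w| (|w| + 1) steps and comparing w with
-- everything that is listed.

open import Defs
open import Data.Nat using (ℕ; zero; suc; pred; _+_; _*_; _∸_; _≤_; _<_; z≤n; s≤s; _≡ᵇ_; _≟_; _≤?_; _<?_; _⊔_)
open import Data.Nat.Properties
open import Data.Nat.Induction using (<-wellFounded; Acc; acc)
open import Data.Nat.Solver using (module +-*-Solver)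
open +-*-Solver using (solve; _:*_; _:+_; _:=_; con)
import Data.Bool
open import Data.Bool using (Bool; true; false; if_then_else_; _∨_; not)
open import Data.Fin using (Fin; toℕ; fromℕ<; combine; remQuot; join; splitAt; #_) renaming (zero to fzero; suc to fsuc)
import Data.Fin.Properties as Finₚ
open import Data.Maybe using (Maybe; just; nothing; is-just)
open import Data.Sum using (_⊎_; inj₁; inj₂)
open import Data.Product using (Σ; _×_; _,_; proj₁; proj₂)
open import Data.List using (List; []; _∷_; length; foldr; foldl; reverse; replicate; concatMap) renaming (map to lmap; _++_ to _+++_)
import Data.List as List
import Data.List.Properties as Listₚ
open import Data.List.Membership.Propositional using (_∈_)
open import Data.List.Membership.Propositional.Properties using (∈-map⁺; ∈-map⁻; ∈-++⁺ˡ; ∈-++⁺ʳ; ∈-++⁻; ∈-∃++; ∈-lookup)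
open import Data.List.Relation.Unary.Any using (here; there)
open import Data.List.Relation.Unary.Any.Properties using (reverse⁺; reverse⁻)
import Data.List.Relation.Unary.All as All
open import Data.List.Relation.Unary.All using (All; []; _∷_)
open import Data.List.Relation.Unary.AllPairs using ([]; _∷_)
open import Data.List.Relation.Unary.Unique.Propositional using (Unique)
open import Data.Vec using (Vec; []; _∷_; lookup; tabulate; _[_]≔_; _++_; head; tail; toList; fromList; _∷ʳ_)
import Data.Vec as Vec
import Data.Vec.Properties as Vecₚ
import Data.Vec.Relation.Unary.All as VAll
import Data.Vec.Relation.Unary.All.Properties as VAllₚ
open import Data.Empty using (⊥; ⊥-elim)
open import Data.Unit using (⊤; tt)
open import Relation.Nullary using (¬_; yes; no)
open import Relation.Binary.Definitions using (tri<; tri≈; tri>)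
open import Relation.Binary.PropositionalEquality

-- Every string has to be a name. So short strings name nodes too, and a query about such nodes
-- alone leaves no time to compute anything. The c k can bear short names because a path never
-- contains them without a companion whose name is long. Unbounded depth is what supplies infinitely
-- many such pairs.
--
-- The names are read off the clock of the very program that has to spell them. Two things prevent a
-- circle. The output of a stage consists of symbols such as "walk to the next mark" and is computed
-- from the tree alone; the number m j enters only as a mark on the tape cell of that position. And
-- the clock runs alike on all inputs, since the input is merely compared with the output, in
-- branches of equal cost.
--
-- The procedures that decide the tree may be arbitrarily slow and are carried out with unary
-- counters. What matters is only the ratio between the last pass of a stage and the time spent
-- before it. A walk may cost about m j steps per symbol, whence a cut-off that is quadratic in the
-- length of the query.

record Finite (A : Set) : Set where
  field
    size    : ℕ
    encode     : A → Fin size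
    decode     : Fin size → A
    decode-encode : ∀ a → decode (encode a) ≡ a

open Finite

finite-⊤ : Finite ⊤
finite-⊤ = record { size = 1 ; encode = λ _ → fzero ; decode = λ _ → tt ; decode-encode = λ _ → refl }

finite-Fin : ∀ n → Finite (Fin n)
finite-Fin n = record { size = n ; encode = λ i → i ; decode = λ i → i ; decode-encode = λ _ → refl }

finite-× : ∀ {A B} → Finite A → Finite B → Finite (A × B)
finite-× {A} {B} a b = record
  { size = size a * size b
  ; encode = λ (x , y) → combine (encode a x) (encode b y)
  ; decode = λ i → decode a (proj₁ (remQuot {size a} (size b) i)) , decode b (proj₂ (remQuot {size a} (size b) i))
  ; decode-encode = λ (x , y) → trans
      (cong (λ p → decode a (proj₁ p) , decode b (proj₂ p)) (Finₚ.remQuot-combine (encode a x) (encode b y)))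
      (cong₂ _,_ (decode-encode a x) (decode-encode b y)) }

finite-⊎ : ∀ {A B} → Finite A → Finite B → Finite (A ⊎ B)
finite-⊎ {A} {B} a b = record
  { size = size a + size b
  ; encode = λ x → join (size a) (size b) (e x)
  ; decode = λ i → d (splitAt (size a) i)
  ; decode-encode = λ x → trans (cong d (Finₚ.splitAt-join (size a) (size b) (e x))) (d-e x) }
  where
  e : A ⊎ B → Fin (size a) ⊎ Fin (size b)
  e (inj₁ x) = inj₁ (encode a x)
  e (inj₂ y) = inj₂ (encode b y)
  d : Fin (size a) ⊎ Fin (size b) → A ⊎ B
  d (inj₁ i) = inj₁ (decode a i)
  d (inj₂ i) = inj₂ (decode b i)
  d-e : ∀ x → d (e x) ≡ x
  d-e (inj₁ x) = cong inj₁ (decode-encode a x)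
  d-e (inj₂ y) = cong inj₂ (decode-encode b y)

finite-retract : ∀ {A B} → Finite A → (f : B → A) (g : A → B) → (∀ b → g (f b) ≡ b) → Finite B
finite-retract a f g gf = record
  { size = size a ; encode = λ b → encode a (f b) ; decode = λ i → g (decode a i)
  ; decode-encode = λ b → trans (cong g (decode-encode a (f b))) (gf b) }

finite-Bool : Finite Bool
finite-Bool = finite-retract (finite-Fin 2) f g λ { true → refl ; false → refl }
  where
  f : Bool → Fin 2
  f false = fzero
  f true = fsuc fzero
  g : Fin 2 → Bool
  g fzero = false
  g (fsuc _) = true

finite-Maybe : ∀ {A} → Finite A → Finite (Maybe A)
finite-Maybe {A} a = finite-retract (finite-⊎ finite-⊤ a) f g λ { nothing → refl ; (just _) → refl }
  where
  f : Maybe A → ⊤ ⊎ A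
  f nothing = inj₁ tt
  f (just x) = inj₂ x
  g : ⊤ ⊎ A → Maybe A
  g (inj₁ _) = nothing
  g (inj₂ x) = just x

finite-Vec : ∀ {A} → Finite A → ∀ n → Finite (Vec A n)
finite-Vec a zero = finite-retract finite-⊤ (λ _ → tt) (λ _ → []) λ { [] → refl }
finite-Vec {A} a (suc n) = finite-retract (finite-× a (finite-Vec a n)) f (λ (x , xs) → x ∷ xs) λ { (x ∷ xs) → refl }
  where
  f : Vec A (suc n) → A × Vec A n
  f (x ∷ xs) = x , xs

symIx : Sym → Fin 6
symIx s0 = # 0
symIx s1 = # 1
symIx sa = # 2
symIx sb = # 3
symIx sc = # 4
symIx sd = # 5

ixSym : Fin 6 → Sym
ixSym = lookup (s0 ∷ s1 ∷ sa ∷ sb ∷ sc ∷ sd ∷ [])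

ixSym-symIx : ∀ s → ixSym (symIx s) ≡ s
ixSym-symIx = λ { s0 → refl ; s1 → refl ; sa → refl ; sb → refl ; sc → refl ; sd → refl }

finite-Sym : Finite Sym
finite-Sym = finite-retract (finite-Fin 6) symIx ixSym ixSym-symIx

≡ᵇ-refl : ∀ n → (n ≡ᵇ n) ≡ true
≡ᵇ-refl zero = refl
≡ᵇ-refl (suc n) = ≡ᵇ-refl n

≢⇒≡ᵇ-false : ∀ m n → m ≢ n → (m ≡ᵇ n) ≡ false
≢⇒≡ᵇ-false zero zero m≢n = ⊥-elim (m≢n refl)
≢⇒≡ᵇ-false zero (suc n) m≢n = refl
≢⇒≡ᵇ-false (suc m) zero m≢n = refl
≢⇒≡ᵇ-false (suc m) (suc n) m≢n = ≢⇒≡ᵇ-false m n (λ e → m≢n (cong suc e))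

_‼_ : ∀ {A : Set} → List A → ℕ → Maybe A
[] ‼ _ = nothing
(x ∷ xs) ‼ zero = just x
(x ∷ xs) ‼ suc n = xs ‼ n

_∈ᵇ_ : ℕ → List ℕ → Bool
x ∈ᵇ [] = false
x ∈ᵇ (y ∷ ys) = (x ≡ᵇ y) ∨ (x ∈ᵇ ys)

vec-ext : ∀ {A : Set} {n} (xs ys : Vec A n) → (∀ i → lookup xs i ≡ lookup ys i) → xs ≡ ys
vec-ext [] [] _ = refl
vec-ext (x ∷ xs) (y ∷ ys) h = cong₂ _∷_ (h fzero) (vec-ext xs ys (λ i → h (fsuc i)))

-- Pointer machines and their simulation by Turing machines

-- Pointer machines.  A register holds a position on the input tape; tests see whether that cell is the
-- first one, its input symbol, and whether it has been marked.

data Instr (K : ℕ) (Q : Set) : Set where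
  inc dec zer mrk : Fin K → Q → Instr K Q
  tst : Fin K → (Bool → Maybe Sym → Bool → Bool) → Q → Q → Instr K Q
  hlt : Bool → Instr K Q

record PState (K : ℕ) : Set where
  constructor pst
  field
    reg   : Fin K → ℕ
    marks : List ℕ

_[_↦_] : ∀ {K} {A : Set} → (Fin K → A) → Fin K → A → Fin K → A
(σ [ r ↦ v ]) r' with r Finₚ.≟ r'
... | yes _ = v
... | no _ = σ r'

update-same : ∀ {K} {A : Set} (σ : Fin K → A) r v → (σ [ r ↦ v ]) r ≡ v
update-same σ r v with r Finₚ.≟ r
... | yes _ = refl
... | no r≢r = ⊥-elim (r≢r refl)

update-other : ∀ {K} {A : Set} (σ : Fin K → A) {r r'} v → r ≢ r' → (σ [ r ↦ v ]) r' ≡ σ r'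
update-other σ {r} {r'} v r≢r' with r Finₚ.≟ r'
... | yes e = ⊥-elim (r≢r' e)
... | no _ = refl

module PointerMachine {K : ℕ} {Q : Set} (I : Q → Instr K Q) (w : List Sym) where
  open PState

  observe : (Bool → Maybe Sym → Bool → Bool) → PState K → Fin K → Bool
  observe φ s r = φ (reg s r ≡ᵇ 0) (w ‼ reg s r) (reg s r ∈ᵇ marks s)

  exec : Instr K Q → PState K → (Q × PState K) ⊎ Bool
  exec (inc r q) s = inj₁ (q , pst (reg s [ r ↦ suc (reg s r) ]) (marks s))
  exec (dec r q) s = inj₁ (q , pst (reg s [ r ↦ pred (reg s r) ]) (marks s))
  exec (zer r q) s = inj₁ (q , pst (reg s [ r ↦ 0 ]) (marks s))
  exec (mrk r q) s = inj₁ (q , pst (reg s) (reg s r ∷ marks s))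
  exec (tst r φ q q') s = inj₁ ((if observe φ s r then q else q') , s)
  exec (hlt b) s = inj₂ b

  data PRun : ℕ → Q × PState K → Bool → Set where
    stop : ∀ {q s b} → exec (I q) s ≡ inj₂ b → PRun 1 (q , s) b
    next : ∀ {n q s c b} → exec (I q) s ≡ inj₁ c → PRun n c b → PRun (suc n) (q , s) b

  update-bound : ∀ (σ : Fin K → ℕ) r v {X} → v ≤ suc X → (∀ r → σ r ≤ X) → ∀ r' → (σ [ r ↦ v ]) r' ≤ suc X
  update-bound σ r v v≤ bd r' with r Finₚ.≟ r'
  ... | yes _ = v≤
  ... | no _ = m≤n⇒m≤1+n (bd r')

  -- A pointer moves right by at most one cell per instruction. So the length of a sweep stays
  -- bounded by the number of instructions executed.
  reg-bound : ∀ i s {q' s' X} → exec i s ≡ inj₁ (q' , s') → (∀ r → reg s r ≤ X) → ∀ r → reg s' r ≤ suc X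
  reg-bound (inc r q) s refl bd = update-bound (reg s) r _ (s≤s (bd r)) bd
  reg-bound (dec r q) s refl bd = update-bound (reg s) r _ (m≤n⇒m≤1+n (≤-trans pred[n]≤n (bd r))) bd
  reg-bound (zer r q) s refl bd = update-bound (reg s) r _ z≤n bd
  reg-bound (mrk r q) s refl bd r' = m≤n⇒m≤1+n (bd r')
  reg-bound (tst r φ q q₁) s refl bd r' = m≤n⇒m≤1+n (bd r')

-- Turing machine simulating a pointer machine: each tape cell stores the input symbol, the mark and, for each
-- register, whether the register points here.  An instruction is one sweep from the left end and back.

record Cell (K : ℕ) : Set where
  constructor cell
  field
    org  : Bool
    symb : Maybe Sym
    mk   : Bool
    bits : Vec Bool K

open Cell

finite-Cell : ∀ K → Finite (Cell K)
finite-Cell K = finite-retract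
  (finite-× finite-Bool (finite-× (finite-Maybe finite-Sym) (finite-× finite-Bool (finite-Vec finite-Bool K))))
  (λ c → org c , symb c , mk c , bits c) (λ (o , s , m , b) → cell o s m b) (λ _ → refl)

-- The phases of one sweep. `placing` and `rewinding` are entered with the bit of the register
-- erased; they set it again at the current cell or at the left end.
data Ctl (K : ℕ) (Q : Set) : Set where
  seeking returning   : Q → Ctl K Q
  placing rewinding : Fin K → Q → Ctl K Q

finite-Ctl : ∀ {K Q} → Finite Q → Finite (Ctl K Q)
finite-Ctl {K} {Q} fq = finite-retract (finite-⊎ (finite-⊎ fq fq) (finite-⊎ fp fp)) f g
  λ { (seeking _) → refl ; (returning _) → refl ; (placing _ _) → refl ; (rewinding _ _) → refl }
  where
  fp = finite-× (finite-Fin K) fq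
  f : Ctl K Q → (Q ⊎ Q) ⊎ ((Fin K × Q) ⊎ (Fin K × Q))
  f (seeking q) = inj₁ (inj₁ q)
  f (returning q) = inj₁ (inj₂ q)
  f (placing r q) = inj₂ (inj₁ (r , q))
  f (rewinding r q) = inj₂ (inj₂ (r , q))
  g : (Q ⊎ Q) ⊎ ((Fin K × Q) ⊎ (Fin K × Q)) → Ctl K Q
  g (inj₁ (inj₁ q)) = seeking q
  g (inj₁ (inj₂ q)) = returning q
  g (inj₂ (inj₁ (r , q))) = placing r q
  g (inj₂ (inj₂ (r , q))) = rewinding r q

data Act (K : ℕ) (Q : Set) : Set where
  hlt : Bool → Act K Q
  stp : Ctl K Q → Cell K → Move → Act K Q

setBit : ∀ {K} → Fin K → Bool → Cell K → Cell K
setBit r b (cell o s m bs) = cell o s m (bs [ r ]≔ b)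

setMark : ∀ {K} → Cell K → Cell K
setMark (cell o s m bs) = cell o s true bs

module Simulation {K : ℕ} {Q : Set} (finQ : Finite Q) (I : Q → Instr K Q) (q₀ : Q) where

  found : Instr K Q → Q → Cell K → Act K Q
  found (inc r q') q c = stp (placing r q') (setBit r false c) right
  -- A register at the left end already holds 0. The left move leaves the head there, so the next
  -- search can start at once.
  found (dec r q') q c = if org c then stp (seeking q') c left else stp (placing r q') (setBit r false c) left
  found (zer r q') q c = stp (rewinding r q') (setBit r false c) left
  found (mrk r q') q c = stp (returning q') (setMark c) left
  found (tst r φ q₁ q₂) q c = stp (returning (if φ (org c) (symb c) (mk c) then q₁ else q₂)) c left
  found (hlt b) q c = hlt b

  seek : Fin K → Instr K Q → Q → Cell K → Act K Q
  seek r i q c = if lookup (bits c) r then found i q c else stp (seeking q) c right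

  goAct : Instr K Q → Q → Cell K → Act K Q
  goAct i@(inc r _) = seek r i
  goAct i@(dec r _) = seek r i
  goAct i@(zer r _) = seek r i
  goAct i@(mrk r _) = seek r i
  goAct i@(tst r _ _ _) = seek r i
  goAct (hlt b) q c = hlt b

  act : Maybe (Ctl K Q) → Cell K → Act K Q
  -- All registers start at 0, so the first cell receives every register bit. The flag `org` makes
  -- the left end recognisable: a left move there merely stays put.
  act nothing c = stp (seeking q₀) (cell true (symb c) false (Vec.replicate K true)) left
  act (just (seeking q)) c = goAct (I q) q c
  act (just (returning q)) c = if org c then stp (seeking q) c left else stp (returning q) c left
  act (just (placing r q)) c = stp (returning q) (setBit r true c) left
  act (just (rewinding r q)) c = if org c then stp (seeking q) (setBit r true c) left else stp (rewinding r q) c left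

  finC : Finite (Cell K)
  finC = finite-Cell K

  finS : Finite (Ctl K Q)
  finS = finite-Ctl finQ

  -- Blanks and original input symbols are read as cells without mark and registers, so that the
  -- tape need not be converted before the simulation.
  view : Γ (size finC) → Cell K
  view nothing = cell false nothing false (Vec.replicate K false)
  view (just (inj₁ s)) = cell false (just s) false (Vec.replicate K false)
  view (just (inj₂ i)) = decode finC i

  write : Cell K → Γ (size finC)
  write c = just (inj₂ (encode finC c))

  view-write : ∀ c → view (write c) ≡ c
  view-write c = decode-encode finC c

  encS : Maybe (Ctl K Q) → Fin (suc (size finS))
  encS nothing = fzero
  encS (just q) = fsuc (encode finS q)

  decS : Fin (suc (size finS)) → Maybe (Ctl K Q)
  decS fzero = nothing
  decS (fsuc i) = just (decode finS i)

  decS-encS : ∀ q → decS (encS q) ≡ q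
  decS-encS nothing = refl
  decS-encS (just q) = cong just (decode-encode finS q)

  toAction : Act K Q → Action (size finS) (size finC)
  toAction (hlt b) = halt b
  toAction (stp q c mv) = step (encS (just q)) (write c) mv

  M : TM
  M = record { nStates = size finS ; nExtra = size finC ; δ = λ q h → toAction (act (decS q) (view h)) }

  Tape : Set
  Tape = ℕ → Cell K

  LeftRep : List (Γ (size finC)) → ℕ → Tape → Set
  LeftRep [] zero T = ⊤
  LeftRep [] (suc p) T = ⊥
  LeftRep (l ∷ ls) zero T = ⊥
  LeftRep (l ∷ ls) (suc p) T = view l ≡ T p × LeftRep ls p T

  nth : List (Γ (size finC)) → ℕ → Γ (size finC)
  nth [] _ = nothing
  nth (x ∷ xs) zero = x
  nth (x ∷ xs) (suc n) = nth xs n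

  record Rep (cfg : Config M) (q : Maybe (Ctl K Q)) (p : ℕ) (T : Tape) : Set where
    constructor rep
    field
      state≡ : Config.state cfg ≡ encS q
      left≡  : LeftRep (Config.lefts cfg) p T
      here≡  : view (Config.here cfg) ≡ T p
      right≡ : ∀ i → view (nth (Config.rights cfg) i) ≡ T (suc p + i)

  LeftRep-cong : ∀ ls p {T T'} → (∀ i → i < p → T' i ≡ T i) → LeftRep ls p T → LeftRep ls p T'
  LeftRep-cong [] zero h _ = tt
  LeftRep-cong (l ∷ ls) (suc p) h (e , r) =
    trans e (sym (h p (n<1+n p))) , LeftRep-cong ls p (λ i i<p → h i (m<n⇒m<1+n i<p)) r

  -- Quantifying over the remaining time `t` lets pieces of a run be composed without saying that
  -- the machine has not yet halted in between.
  record Reach (q : Maybe (Ctl K Q)) (p : ℕ) (T : Tape) (n : ℕ) (q' : Maybe (Ctl K Q)) (p' : ℕ) (T' : Tape) : Set where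
    constructor mkReach
    field
      reaches : ∀ cfg → Rep cfg q p T →
        Σ (Config M) λ cfg' → (∀ t → run M (n + t) cfg ≡ run M t cfg') × Rep cfg' q' p' T'

  open Reach

  reach-trans : ∀ {q p T n q' p' T' n' q″ p″ T″} → Reach q p T n q' p' T' → Reach q' p' T' n' q″ p″ T″
    → Reach q p T (n + n') q″ p″ T″
  reach-trans {n = n} {n' = n'} f g .reaches cfg r with reaches f cfg r
  ... | cfg' , e , r' with reaches g cfg' r'
  ... | cfg″ , e' , r″ = cfg″ , (λ t → trans (cong (λ k → run M k cfg) (+-assoc n n' t)) (trans (e (n' + t)) (e' t))) , r″

  reach-refl : ∀ {q p T T'} → (∀ i → T i ≡ T' i) → Reach q p T 0 q p T'
  reach-refl {p = p} h .reaches cfg (rep a b c d) =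
    cfg , (λ t → refl) , rep a (LeftRep-cong (Config.lefts cfg) p (λ i _ → sym (h i)) b) (trans c (h _)) (λ i → trans (d i) (h _))

  shift : Move → ℕ → ℕ
  shift left = pred
  shift right = suc

  run-step : ∀ t q ls h rs q' c mv → TM.δ M q h ≡ step q' c mv
    → run M (suc t) (conf q ls h rs) ≡ run M t (moveHead {M} q' ls c rs mv)
  run-step t q ls h rs q' c mv e with TM.δ M q h | e
  ... | .(step q' c mv) | refl = refl

  reach-step : ∀ {q p T q' c mv T'} → act q (T p) ≡ stp q' c mv → T' p ≡ c → (∀ i → i ≢ p → T' i ≡ T i)
    → Reach q p T 1 (just q') (shift mv p) T'
  reach-step {q} {p} {T} {q'} {c} {mv} {T'} e hp ho .reaches (conf st ls h rs) (rep refl b v d) =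
    moveHead {M} (encS (just q')) ls (write c) rs mv ,
    (λ t → run-step t st ls h rs _ _ mv
      (trans (cong₂ (λ x y → toAction (act x y)) (decS-encS q) v) (cong toAction e))) ,
    moved mv ls rs p b d hp ho
    where
    vw : ∀ {p} → T' p ≡ c → view (write c) ≡ T' p
    vw hp = trans (view-write c) (sym hp)
    pushed : ∀ ls {p} → LeftRep ls p T → T' p ≡ c → (∀ i → i ≢ p → T' i ≡ T i) → LeftRep (write c ∷ ls) (suc p) T'
    pushed ls {p} b hp ho = vw hp , LeftRep-cong ls p (λ i i<p → ho i (<⇒≢ i<p)) b
    off : ∀ {p} → (∀ i → i ≢ p → T' i ≡ T i) → ∀ i → T (suc p + i) ≡ T' (suc p + i)
    off {p} ho i = sym (ho _ λ x → m+1+n≢m p {i} (trans (+-suc p i) x))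
    ahead : ∀ rs {p} → (∀ i → view (nth rs i) ≡ T (suc p + i)) → (∀ i → i ≢ p → T' i ≡ T i) → view (nth rs 0) ≡ T' (suc p)
    ahead rs {p} d ho = trans (d 0) (trans (off ho 0) (cong T' (cong suc (+-identityʳ p))))
    beyond : ∀ rs {p} → (∀ i → view (nth rs i) ≡ T (suc p + i)) → (∀ i → i ≢ p → T' i ≡ T i)
      → ∀ i → view (nth rs (suc i)) ≡ T' (suc (suc p) + i)
    beyond rs {p} d ho i = trans (d (suc i)) (trans (off ho (suc i)) (cong T' (cong suc (+-suc p i))))
    moved : ∀ mv ls rs p → LeftRep ls p T → (∀ i → view (nth rs i) ≡ T (suc p + i)) → T' p ≡ c → (∀ i → i ≢ p → T' i ≡ T i)
      → Rep (moveHead {M} (encS (just q')) ls (write c) rs mv) (just q') (shift mv p) T'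
    moved left [] rs zero b d hp ho = rep refl tt (vw hp) (λ i → trans (d i) (sym (ho (suc i) λ ())))
    moved left (l ∷ ls) rs (suc p) (e , b) d hp ho = rep refl
      (LeftRep-cong ls p (λ i i<p → ho i (<⇒≢ (m<n⇒m<1+n i<p))) b)
      (trans e (sym (ho p (<⇒≢ (n<1+n p)))))
      λ { zero → trans (vw hp) (cong T' (sym (+-identityʳ (suc p))))
        ; (suc i) → trans (d i) (trans (sym (ho _ λ x → m+1+n≢m p {i} (suc-injective (trans (+-suc (suc p) i) x)))) (cong T' (sym (+-suc (suc p) i)))) }
    moved right [] [] p b d hp ho = rep refl (pushed [] b hp ho) (ahead [] d ho) (beyond [] d ho)
    moved right (l ∷ ls) [] p b d hp ho = rep refl (pushed (l ∷ ls) b hp ho) (ahead [] d ho) (beyond [] d ho)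
    moved right [] (r ∷ rs) p b d hp ho = rep refl (pushed [] b hp ho) (ahead (r ∷ rs) d ho) (beyond (r ∷ rs) d ho)
    moved right (l ∷ ls) (r ∷ rs) p b d hp ho =
      rep refl (pushed (l ∷ ls) b hp ho) (ahead (r ∷ rs) d ho) (beyond (r ∷ rs) d ho)

  module _ (w : List Sym) where
    open PState
    open PointerMachine I w

    cells : (Fin K → ℕ → Bool) → (ℕ → Bool) → Tape
    cells b μ i = cell (i ≡ᵇ 0) (w ‼ i) (μ i) (tabulate (λ r → b r i))

    at : PState K → Fin K → ℕ → Bool
    at s r i = reg s r ≡ᵇ i

    tape : PState K → Tape
    tape s = cells (at s) (_∈ᵇ marks s)

    cells-cong : ∀ b b' μ μ' i → (∀ r → b r i ≡ b' r i) → μ i ≡ μ' i → cells b μ i ≡ cells b' μ' i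
    cells-cong b b' μ μ' i hb hμ = cong₂ (cell (i ≡ᵇ 0) (w ‼ i)) hμ (Vecₚ.tabulate-cong hb)

    bit-lookup : ∀ b μ i r → lookup (bits (cells b μ i)) r ≡ b r i
    bit-lookup b μ i r = Vecₚ.lookup∘tabulate (λ r → b r i) r

    setBit-cells : ∀ b b' μ i r v → b' r i ≡ v → (∀ r' → r ≢ r' → b' r' i ≡ b r' i)
      → cells b' μ i ≡ setBit r v (cells b μ i)
    setBit-cells b b' μ i r v hr ho = cong (cell (i ≡ᵇ 0) (w ‼ i) (μ i)) (vec-ext _ _ same)
      where
      same : ∀ r' → lookup (tabulate (λ r → b' r i)) r' ≡ lookup (tabulate (λ r → b r i) [ r ]≔ v) r'
      same r' with r Finₚ.≟ r'
      ... | yes refl = trans (Vecₚ.lookup∘tabulate _ r) (trans hr (sym (Vecₚ.lookup∘updateAt r (tabulate (λ r → b r i)))))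
      ... | no r≢r' = trans (Vecₚ.lookup∘tabulate _ r') (trans (ho r' r≢r')
          (sym (trans (Vecₚ.lookup∘updateAt′ r' r (λ e → r≢r' (sym e)) (tabulate (λ r → b r i))) (Vecₚ.lookup∘tabulate _ r'))))

    reach-back : ∀ q p {b μ} → Reach (just (returning q)) p (cells b μ) (suc p) (just (seeking q)) 0 (cells b μ)
    reach-back q zero = reach-step refl refl (λ _ _ → refl)
    reach-back q (suc p) {b} {μ} = reach-trans
      (reach-step {T' = cells b μ} refl refl (λ _ _ → refl)) (reach-back q p)

    erase : (Fin K → ℕ → Bool) → Fin K → Fin K → ℕ → Bool
    erase b r = b [ r ↦ (λ _ → false) ]

    erased : ∀ b r i → erase b r r i ≡ false
    erased b r i = cong (λ f → f i) (update-same b r (λ _ → false))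

    erase-other : ∀ b {r r'} i → r ≢ r' → erase b r r' i ≡ b r' i
    erase-other b i r≢r' = cong (λ f → f i) (update-other b (λ _ → false) r≢r')

    erase-off : ∀ s r r' i → i ≢ reg s r → erase (at s) r r' i ≡ at s r' i
    erase-off s r r' i i≢ with r Finₚ.≟ r'
    ... | yes refl = sym (≢⇒≡ᵇ-false _ _ (λ e → i≢ (sym e)))
    ... | no _ = refl

    -- Puts register r, erased from the tape before, at position v.
    written : ∀ s r v ms i → (i ≡ v → setBit r true (cells (erase (at s) r) (_∈ᵇ ms) i) ≡ tape (pst (reg s [ r ↦ v ]) ms) i)
      × (i ≢ v → tape (pst (reg s [ r ↦ v ]) ms) i ≡ cells (erase (at s) r) (_∈ᵇ ms) i)
    written s r v ms i = hit , miss
      where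
      s' = pst (reg s [ r ↦ v ]) ms
      other : ∀ r' → r ≢ r' → at s' r' i ≡ erase (at s) r r' i
      other r' ne = trans (cong (_≡ᵇ i) (update-other (reg s) v ne)) (sym (erase-other (at s) i ne))
      hit : i ≡ v → setBit r true (cells (erase (at s) r) (_∈ᵇ ms) i) ≡ tape s' i
      hit refl = sym (setBit-cells (erase (at s) r) (at s') (_∈ᵇ ms) i r true (trans (cong (_≡ᵇ i) (update-same (reg s) r i)) (≡ᵇ-refl i)) other)
      miss : i ≢ v → tape s' i ≡ cells (erase (at s) r) (_∈ᵇ ms) i
      miss i≢v = cells-cong (at s') (erase (at s) r) (_∈ᵇ ms) (_∈ᵇ ms) i bit refl
        where
        bit : ∀ r' → at s' r' i ≡ erase (at s) r r' i
        bit r' with r Finₚ.≟ r'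
        ... | yes refl = ≢⇒≡ᵇ-false v i (λ e → i≢v (sym e))
        ... | no _ = refl

    Seeks : Q → Fin K → Set
    Seeks q r = ∀ c → act (just (seeking q)) c ≡ seek r (I q) q c

    seek-miss : ∀ {q r} → Seeks q r → ∀ s i → i ≢ reg s r → act (just (seeking q)) (tape s i) ≡ stp (seeking q) (tape s i) right
    seek-miss {q} {r} h s i ne = trans (h _) (cong (λ b → if b then found (I q) q (tape s i) else stp (seeking q) (tape s i) right)
      (trans (bit-lookup (at s) (_∈ᵇ marks s) i r) (≢⇒≡ᵇ-false _ _ (λ e → ne (sym e)))))

    seek-hit : ∀ {q r} → Seeks q r → ∀ s → act (just (seeking q)) (tape s (reg s r)) ≡ found (I q) q (tape s (reg s r))
    seek-hit {q} {r} h s = trans (h _) (cong (λ b → if b then found (I q) q (tape s p) else stp (seeking q) (tape s p) right)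
      (trans (bit-lookup (at s) (_∈ᵇ marks s) p r) (≡ᵇ-refl p)))
      where p = reg s r

    reach-seek : ∀ {q r} → Seeks q r → ∀ s p k → p + k ≡ reg s r → Reach (just (seeking q)) p (tape s) k (just (seeking q)) (reg s r) (tape s)
    reach-seek h s p zero e rewrite sym (trans (sym (+-identityʳ p)) e) = reach-refl (λ _ → refl)
    reach-seek {q} {r} h s p (suc k) e = reach-trans
      (reach-step (seek-miss h s p (λ p≡ → m+1+n≢m p {k} (trans e (sym p≡)))) refl (λ _ _ → refl))
      (reach-seek h s (suc p) k (trans (sym (+-suc p k)) e))

    -- One sweep goes out to a register at a position of at most `X` and back; the change itself
    -- takes a constant number of steps.
    Done : Q → PState K → Q → PState K → ℕ → Set
    Done q s q' s' X = Σ ℕ λ n → n ≤ X + X + 4 × Reach (just (seeking q)) 0 (tape s) n (just (seeking q')) 0 (tape s')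

    reach-zback : ∀ s r q p → let s' = pst (reg s [ r ↦ 0 ]) (marks s) in
      Reach (just (rewinding r q)) p (cells (erase (at s) r) (_∈ᵇ marks s)) (suc p) (just (seeking q)) 0 (tape s')
    reach-zback s r q zero = reach-step refl (sym (proj₁ (written s r 0 (marks s) 0) refl)) (λ i ne → proj₂ (written s r 0 (marks s) i) ne)
    reach-zback s r q (suc p) = reach-trans
      (reach-step {T' = cells (erase (at s) r) (_∈ᵇ marks s)} refl refl (λ _ _ → refl)) (reach-zback s r q p)

    reach-erase : ∀ {q r q' mv} → Seeks q r → ∀ s
      → found (I q) q (tape s (reg s r)) ≡ stp q' (setBit r false (tape s (reg s r))) mv
      → Reach (just (seeking q)) (reg s r) (tape s) 1 (just q') (shift mv (reg s r)) (cells (erase (at s) r) (_∈ᵇ marks s))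
    reach-erase {q} {r} h s e = reach-step (trans (seek-hit h s) e)
      (setBit-cells (at s) (erase (at s) r) (_∈ᵇ marks s) (reg s r) r false (erased (at s) r (reg s r)) (λ r' ne → erase-other (at s) (reg s r) ne))
      (λ i ne → cells-cong (erase (at s) r) (at s) (_∈ᵇ marks s) (_∈ᵇ marks s) i (λ r' → erase-off s r r' i ne) refl)

    reach-put : ∀ s r q v → let s' = pst (reg s [ r ↦ v ]) (marks s) in
      Reach (just (placing r q)) v (cells (erase (at s) r) (_∈ᵇ marks s)) 1 (just (returning q)) (pred v) (tape s')
    reach-put s r q v = reach-step refl (sym (proj₁ (written s r v (marks s) v) refl)) (λ i ne → proj₂ (written s r v (marks s) i) ne)

    sweep≤ : ∀ {v u X} → v ≤ X → u ≤ v → v + (3 + u) ≤ X + X + 4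
    sweep≤ {v} {u} {X} v≤ u≤ = ≤-trans (+-mono-≤ v≤ (≤-trans (+-monoʳ-≤ 3 (≤-trans u≤ v≤)) (n≤1+n _)))
      (≤-reflexive (trans (cong (X +_) (+-comm 4 X)) (sym (+-assoc X X 4))))

    go-step : ∀ q i s {q' s' X} → I q ≡ i → exec i s ≡ inj₁ (q' , s') → (∀ r → reg s r ≤ X) → Done q s q' s' X
    go-step q i@(inc r q') s h refl bd = _ , sweep≤ (bd r) ≤-refl ,
      reach-trans (reach-seek seeks s 0 (reg s r) refl)
        (reach-trans (reach-erase seeks s (cong (λ i → found i q (tape s (reg s r))) h))
          (reach-trans (reach-put s r q' (suc (reg s r))) (reach-back q' (reg s r))))
      where
      seeks : Seeks q r
      seeks c rewrite h = refl
    go-step q (dec r q') s {X = X} h refl bd with reg s r in er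
    ... | zero = 1 , ≤-trans (s≤s z≤n) (m≤n+m 4 (X + X)) ,
      reach-trans (reach-step {c = tape s 0} {mv = left} {T' = tape s} (subst (λ p → act (just (seeking q)) (tape s p) ≡ stp (seeking q') (tape s p) left) er
          (trans (seek-hit seeks s) (trans (cong (λ i → found i q (tape s (reg s r))) h) (hit er))))
          refl (λ _ _ → refl)) (reach-refl (λ i → cells-cong (at s) (at (pst (reg s [ r ↦ 0 ]) (marks s))) (_∈ᵇ marks s) (_∈ᵇ marks s) i (λ r' → same r' i) refl))
      where
      seeks : Seeks q r
      seeks c rewrite h = refl
      hit : ∀ {p} → p ≡ 0 → found (dec r q') q (tape s p) ≡ stp (seeking q') (tape s p) left
      hit refl = refl
      same : ∀ r' i → at s r' i ≡ at (pst (reg s [ r ↦ 0 ]) (marks s)) r' i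
      same r' i with r Finₚ.≟ r'
      ... | yes refl = cong (_≡ᵇ i) er
      ... | no _ = refl
    ... | suc v = _ , sweep≤ (subst (_≤ X) er (bd r)) (≤-trans pred[n]≤n (n≤1+n v)) ,
      reach-trans (subst (λ p → Reach _ 0 (tape s) (suc v) _ p (tape s)) er (reach-seek seeks s 0 (suc v) (sym er)))
        (reach-trans (subst (λ p → Reach _ p (tape s) 1 (just (placing r q')) (pred p) (cells (erase (at s) r) (_∈ᵇ marks s))) er
            (reach-erase seeks s (trans (cong (λ i → found i q (tape s (reg s r))) h) (hit er))))
          (reach-trans (reach-put s r q' v) (reach-back q' (pred v))))
      where
      seeks : Seeks q r
      seeks c rewrite h = refl
      hit : ∀ {p} → p ≡ suc v → found (dec r q') q (tape s p) ≡ stp (placing r q') (setBit r false (tape s p)) left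
      hit refl = refl
    go-step q (zer r q') s h refl bd = _ , ≤-trans (+-monoʳ-≤ (reg s r) (n≤1+n _)) (sweep≤ (bd r) pred[n]≤n) ,
      reach-trans (reach-seek seeks s 0 (reg s r) refl)
        (reach-trans (reach-erase seeks s (cong (λ i → found i q (tape s (reg s r))) h)) (reach-zback s r q' (pred (reg s r))))
      where
      seeks : Seeks q r
      seeks c rewrite h = refl
    go-step q (mrk r q') s h refl bd = _ , ≤-trans (+-monoʳ-≤ (reg s r) (n≤1+n _)) (sweep≤ (bd r) pred[n]≤n) ,
      reach-trans (reach-seek seeks s 0 (reg s r) refl)
        (reach-trans (reach-step (trans (seek-hit seeks s) (cong (λ i → found i q (tape s (reg s r))) h)) (marked refl) unmarked)
          (reach-back q' (pred (reg s r))))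
      where
      seeks : Seeks q r
      seeks c rewrite h = refl
      marked : ∀ {p} → p ≡ reg s r → tape (pst (reg s) (reg s r ∷ marks s)) p ≡ setMark (tape s p)
      marked {p} refl = cong (λ b → cell (p ≡ᵇ 0) (w ‼ p) (b ∨ (p ∈ᵇ marks s)) (tabulate λ r' → at s r' p)) (≡ᵇ-refl p)
      unmarked : ∀ i → i ≢ reg s r → tape (pst (reg s) (reg s r ∷ marks s)) i ≡ tape s i
      unmarked i ne = cong (λ b → cell (i ≡ᵇ 0) (w ‼ i) (b ∨ (i ∈ᵇ marks s)) (tabulate λ r' → at s r' i)) (≢⇒≡ᵇ-false i _ ne)
    go-step q (tst r φ q₁ q₂) s h refl bd = _ , ≤-trans (+-monoʳ-≤ (reg s r) (n≤1+n _)) (sweep≤ (bd r) pred[n]≤n) ,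
      reach-trans (reach-seek seeks s 0 (reg s r) refl)
        (reach-trans (reach-step (trans (seek-hit seeks s) (cong (λ i → found i q (tape s (reg s r))) h)) refl (λ _ _ → refl))
          (reach-back _ (pred (reg s r))))
      where
      seeks : Seeks q r
      seeks c rewrite h = refl

    run-halt : ∀ cfg q T b → Rep cfg (just (seeking q)) 0 T → I q ≡ hlt b → run M 1 cfg ≡ just b
    run-halt (conf st ls h rs) q T b (rep refl _ _ _) e
      rewrite decode-encode finS (seeking q) | e = refl

    -- Starting from at most `X`, no register exceeds `X + n` during `n` instructions. One bound
    -- thus serves for all the sweeps.
    simulate : ∀ n c b X → PRun n c b → (∀ r → reg (proj₂ c) r ≤ X) → ∀ cfg → Rep cfg (just (seeking (proj₁ c))) 0 (tape (proj₂ c))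
      → Σ ℕ λ t → t ≤ n * ((X + n) + (X + n) + 4) × run M t cfg ≡ just b
    simulate .1 (q , s) b X (stop e) bd cfg rp with I q in ei
    simulate .1 (q , s) b X (stop refl) bd cfg rp | hlt .b =
      1 , ≤-trans (m≤n+m 1 (X + 1 + (X + 1) + 3)) (≤-reflexive (trans (+-assoc _ 3 1) (sym (+-identityʳ _)))) ,
      run-halt cfg q _ b rp ei
    simulate (suc n) (q , s) b X (next {c = q' , s'} e pr) bd cfg rp with go-step q (I q) s refl e bd
    ... | k , k≤ , reach with reaches reach cfg rp
    ... | cfg' , re , rp' with simulate n (q' , s') b (suc X) pr (reg-bound (I q) s e bd) cfg' rp'
    ... | t , t≤ , rt = k + t , +-mono-≤ (≤-trans k≤ (+-monoˡ-≤ 4 (+-mono-≤ (m≤m+n X (suc n)) (m≤m+n X (suc n)))))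
          (≤-trans t≤ (≤-reflexive (cong (λ z → n * (z + z + 4)) (sym (+-suc X n))))) , trans (re t) rt

    initial-rep : Rep (initConfig M w) nothing 0 (λ i → cell false (w ‼ i) false (Vec.replicate K false))
    initial-rep = rep (st w) (lf w) (hr w) (rt w)
      where
      st : ∀ w → Config.state (initConfig M w) ≡ fzero
      st [] = refl
      st (x ∷ w) = refl
      lf : ∀ w → LeftRep (Config.lefts (initConfig M w)) 0 (λ i → cell false (w ‼ i) false (Vec.replicate K false))
      lf [] = tt
      lf (x ∷ w) = tt
      hr : ∀ w → view (Config.here (initConfig M w)) ≡ cell false (w ‼ 0) false (Vec.replicate K false)
      hr [] = refl
      hr (x ∷ w) = refl
      nths : ∀ w i → view (nth (lmap (λ y → just (inj₁ y)) w) i) ≡ cell false (w ‼ i) false (Vec.replicate K false)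
      nths [] i = refl
      nths (x ∷ w) zero = refl
      nths (x ∷ w) (suc i) = nths w i
      rt : ∀ w i → view (nth (Config.rights (initConfig M w)) i) ≡ cell false (w ‼ suc i) false (Vec.replicate K false)
      rt [] i = refl
      rt (x ∷ w) i = nths w i

    simulates : ∀ n b → PRun n (q₀ , pst (λ _ → 0) []) b
      → Σ ℕ λ t → t ≤ 1 + n * (n + n + 4) × HaltsWithin M t w b
    simulates n b pr with reaches (reach-step {q = nothing} {T' = tape (pst (λ _ → 0) [])} refl org≡ off≡) (initConfig M w) initial-rep
      where
      org≡ : tape (pst (λ _ → 0) []) 0 ≡ cell true (w ‼ 0) false (Vec.replicate K true)
      org≡ = cong (cell true (w ‼ 0) false) (vec-ext _ _ λ r →
        trans (Vecₚ.lookup∘tabulate (λ _ → true) r) (sym (Vecₚ.lookup-replicate r true)))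
      off≡ : ∀ i → i ≢ 0 → tape (pst (λ _ → 0) []) i ≡ cell false (w ‼ i) false (Vec.replicate K false)
      off≡ zero ne = ⊥-elim (ne refl)
      off≡ (suc i) ne = cong (cell false (w ‼ suc i) false) (vec-ext _ _ λ r →
        trans (Vecₚ.lookup∘tabulate (λ _ → false) r) (sym (Vecₚ.lookup-replicate r false)))
    ... | cfg , re , rp with simulate n _ b 0 pr (λ _ → z≤n) cfg rp
    ... | t , t≤ , rt = suc t , s≤s t≤ , trans (re t) rt

-- While programs, their compilation and the cut-off

-- Structured programs over a stack of counters, with a pointer cp comparing the input to the emitted word, a
-- pointer aux walking along the marks, a mismatch flag bad and a success counter fnd.

data EReg : Set where
  cp aux bad : EReg
  stk : ℕ → EReg

data Op : Set where
  inc dec zer : EReg → Op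
  mark hit : Op

data Test : Set where
  nonz : EReg → Test
  reads : Maybe Sym → Test
  marked : Bool → Test

infixr 5 _⨾_

data Prog : Set where
  op : Op → Prog
  _⨾_ : Prog → Prog → Prog
  ite : Test → Prog → Prog → Prog
  while : Test → Prog → Prog

record EState : Set where
  constructor est
  field
    stack : ℕ → ℕ
    cpv auxv badv fnd : ℕ
    emarks : List ℕ
    time : ℕ

open EState

_≡ˢ_ : Maybe Sym → Maybe Sym → Bool
nothing ≡ˢ nothing = true
nothing ≡ˢ just _ = false
just _ ≡ˢ nothing = false
just x ≡ˢ just y = toℕ (symIx x) ≡ᵇ toℕ (symIx y)

_≡ᵒ_ : Bool → Bool → Bool
true ≡ᵒ b = b
false ≡ᵒ b = not b

get : EReg → EState → ℕ
get cp s = cpv s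
get aux s = auxv s
get bad s = badv s
get (stk i) s = stack s i

set : EReg → ℕ → EState → EState
set cp v s = record s { cpv = v }
set aux v s = record s { auxv = v }
set bad v s = record s { badv = v }
set (stk i) v s = record s { stack = λ j → if i ≡ᵇ j then v else stack s j }

time-set : ∀ r v e → time (set r v e) ≡ time e
time-set cp v s = refl
time-set aux v s = refl
time-set bad v s = refl
time-set (stk _) v s = refl

fnd-set : ∀ r v s → fnd (set r v s) ≡ fnd s
fnd-set cp v s = refl
fnd-set aux v s = refl
fnd-set bad v s = refl
fnd-set (stk _) v s = refl

tick : EState → EState
tick s = record s { time = suc (time s) }

-- `mark` marks the cell whose position is the current time. This is how the program writes down a
-- moment of its own run.
doOp : Op → EState → EState
doOp (inc r) s = tick (set r (suc (get r s)) s)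
doOp (dec r) s = tick (set r (pred (get r s)) s)
doOp (zer r) s = tick (set r 0 s)
doOp mark s = tick (record s { emarks = time s ∷ emarks s })
doOp hit s = tick (record s { fnd = suc (fnd s) })

evalTest : List Sym → Test → EState → Bool
evalTest w (nonz r) s = not (get r s ≡ᵇ 0)
evalTest w (reads x) s = (w ‼ cpv s) ≡ˢ x
evalTest w (marked b) s = (auxv s ∈ᵇ emarks s) ≡ᵒ b

data Exec (w : List Sym) : Prog → EState → EState → Set where
  e-op : ∀ o {s} → Exec w (op o) s (doOp o s)
  e-seq : ∀ {p q s s' s″} → Exec w p s s' → Exec w q s' s″ → Exec w (p ⨾ q) s s″
  e-ite₁ : ∀ {t p q s s'} → evalTest w t s ≡ true → Exec w p (tick s) s' → Exec w (ite t p q) s s'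
  e-ite₀ : ∀ {t p q s s'} → evalTest w t s ≡ false → Exec w q (tick s) s' → Exec w (ite t p q) s s'
  e-while₁ : ∀ {t p s s' s″} → evalTest w t s ≡ true → Exec w p (tick s) s' → Exec w (while t p) s' s″ → Exec w (while t p) s s″
  e-while₀ : ∀ {t p s} → evalTest w t s ≡ false → Exec w (while t p) s (tick s)

data EInstr (Q : Set) : Set where
  op : Op → Q → EInstr Q
  tst : Test → Q → Q → EInstr Q

-- Program positions become control states of a machine, so there have to be finitely many. Tests
-- occupy a position of their own, sequencing does not.
Pos : Prog → Set
Pos (op _) = ⊤
Pos (p ⨾ q) = Pos p ⊎ Pos q
Pos (ite _ p q) = ⊤ ⊎ (Pos p ⊎ Pos q)
Pos (while _ p) = ⊤ ⊎ Pos p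

finite-Pos : ∀ p → Finite (Pos p)
finite-Pos (op _) = finite-⊤
finite-Pos (p ⨾ q) = finite-⊎ (finite-Pos p) (finite-Pos q)
finite-Pos (ite _ p q) = finite-⊎ finite-⊤ (finite-⊎ (finite-Pos p) (finite-Pos q))
finite-Pos (while _ p) = finite-⊎ finite-⊤ (finite-Pos p)

entry : ∀ p → Pos p
entry (op _) = tt
entry (p ⨾ q) = inj₁ (entry p)
entry (ite _ p q) = inj₁ tt
entry (while _ p) = inj₁ tt

code : ∀ {Q : Set} p → (Pos p → Q) → Q → Pos p → EInstr Q
code (op o) emb k tt = op o k
code (p ⨾ q) emb k (inj₁ x) = code p (λ x → emb (inj₁ x)) (emb (inj₂ (entry q))) x
code (p ⨾ q) emb k (inj₂ y) = code q (λ y → emb (inj₂ y)) k y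
code (ite t p q) emb k (inj₁ tt) = tst t (emb (inj₂ (inj₁ (entry p)))) (emb (inj₂ (inj₂ (entry q))))
code (ite t p q) emb k (inj₂ (inj₁ x)) = code p (λ x → emb (inj₂ (inj₁ x))) k x
code (ite t p q) emb k (inj₂ (inj₂ y)) = code q (λ y → emb (inj₂ (inj₂ y))) k y
code (while t p) emb k (inj₁ tt) = tst t (emb (inj₂ (entry p))) k
code (while t p) emb k (inj₂ x) = code p (λ x → emb (inj₂ x)) (emb (inj₁ tt)) x

module Flat {Q : Set} (I : Q → EInstr Q) (w : List Sym) where

  estep : EInstr Q → EState → Q × EState
  estep (op o q) s = q , doOp o s
  estep (tst t q q') s = (if evalTest w t s then q else q') , tick s

  erun : ℕ → Q × EState → Q × EState
  erun zero c = c
  erun (suc n) (q , s) = erun n (estep (I q) s)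

  erun-+ : ∀ m n c → erun (m + n) c ≡ erun n (erun m c)
  erun-+ zero n c = refl
  erun-+ (suc m) n (q , s) = erun-+ m n (estep (I q) s)

  Contains : ∀ p → (Pos p → Q) → Q → Set
  Contains p emb k = ∀ x → I (emb x) ≡ code p emb k x

  Leads : Q → EState → Q → EState → Set
  Leads q s q' s' = Σ ℕ λ t → time s' ≡ t + time s × erun t (q , s) ≡ (q' , s')

  leads-trans : ∀ {q s q' s' q″ s″} → Leads q s q' s' → Leads q' s' q″ s″ → Leads q s q″ s″
  leads-trans {q} {s} (t , e , r) (t' , e' , r') = t + t' ,
    trans e' (trans (cong (t' +_) e) (trans (sym (+-assoc t' t (time s))) (cong (_+ time s) (+-comm t' t)))) ,
    trans (erun-+ t t' (q , s)) (trans (cong (erun t') r) r')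

  leads-tst : ∀ {q t q₁ q₂ s} b → evalTest w t s ≡ b → I q ≡ tst t q₁ q₂ → Leads q s (if b then q₁ else q₂) (tick s)
  leads-tst {q} {t} {q₁} {q₂} {s} b e i = 1 , refl ,
    trans (cong (λ i → estep i s) i) (cong (λ b → (if b then q₁ else q₂) , tick s) e)

  -- The clock is exact: the compiled program makes precisely as many steps as the clock advances.
  -- The positions of the marks depend on this.
  exec-leads : ∀ {p s s'} → Exec w p s s' → ∀ emb k → Contains p emb k → Leads (emb (entry p)) s k s'
  exec-leads (e-op (inc r)) emb k c = 1 , cong suc (time-set r _ _) , cong (λ i → estep i _) (c tt)
  exec-leads (e-op (dec r)) emb k c = 1 , cong suc (time-set r _ _) , cong (λ i → estep i _) (c tt)
  exec-leads (e-op (zer r)) emb k c = 1 , cong suc (time-set r _ _) , cong (λ i → estep i _) (c tt)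
  exec-leads (e-op mark) emb k c = 1 , refl , cong (λ i → estep i _) (c tt)
  exec-leads (e-op hit) emb k c = 1 , refl , cong (λ i → estep i _) (c tt)
  exec-leads (e-seq x y) emb k c = leads-trans
    (exec-leads x (λ z → emb (inj₁ z)) _ (λ z → c (inj₁ z))) (exec-leads y (λ z → emb (inj₂ z)) k (λ z → c (inj₂ z)))
  exec-leads (e-ite₁ e x) emb k c = leads-trans (leads-tst true e (c (inj₁ tt)))
    (exec-leads x (λ z → emb (inj₂ (inj₁ z))) k (λ z → c (inj₂ (inj₁ z))))
  exec-leads (e-ite₀ e x) emb k c = leads-trans (leads-tst false e (c (inj₁ tt)))
    (exec-leads x (λ z → emb (inj₂ (inj₂ z))) k (λ z → c (inj₂ (inj₂ z))))
  exec-leads (e-while₁ e x y) emb k c = leads-trans (leads-tst true e (c (inj₁ tt)))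
    (leads-trans (exec-leads x (λ z → emb (inj₂ z)) _ (λ z → c (inj₂ z))) (exec-leads y emb k c))
  exec-leads (e-while₀ e) emb k c = leads-tst false e (c (inj₁ tt))

  fnd-step : ∀ i s → fnd s ≤ fnd (proj₂ (estep i s))
  fnd-step (op (inc r) q) s = ≤-reflexive (sym (fnd-set r _ s))
  fnd-step (op (dec r) q) s = ≤-reflexive (sym (fnd-set r _ s))
  fnd-step (op (zer r) q) s = ≤-reflexive (sym (fnd-set r _ s))
  fnd-step (op mark q) s = ≤-refl
  fnd-step (op hit q) s = n≤1+n _
  fnd-step (tst t q q') s = ≤-refl

  -- The cut-off may fall anywhere inside a stage. Monotonicity transfers what is known at the
  -- borders of the stages to that moment.
  fnd-mono : ∀ n c → fnd (proj₂ c) ≤ fnd (proj₂ (erun n c))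
  fnd-mono zero c = ≤-refl
  fnd-mono (suc n) (q , s) = ≤-trans (fnd-step (I q) s) (fnd-mono n (estep (I q) s))

-- `EState` has a stack register for every natural number, a machine only finitely many. The bounds
-- are one more than the largest index that is mentioned.
boundReg : EReg → ℕ
boundReg (stk i) = suc i
boundReg _ = 0

boundOp : Op → ℕ
boundOp (inc r) = boundReg r
boundOp (dec r) = boundReg r
boundOp (zer r) = boundReg r
boundOp _ = 0

boundTest : Test → ℕ
boundTest (nonz r) = boundReg r
boundTest _ = 0

boundInstr : ∀ {Q} → EInstr Q → ℕ
boundInstr (op o _) = boundOp o
boundInstr (tst t _ _) = boundTest t

bound : Prog → ℕ
bound (op o) = boundOp o
bound (p ⨾ q) = bound p ⊔ bound q
bound (ite t p q) = boundTest t ⊔ (bound p ⊔ bound q)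
bound (while t p) = boundTest t ⊔ bound p

code-bounded : ∀ {Q : Set} p (emb : Pos p → Q) k S → bound p ≤ S → ∀ x → boundInstr (code p emb k x) ≤ S
code-bounded (op o) emb k S h x = h
code-bounded (p ⨾ q) emb k S h (inj₁ x) = code-bounded p _ _ S (m⊔n≤o⇒m≤o _ _ h) x
code-bounded (p ⨾ q) emb k S h (inj₂ x) = code-bounded q _ _ S (m⊔n≤o⇒n≤o _ _ h) x
code-bounded (ite t p q) emb k S h (inj₁ tt) = m⊔n≤o⇒m≤o _ _ h
code-bounded (ite t p q) emb k S h (inj₂ (inj₁ x)) = code-bounded p _ _ S (m⊔n≤o⇒m≤o _ _ (m⊔n≤o⇒n≤o (boundTest t) _ h)) x
code-bounded (ite t p q) emb k S h (inj₂ (inj₂ x)) = code-bounded q _ _ S (m⊔n≤o⇒n≤o (bound p) _ (m⊔n≤o⇒n≤o (boundTest t) _ h)) x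
code-bounded (while t p) emb k S h (inj₁ tt) = m⊔n≤o⇒m≤o _ _ h
code-bounded (while t p) emb k S h (inj₂ x) = code-bounded p _ _ S (m⊔n≤o⇒n≤o (boundTest t) _ h) x

-- The registers #in and #out count modulo |w| + 1 and up to |w|, cutting the run off after |w| (|w| + 1) steps.

data Phase : Set where
  work clock look advance rewind carry check verdict reject accept : Phase

phaseIx : Phase → Fin 10
phaseIx work = # 0
phaseIx clock = # 1
phaseIx look = # 2
phaseIx advance = # 3
phaseIx rewind = # 4
phaseIx carry = # 5
phaseIx check = # 6
phaseIx verdict = # 7
phaseIx reject = # 8
phaseIx accept = # 9

finite-Phase : Finite Phase
finite-Phase = finite-retract (finite-Fin 10) phaseIx
  (lookup (work ∷ clock ∷ look ∷ advance ∷ rewind ∷ carry ∷ check ∷ verdict ∷ reject ∷ accept ∷ []))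
  λ { work → refl ; clock → refl ; look → refl ; advance → refl ; rewind → refl ; carry → refl
    ; check → refl ; verdict → refl ; reject → refl ; accept → refl }

pattern #clk = fzero
pattern #in = fsuc fzero
pattern #out = fsuc #in
pattern #fnd = fsuc #out
pattern #cp = fsuc #fnd
pattern #aux = fsuc #cp
pattern #bad = fsuc #aux
pattern #stk i = fsuc (fsuc (fsuc (fsuc (fsuc (fsuc (fsuc i))))))

‼-inside : ∀ (w : List Sym) i → i < length w → is-just (w ‼ i) ≡ true
‼-inside (x ∷ w) zero h = refl
‼-inside (x ∷ w) (suc i) (s≤s h) = ‼-inside w i h

‼-end : ∀ (w : List Sym) → is-just (w ‼ length w) ≡ false
‼-end [] = refl
‼-end (x ∷ w) = ‼-end w

nonzero : ℕ → Bool
nonzero zero = false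
nonzero (suc _) = true

module Clocked {Q : Set} (I : Q → EInstr Q) (S : ℕ) (fits : ∀ q → boundInstr (I q) ≤ S) where

  ix : EReg → Fin (7 + S)
  ix cp = #cp
  ix aux = #aux
  ix bad = #bad
  ix (stk i) with i <? S
  ... | yes i<S = #stk (fromℕ< i<S)
  ... | no _ = fzero

  work-instr : EInstr Q → Instr (7 + S) (Q × Phase)
  work-instr (op (inc r) q) = inc (ix r) (q , clock)
  work-instr (op (dec r) q) = dec (ix r) (q , clock)
  work-instr (op (zer r) q) = zer (ix r) (q , clock)
  -- The clock register is itself a pointer into the tape and already stands on the cell to be
  -- marked.
  work-instr (op mark q) = mrk #clk (q , clock)
  work-instr (op hit q) = inc #fnd (q , clock)
  work-instr (tst (nonz r) q q') = tst (ix r) (λ o _ _ → not o) (q , clock) (q' , clock)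
  work-instr (tst (reads x) q q') = tst #cp (λ _ s _ → s ≡ˢ x) (q , clock) (q' , clock)
  work-instr (tst (marked b) q q') = tst #aux (λ _ _ m → m ≡ᵒ b) (q , clock) (q' , clock)

  clocked : Q × Phase → Instr (7 + S) (Q × Phase)
  clocked (q , work) = work-instr (I q)
  clocked (q , clock) = inc #clk (q , look)
  clocked (q , look) = tst #in (λ _ s _ → is-just s) (q , advance) (q , rewind)
  clocked (q , advance) = inc #in (q , work)
  clocked (q , rewind) = zer #in (q , carry)
  clocked (q , carry) = inc #out (q , check)
  clocked (q , check) = tst #out (λ _ s _ → is-just s) (q , work) (q , verdict)
  clocked (q , verdict) = tst #fnd (λ o _ _ → o) (q , reject) (q , accept)
  clocked (q , reject) = hlt false
  clocked (q , accept) = hlt true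

  image : ℕ → EState → ℕ → ℕ → Fin (7 + S) → ℕ
  image t e i o #clk = t
  image t e i o #in = i
  image t e i o #out = o
  image t e i o #fnd = fnd e
  image t e i o #cp = cpv e
  image t e i o #aux = auxv e
  image t e i o #bad = badv e
  image t e i o (#stk k) = stack e (toℕ k)

  module _ (w : List Sym) where
    open PState
    open PointerMachine clocked w
    open Flat I w

    -- The clock register is compared with `t` instead of `time e`: between an instruction and the
    -- phase `clock` it lags behind by one.
    record Sim (t : ℕ) (e : EState) (i o : ℕ) (p : PState (7 + S)) : Set where
      constructor sim
      field
        regs≡ : ∀ r → reg p r ≡ image t e i o r
        marks≡ : marks p ≡ emarks e
    open Sim

    get-ix : ∀ r → boundReg r ≤ S → ∀ {t e i o} → image t e i o (ix r) ≡ get r e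
    get-ix cp f = refl
    get-ix aux f = refl
    get-ix bad f = refl
    get-ix (stk k) f {e = e} with k <? S
    ... | yes k<S = cong (stack e) (Finₚ.toℕ-fromℕ< k<S)
    ... | no k≮S = ⊥-elim (k≮S f)

    set-ix : ∀ r → boundReg r ≤ S → ∀ v v' {t e i o p} → v ≡ v' → Sim t e i o p → Sim t (set r v' e) i o (pst (reg p [ ix r ↦ v ]) (marks p))
    set-ix cp f v .v refl sm = sim
      (λ { #clk → regs≡ sm #clk ; #in → regs≡ sm #in ; #out → regs≡ sm #out ; #fnd → regs≡ sm #fnd ; #cp → refl
         ; #aux → regs≡ sm #aux ; #bad → regs≡ sm #bad ; (#stk k) → regs≡ sm (#stk k) }) (marks≡ sm)
    set-ix aux f v .v refl sm = sim
      (λ { #clk → regs≡ sm #clk ; #in → regs≡ sm #in ; #out → regs≡ sm #out ; #fnd → regs≡ sm #fnd ; #cp → regs≡ sm #cp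
         ; #aux → refl ; #bad → regs≡ sm #bad ; (#stk k) → regs≡ sm (#stk k) }) (marks≡ sm)
    set-ix bad f v .v refl sm = sim
      (λ { #clk → regs≡ sm #clk ; #in → regs≡ sm #in ; #out → regs≡ sm #out ; #fnd → regs≡ sm #fnd ; #cp → regs≡ sm #cp
         ; #aux → regs≡ sm #aux ; #bad → refl ; (#stk k) → regs≡ sm (#stk k) }) (marks≡ sm)
    set-ix (stk j) f v .v {e = e} {p = p} refl sm with j <? S
    ... | no j≮S = ⊥-elim (j≮S f)
    ... | yes j<S = sim
      (λ { #clk → regs≡ sm #clk ; #in → regs≡ sm #in ; #out → regs≡ sm #out ; #fnd → regs≡ sm #fnd ; #cp → regs≡ sm #cp
         ; #aux → regs≡ sm #aux ; #bad → regs≡ sm #bad ; (#stk k) → lem k }) (marks≡ sm)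
      where
      x : Fin (7 + S)
      x = #stk (fromℕ< j<S)
      lem : ∀ k → (reg p [ x ↦ v ]) (#stk k) ≡ (if j ≡ᵇ toℕ k then v else stack e (toℕ k))
      lem k with j ≟ toℕ k
      ... | yes refl = trans (cong (reg p [ x ↦ v ]) (cong (λ z → #stk z) (sym (Finₚ.fromℕ<-toℕ k j<S))))
              (trans (update-same (reg p) x v) (cong (λ b → if b then v else stack e (toℕ k)) (sym (≡ᵇ-refl (toℕ k)))))
      ... | no j≢k = trans (update-other (reg p) v (λ eq → j≢k (trans (sym (Finₚ.toℕ-fromℕ< j<S)) (cong toℕ (inv eq)))))
              (trans (regs≡ sm (#stk k)) (cong (λ b → if b then v else stack e (toℕ k)) (sym (≢⇒≡ᵇ-false j (toℕ k) j≢k))))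
        where
        inv : ∀ {a b : Fin S} → _≡_ {A = Fin (7 + S)} (#stk a) (#stk b) → a ≡ b
        inv refl = refl

    update-clk : ∀ {t e i o p} → Sim t e i o p → Sim (suc t) e i o (pst (reg p [ #clk ↦ suc (reg p #clk) ]) (marks p))
    update-clk sm = sim
      (λ { #clk → cong suc (regs≡ sm #clk) ; #in → regs≡ sm #in ; #out → regs≡ sm #out ; #fnd → regs≡ sm #fnd ; #cp → regs≡ sm #cp
         ; #aux → regs≡ sm #aux ; #bad → regs≡ sm #bad ; (#stk k) → regs≡ sm (#stk k) }) (marks≡ sm)

    update-in : ∀ {t e i o p} v → Sim t e i o p → Sim t e v o (pst (reg p [ #in ↦ v ]) (marks p))
    update-in v sm = sim
      (λ { #clk → regs≡ sm #clk ; #in → refl ; #out → regs≡ sm #out ; #fnd → regs≡ sm #fnd ; #cp → regs≡ sm #cp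
         ; #aux → regs≡ sm #aux ; #bad → regs≡ sm #bad ; (#stk k) → regs≡ sm (#stk k) }) (marks≡ sm)

    update-out : ∀ {t e i o p} v → Sim t e i o p → Sim t e i v (pst (reg p [ #out ↦ v ]) (marks p))
    update-out v sm = sim
      (λ { #clk → regs≡ sm #clk ; #in → regs≡ sm #in ; #out → refl ; #fnd → regs≡ sm #fnd ; #cp → regs≡ sm #cp
         ; #aux → regs≡ sm #aux ; #bad → regs≡ sm #bad ; (#stk k) → regs≡ sm (#stk k) }) (marks≡ sm)

    update-fnd : ∀ {t e i o p} v → v ≡ suc (fnd e) → Sim t e i o p → Sim t (record e { fnd = suc (fnd e) }) i o (pst (reg p [ #fnd ↦ v ]) (marks p))
    update-fnd v refl sm = sim
      (λ { #clk → regs≡ sm #clk ; #in → regs≡ sm #in ; #out → regs≡ sm #out ; #fnd → refl ; #cp → regs≡ sm #cp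
         ; #aux → regs≡ sm #aux ; #bad → regs≡ sm #bad ; (#stk k) → regs≡ sm (#stk k) }) (marks≡ sm)

    retime : ∀ {t e i o p} t' → Sim t e i o p → Sim t (record e { time = t' }) i o p
    retime t' sm = sim
      (λ { #clk → regs≡ sm #clk ; #in → regs≡ sm #in ; #out → regs≡ sm #out ; #fnd → regs≡ sm #fnd ; #cp → regs≡ sm #cp
         ; #aux → regs≡ sm #aux ; #bad → regs≡ sm #bad ; (#stk k) → regs≡ sm (#stk k) }) (marks≡ sm)

    resim : ∀ {t t' e i i' o o' p} → t ≡ t' → i ≡ i' → o ≡ o' → Sim t e i o p → Sim t' e i' o' p
    resim refl refl refl sm = sm

    branch : ∀ {q₁ q₂ : Q} {p : PState (7 + S)} b
      → inj₁ {B = Bool} ((if b then (q₁ , clock) else (q₂ , clock)) , p) ≡ inj₁ (((if b then q₁ else q₂) , clock) , p)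
    branch true = refl
    branch false = refl

    Worked : Q → EState → ℕ → ℕ → PState (7 + S) → Set
    Worked q e i o p = Σ (PState (7 + S)) λ p' → let c = estep (I q) e in
      exec (work-instr (I q)) p ≡ inj₁ ((proj₁ c , clock) , p') × time (proj₂ c) ≡ suc (time e) × Sim (time e) (proj₂ c) i o p'

    worked : ∀ q {e i o p} → Sim (time e) e i o p → Worked q e i o p
    worked q {e} {i} {o} {p} sm with I q | fits q
    ... | op (inc r) q' | f = _ , refl , cong suc (time-set r _ e) ,
      retime _ (set-ix r f _ _ (cong suc (trans (regs≡ sm (ix r)) (get-ix r f))) sm)
    ... | op (dec r) q' | f = _ , refl , cong suc (time-set r _ e) ,
      retime _ (set-ix r f _ _ (cong pred (trans (regs≡ sm (ix r)) (get-ix r f))) sm)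
    ... | op (zer r) q' | f = _ , refl , cong suc (time-set r _ e) , retime _ (set-ix r f 0 0 refl sm)
    ... | op mark q' | f = _ , refl , refl , retime {e = record e { emarks = time e ∷ emarks e }} _ (sim
      (λ { #clk → regs≡ sm #clk ; #in → regs≡ sm #in ; #out → regs≡ sm #out ; #fnd → regs≡ sm #fnd ; #cp → regs≡ sm #cp
         ; #aux → regs≡ sm #aux ; #bad → regs≡ sm #bad ; (#stk k) → regs≡ sm (#stk k) })
      (cong₂ _∷_ (regs≡ sm #clk) (marks≡ sm)))
    ... | op hit q' | f = _ , refl , refl , retime _ (update-fnd _ (cong suc (regs≡ sm #fnd)) sm)
    ... | tst (nonz r) q₁ q₂ | f = p , trans (cong (λ v → inj₁ ((if not (v ≡ᵇ 0) then (q₁ , clock) else (q₂ , clock)) , p)) (trans (regs≡ sm (ix r)) (get-ix r f)))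
          (branch (not (get r e ≡ᵇ 0))) , refl , retime _ sm
    ... | tst (reads x) q₁ q₂ | f = p , trans (cong (λ v → inj₁ ((if (w ‼ v) ≡ˢ x then (q₁ , clock) else (q₂ , clock)) , p)) (regs≡ sm #cp))
          (branch ((w ‼ cpv e) ≡ˢ x)) , refl , retime _ sm
    ... | tst (marked x) q₁ q₂ | f = p , trans (cong₂ (λ v ms → inj₁ ((if (v ∈ᵇ ms) ≡ᵒ x then (q₁ , clock) else (q₂ , clock)) , p)) (regs≡ sm #aux) (marks≡ sm))
          (branch ((auxv e ∈ᵇ emarks e) ≡ᵒ x)) , refl , retime _ sm

    -- A program step takes four instructions, or six when `#in` wraps around; the verdict at the
    -- end takes two more.
    Result : ℕ → Q → EState → PState (7 + S) → Set
    Result N q e p = Σ ℕ λ n → n ≤ 6 * N + 2 × PRun n ((q , work) , p) (nonzero (fnd (proj₂ (erun N (q , e)))))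

    tested : ∀ {q₁ q₂ : Q × Phase} {p} b b' → b ≡ b' → _≡_ {A = ((Q × Phase) × PState (7 + S)) ⊎ Bool} (inj₁ ((if b then q₁ else q₂) , p)) (inj₁ ((if b' then q₁ else q₂) , p))
    tested b .b refl = refl

    settle : ∀ {q p} f → reg p #fnd ≡ f → PRun 2 ((q , verdict) , p) (nonzero f)
    settle zero h = next (tested _ true (cong (_≡ᵇ 0) h)) (stop refl)
    settle (suc f) h = next (tested _ false (cong (_≡ᵇ 0) h)) (stop refl)

    -- `i` and `o` are the digits of the number of steps made, in base `suc (length w)`, and `a` and
    -- `c` complement them: still to come are the `suc a` steps of the present round and `c` full
    -- rounds.
    clocked-run : ∀ c a q e i o p → i + a ≡ length w → suc (o + c) ≡ length w → Sim (time e) e i o p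
      → Result (c * suc (length w) + suc a) q e p
    clocked-run c (suc a) q e i o p ei eo sm with worked q sm
    ... | p' , ex , te , sm' with clocked-run c a (proj₁ (estep (I q) e)) (proj₂ (estep (I q) e)) (suc i) o
            (pst (reg p″ [ #in ↦ suc (reg p″ #in) ]) (marks p″)) (trans (sym (+-suc i a)) ei) eo
            (resim (sym te) (cong suc (regs≡ sm' #in)) refl (update-in _ (update-clk sm')))
      where p″ = pst (reg p' [ #clk ↦ suc (reg p' #clk) ]) (marks p')
    ... | n , n≤ , r = subst (λ N → Result N q e p) (sym (+-suc (c * suc (length w)) (suc a))) (4 + n ,
      ≤-trans (+-mono-≤ {4} {6} (s≤s (s≤s (s≤s (s≤s z≤n)))) n≤)
        (≤-reflexive (trans (sym (+-assoc 6 (6 * N') 2)) (cong (_+ 2) (sym (*-suc 6 N'))))) ,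
      next ex (next refl (next (tested _ true inside) (next refl r))))
      where
      N' = c * suc (length w) + suc a
      inside : is-just (w ‼ reg p' #in) ≡ true
      inside = trans (cong (λ z → is-just (w ‼ z)) (regs≡ sm' #in)) (‼-inside w i (≤-trans (m≤m+n (suc i) a) (≤-reflexive (trans (sym (+-suc i a)) ei))))
    clocked-run (suc c) zero q e i o p ei eo sm with worked q sm
    ... | p' , ex , te , sm' with clocked-run c (length w) (proj₁ (estep (I q) e)) (proj₂ (estep (I q) e)) 0 (suc o)
            (pst (reg p₃ [ #out ↦ suc (reg p₃ #out) ]) (marks p₃)) refl (trans (cong suc (sym (+-suc o c))) eo)
            (resim (sym te) refl (cong suc (regs≡ sm' #out)) (update-out _ (update-in 0 (update-clk sm'))))
      where
      p₂ = pst (reg p' [ #clk ↦ suc (reg p' #clk) ]) (marks p')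
      p₃ = pst (reg p₂ [ #in ↦ 0 ]) (marks p₂)
    ... | n , n≤ , r = subst (λ N → Result N q e p)
        (trans (cong suc (+-comm (c * suc (length w)) (suc (length w)))) (+-comm 1 (suc c * suc (length w)))) (6 + n ,
      ≤-trans (+-monoʳ-≤ 6 n≤) (≤-reflexive (trans (sym (+-assoc 6 (6 * N') 2)) (cong (_+ 2) (sym (*-suc 6 N'))))) ,
      next ex (next refl (next (tested _ false outside) (next refl (next refl (next (tested _ true inside) r))))))
      where
      N' = c * suc (length w) + suc (length w)
      outside : is-just (w ‼ reg p' #in) ≡ false
      outside = trans (cong (λ z → is-just (w ‼ z)) (trans (regs≡ sm' #in) (trans (sym (+-identityʳ i)) ei))) (‼-end w)
      inside : is-just (w ‼ suc (reg p' #out)) ≡ true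
      inside = trans (cong (λ z → is-just (w ‼ suc z)) (regs≡ sm' #out)) (‼-inside w (suc o) (≤-trans (s≤s (m≤m+n (suc o) c)) (≤-reflexive (trans (cong suc (sym (+-suc o c))) eo))))
    clocked-run zero zero q e i o p ei eo sm with worked q sm
    ... | p' , ex , te , sm' = 8 , ≤-refl ,
      next ex (next refl (next (tested _ false outside) (next refl (next refl (next (tested _ false over) (settle _ (regs≡ sm' #fnd)))))))
      where
      outside : is-just (w ‼ reg p' #in) ≡ false
      outside = trans (cong (λ z → is-just (w ‼ z)) (trans (regs≡ sm' #in) (trans (sym (+-identityʳ i)) ei))) (‼-end w)
      over : is-just (w ‼ suc (reg p' #out)) ≡ false
      over = trans (cong (λ z → is-just (w ‼ z)) (trans (cong suc (trans (regs≡ sm' #out) (sym (+-identityʳ o)))) eo)) (‼-end w)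

    run-clocked : ∀ q e → 1 ≤ length w → time e ≡ 0 → (∀ r → 0 ≡ image 0 e 0 0 r) → emarks e ≡ []
      → Result (length w * suc (length w)) q e (pst (λ _ → 0) [])
    run-clocked q e 1≤w t≡0 r≡ m≡ with length w in eq | 1≤w
    ... | suc ℓ | _ = subst (λ N → Result N q e (pst (λ _ → 0) []))
      (trans (cong (λ z → ℓ * suc z + suc z) eq) (+-comm (ℓ * suc (suc ℓ)) (suc (suc ℓ))))
      (clocked-run ℓ (length w) q e 0 0 (pst (λ _ → 0) []) refl (sym eq)
        (resim (sym t≡0) refl refl (sim r≡ (sym m≡))))

start : EState
start = est (λ _ → 0) 0 0 0 0 [] 0

run-mono : ∀ M t t' c b → t ≤ t' → run M t c ≡ just b → run M t' c ≡ just b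
run-mono M (suc t) (suc t') (conf q ls h rs) b (s≤s t≤) e with TM.δ M q h
... | halt _ = e
... | step q' x mv = run-mono M t t' _ b t≤ e

-- The expansion of `1 + n (2 n + 4)`, the cost of simulating `n` instructions, at
-- `n = 6 ℓ (ℓ + 1) + 2`, the bound on the instructions for `ℓ (ℓ + 1)` program steps.
timePoly : Poly
timePoly = 17 ∷ 72 ∷ 144 ∷ 144 ∷ 72 ∷ []

timePoly-bound : ∀ ℓ → let n = 6 * (ℓ * suc ℓ) + 2 in 1 + n * (n + n + 4) ≡ evalPoly timePoly ℓ
timePoly-bound = solve 1 (λ ℓ → let n = con 6 :* (ℓ :* (con 1 :+ ℓ)) :+ con 2 in
  con 1 :+ n :* (n :+ n :+ con 4) :=
  con 17 :+ ℓ :* (con 72 :+ ℓ :* (con 144 :+ ℓ :* (con 144 :+ ℓ :* (con 72 :+ ℓ :* con 0))))) refl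

-- The exit leads back to the entry: stages follow one another for ever and only the cut-off ends
-- the run.
looping : ∀ p → Pos p → EInstr (Pos p)
looping p = code p (λ x → x) (entry p)

module Decider (p : Prog) where
  open Clocked (looping p) (bound p) (code-bounded p (λ x → x) (entry p) (bound p) ≤-refl)
  open Simulation (finite-× (finite-Pos p) finite-Phase) clocked (entry p , work) using (M; simulates)

  decider : TM
  decider = M

  verdictOf : List Sym → Bool
  verdictOf w = nonzero (fnd (proj₂ (Flat.erun (looping p) w (length w * suc (length w)) (entry p , start))))

  decides : ∀ w → 1 ≤ length w → HaltsWithin decider (evalPoly timePoly (length w)) w (verdictOf w)
  decides w 1≤w with run-clocked w (entry p) start 1≤w refl zeros refl
    where
    zeros : ∀ r → 0 ≡ image 0 start 0 0 r
    zeros #clk = refl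
    zeros #in = refl
    zeros #out = refl
    zeros #fnd = refl
    zeros #cp = refl
    zeros #aux = refl
    zeros #bad = refl
    zeros (#stk _) = refl
  ... | n , n≤ , pr with simulates w n _ pr
  ... | t , t≤ , h = run-mono M t _ _ _ (≤-trans t≤ (≤-trans (s≤s (*-mono-≤ n≤ (+-monoˡ-≤ 4 (+-mono-≤ n≤ n≤))))
        (≤-reflexive (timePoly-bound (length w))))) h

-- Programs on a stack of counters, with exact running times

open EState

-- The vector lists the stack from the top, whereas registers are numbered from the bottom, so
-- pushing renumbers nothing. All registers above the top are 0; hence a 0 can be pushed without an
-- instruction.
bot : ∀ {n} → Vec ℕ n → ℕ → ℕ
bot [] i = 0
bot {suc n} (x ∷ ρ) i = if n ≡ᵇ i then x else bot ρ i

_⊨_ : ∀ {n} → EState → Vec ℕ n → Set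
s ⊨ ρ = ∀ i → stack s i ≡ bot ρ i

record Frame (s s' : EState) : Set where
  constructor frame
  field
    cp≡ : cpv s' ≡ cpv s
    aux≡ : auxv s' ≡ auxv s
    bad≡ : badv s' ≡ badv s
    fnd≡ : fnd s' ≡ fnd s
    marks≡ : emarks s' ≡ emarks s

frame-trans : ∀ {s s' s″} → Frame s s' → Frame s' s″ → Frame s s″
frame-trans (frame a b c d e) (frame a' b' c' d' e') =
  frame (trans a' a) (trans b' b) (trans c' c) (trans d' d) (trans e' e)

-- The cost is not allowed to depend on the input word, since names will be read off the clock.
record Tri (p : Prog) {n n'} (ρ : Vec ℕ n) (ρ' : Vec ℕ n') : Set where
  constructor tri
  field
    cost : ℕ
    runs : ∀ w s → s ⊨ ρ → Σ EState λ s' → Exec w p s s' × s' ⊨ ρ' × Frame s s' × time s' ≡ cost + time s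
open Tri

tri-seq : ∀ {p q n n' n″} {ρ : Vec ℕ n} {ρ' : Vec ℕ n'} {ρ″ : Vec ℕ n″} → Tri p ρ ρ' → Tri q ρ' ρ″ → Tri (p ⨾ q) ρ ρ″
tri-seq P Q .cost = cost Q + cost P
tri-seq P Q .runs w s h with runs P w s h
... | s' , e , h' , f , t with runs Q w s' h'
... | s″ , e' , h″ , f' , t' = s″ , e-seq e e' , h″ , frame-trans f f' ,
  trans t' (trans (cong (cost Q +_) t) (sym (+-assoc (cost Q) (cost P) (time s))))

tri-pre : ∀ {p n m n'} {ρ : Vec ℕ n} {σ : Vec ℕ m} {ρ' : Vec ℕ n'} → (∀ i → bot ρ i ≡ bot σ i) → Tri p σ ρ' → Tri p ρ ρ'
tri-pre h P .cost = cost P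
tri-pre h P .runs w s m = runs P w s (λ i → trans (m i) (h i))

tri-post : ∀ {p n m n'} {ρ : Vec ℕ n} {σ : Vec ℕ m} {ρ' : Vec ℕ n'} → (∀ i → bot σ i ≡ bot ρ' i) → Tri p ρ σ → Tri p ρ ρ'
tri-post h P .cost = cost P
tri-post h P .runs w s m with runs P w s m
... | s' , e , m' , r = s' , e , (λ i → trans (m' i) (h i)) , r

bot-zero : ∀ {n} (ρ : Vec ℕ n) i → n ≤ i → bot ρ i ≡ 0
bot-zero [] i _ = refl
bot-zero {suc n} (x ∷ ρ) i n<i rewrite ≢⇒≡ᵇ-false n i (<⇒≢ n<i) = bot-zero ρ i (<⇒≤ n<i)

push-zero : ∀ {n} (ρ : Vec ℕ n) i → bot ρ i ≡ bot (0 ∷ ρ) i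
push-zero {n} ρ i with n ≟ i
... | yes refl rewrite ≡ᵇ-refl n = bot-zero ρ n ≤-refl
... | no ne rewrite ≢⇒≡ᵇ-false n i ne = refl

bot-get : ∀ {m n} (xs : Vec ℕ m) x (ρ : Vec ℕ n) → bot (xs ++ x ∷ ρ) n ≡ x
bot-get {n = n} [] x ρ rewrite ≡ᵇ-refl n = refl
bot-get {suc m} {n} (y ∷ xs) x ρ
  rewrite ≢⇒≡ᵇ-false (m + suc n) n (λ e → m+1+n≢m n {m} (trans (trans (+-suc n m) (trans (cong suc (+-comm n m)) (sym (+-suc m n)))) e)) = bot-get xs x ρ

bot-put : ∀ {m n} (xs : Vec ℕ m) v x (ρ : Vec ℕ n) i → (if n ≡ᵇ i then v else bot (xs ++ x ∷ ρ) i) ≡ bot (xs ++ v ∷ ρ) i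
bot-put {n = n} xs v x ρ i with n ≟ i
bot-put {n = n} xs v x ρ .n | yes refl rewrite ≡ᵇ-refl n = sym (bot-get xs v ρ)
bot-put {m} {n} xs v x ρ i | no ne rewrite ≢⇒≡ᵇ-false n i ne = same xs
  where
  same : ∀ {m} (xs : Vec ℕ m) → bot (xs ++ x ∷ ρ) i ≡ bot (xs ++ v ∷ ρ) i
  same [] rewrite ≢⇒≡ᵇ-false n i ne = refl
  same {suc m} (y ∷ xs) = cong (if (m + suc n) ≡ᵇ i then y else_) (same xs)

module _ {m n} (xs : Vec ℕ m) (x : ℕ) (ρ : Vec ℕ n) where

  set-at : ∀ (f : ℕ → ℕ) o → (∀ s → doOp o s ≡ tick (set (stk n) (f (stack s n)) s)) → Tri (op o) (xs ++ x ∷ ρ) (xs ++ f x ∷ ρ)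
  set-at f o ho .cost = 1
  set-at f o ho .runs w s h = tick (set (stk n) (f (stack s n)) s) , subst (Exec w (op o) s) (ho s) (e-op o) ,
    (λ i → trans (cong₂ (λ v u → if n ≡ᵇ i then v else u) (cong f (trans (h n) (bot-get xs x ρ))) (h i)) (bot-put xs (f x) x ρ i)) ,
    frame refl refl refl refl refl , refl

  inc-at : Tri (op (inc (stk n))) (xs ++ x ∷ ρ) (xs ++ suc x ∷ ρ)
  inc-at = set-at suc _ (λ _ → refl)

  dec-at : Tri (op (dec (stk n))) (xs ++ x ∷ ρ) (xs ++ pred x ∷ ρ)
  dec-at = set-at pred _ (λ _ → refl)

  zer-at : Tri (op (zer (stk n))) (xs ++ x ∷ ρ) (xs ++ 0 ∷ ρ)
  zer-at = set-at (λ _ → 0) _ (λ _ → refl)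

  test-at : ∀ w s → s ⊨ (xs ++ x ∷ ρ) → evalTest w (nonz (stk n)) s ≡ not (x ≡ᵇ 0)
  test-at w s h = cong (λ v → not (v ≡ᵇ 0)) (trans (h n) (bot-get xs x ρ))

  ite-at : ∀ {p q n'} {ρ' : Vec ℕ n'} → (x ≢ 0 → Tri p (xs ++ x ∷ ρ) ρ') → (x ≡ 0 → Tri q (xs ++ x ∷ ρ) ρ')
    → Tri (ite (nonz (stk n)) p q) (xs ++ x ∷ ρ) ρ'
  ite-at P Q with x ≟ 0
  ... | yes e = tri (suc (cost (Q e))) λ w s h → let s' , ex , h' , f , t = runs (Q e) w (tick s) h in
    s' , e-ite₀ (trans (test-at w s h) (cong (λ v → not (v ≡ᵇ 0)) e)) ex , h' ,
    frame-trans (frame refl refl refl refl refl) f , trans t (+-suc (cost (Q e)) (time s))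
  ... | no ne = tri (suc (cost (P ne))) λ w s h → let s' , ex , h' , f , t = runs (P ne) w (tick s) h in
    s' , e-ite₁ (trans (test-at w s h) (cong not (≢⇒≡ᵇ-false x 0 ne))) ex , h' ,
    frame-trans (frame refl refl refl refl refl) f , trans t (+-suc (cost (P ne)) (time s))

while-done : ∀ {m n p} (xs : Vec ℕ m) (ρ : Vec ℕ n) → Tri (while (nonz (stk n)) p) (xs ++ 0 ∷ ρ) (xs ++ 0 ∷ ρ)
while-done xs ρ .cost = 1
while-done xs ρ .runs w s h = tick s , e-while₀ (test-at xs 0 ρ w s h) , h , frame refl refl refl refl refl , refl

while-step : ∀ {m n p k k'} (xs : Vec ℕ m) x (ρ : Vec ℕ n) {ρ' : Vec ℕ k} {ρ″ : Vec ℕ k'} → Tri p (xs ++ suc x ∷ ρ) ρ'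
  → Tri (while (nonz (stk n)) p) ρ' ρ″ → Tri (while (nonz (stk n)) p) (xs ++ suc x ∷ ρ) ρ″
while-step xs x ρ P L .cost = suc (cost L + cost P)
while-step xs x ρ P L .runs w s h with runs P w (tick s) h
... | s' , e , h' , f , t with runs L w s' h'
... | s″ , e' , h″ , f' , t' = s″ , e-while₁ (test-at xs (suc x) ρ w s h) e e' , h″ ,
  frame-trans (frame refl refl refl refl refl) (frame-trans f f') ,
  trans t' (trans (cong (cost L +_) t) (trans (sym (+-assoc (cost L) (cost P) (suc (time s)))) (+-suc (cost L + cost P) (time s))))

-- After a call the result lies on top of a value that is no longer wanted.
nip : ℕ → Prog
nip d = op (zer (stk d)) ⨾ while (nonz (stk (suc d))) (op (dec (stk (suc d))) ⨾ op (inc (stk d)))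

nip-tri : ∀ {d} r x (τ : Vec ℕ d) → Tri (nip d) (r ∷ x ∷ τ) (r ∷ τ)
nip-tri {d} r x τ = tri-post (λ i → sym (push-zero (r ∷ τ) i))
  (tri-seq (zer-at (r ∷ []) x τ) (subst (λ v → Tri L (r ∷ 0 ∷ τ) (0 ∷ v ∷ τ)) (+-identityʳ r) (move r 0)))
  where
  L = while (nonz (stk (suc d))) (op (dec (stk (suc d))) ⨾ op (inc (stk d)))
  move : ∀ r y → Tri L (r ∷ y ∷ τ) (0 ∷ r + y ∷ τ)
  move zero y = while-done [] (y ∷ τ)
  move (suc r) y = while-step [] r (y ∷ τ) (tri-seq (dec-at [] (suc r) (y ∷ τ)) (inc-at (r ∷ []) y τ))
    (subst (λ v → Tri L (r ∷ suc y ∷ τ) (0 ∷ v ∷ τ)) (+-suc r y) (move r (suc y)))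

data Split : ∀ {d} → Vec ℕ d → ℕ → Set where
  split : ∀ {m a} (xs : Vec ℕ m) x (ρ : Vec ℕ a) → Split (xs ++ x ∷ ρ) a

splitAtReg : ∀ {d} (τ : Vec ℕ d) a → a < d → Split τ a
splitAtReg {suc d} (y ∷ τ) a a<d with a ≟ d
... | yes refl = split [] y τ
... | no ne with splitAtReg τ a (≤∧≢⇒< (≤-pred a<d) ne)
... | split xs x ρ = split (y ∷ xs) x ρ

-- A counter can be read only by emptying it. Its value therefore goes into two fresh counters, one
-- of which restores the source.
copy : ℕ → ℕ → Prog
copy a d = while (nonz (stk a)) (op (dec (stk a)) ⨾ op (inc (stk d)) ⨾ op (inc (stk (suc d))))
  ⨾ while (nonz (stk (suc d))) (op (dec (stk (suc d))) ⨾ op (inc (stk a)))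

copy-tri : ∀ {d} (τ : Vec ℕ d) a → a < d → Tri (copy a d) τ (bot τ a ∷ τ)
copy-tri τ a a<d with splitAtReg τ a a<d
... | split {m} xs x ρ = tri-pre (λ i → trans (push-zero τ' i) (push-zero (0 ∷ τ') i))
  (tri-post (λ i → trans (sym (push-zero (x + 0 ∷ τ') i)) (cong (λ v → bot (v ∷ τ') i) (trans (+-identityʳ x) (sym (bot-get xs x ρ)))))
    (tri-seq (out x 0 0) (subst (λ v → Tri L₂ (x + 0 ∷ x + 0 ∷ xs ++ 0 ∷ ρ) (0 ∷ x + 0 ∷ xs ++ v ∷ ρ)) (trans (+-identityʳ _) (+-identityʳ x)) (home (x + 0) (x + 0) 0))))
  where
  d = m + suc a
  τ' = xs ++ x ∷ ρ
  L₁ = while (nonz (stk a)) (op (dec (stk a)) ⨾ op (inc (stk d)) ⨾ op (inc (stk (suc d))))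
  L₂ = while (nonz (stk (suc d))) (op (dec (stk (suc d))) ⨾ op (inc (stk a)))
  out : ∀ x y z → Tri L₁ (z ∷ y ∷ xs ++ x ∷ ρ) (x + z ∷ x + y ∷ xs ++ 0 ∷ ρ)
  out zero y z = while-done (z ∷ y ∷ xs) ρ
  out (suc x) y z = while-step (z ∷ y ∷ xs) x ρ
    (tri-seq (dec-at (z ∷ y ∷ xs) (suc x) ρ) (tri-seq (inc-at (z ∷ []) y (xs ++ x ∷ ρ)) (inc-at [] z (suc y ∷ xs ++ x ∷ ρ))))
    (subst₂ (λ u v → Tri L₁ (suc z ∷ suc y ∷ xs ++ x ∷ ρ) (u ∷ v ∷ xs ++ 0 ∷ ρ)) (+-suc x z) (+-suc x y) (out x (suc y) (suc z)))
  home : ∀ z y x → Tri L₂ (z ∷ y ∷ xs ++ x ∷ ρ) (0 ∷ y ∷ xs ++ z + x ∷ ρ)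
  home zero y x = while-done [] (y ∷ xs ++ x ∷ ρ)
  home (suc z) y x = while-step [] z (y ∷ xs ++ x ∷ ρ)
    (tri-seq (dec-at [] (suc z) (y ∷ xs ++ x ∷ ρ)) (inc-at (z ∷ y ∷ xs) x ρ))
    (subst (λ v → Tri L₂ (z ∷ y ∷ xs ++ suc x ∷ ρ) (0 ∷ y ∷ xs ++ v ∷ ρ)) (+-suc z x) (home z y (suc x)))

-- Number functions computed by programs

-- as lists the registers holding the variables of ρ.
record Agree {d n} (τ : Vec ℕ d) (as ρ : Vec ℕ n) : Set where
  constructor mkAgree
  field
    agree : ∀ i → lookup as i < d × bot τ (lookup as i) ≡ lookup ρ i
open Agree

agree-push : ∀ {d n} {τ : Vec ℕ d} {as ρ : Vec ℕ n} x → Agree τ as ρ → Agree (x ∷ τ) as ρ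
agree-push {d} {τ = τ} {as} x (mkAgree h) .agree i = m<n⇒m<1+n (proj₁ (h i)) ,
  trans (cong (λ b → if b then x else bot τ (lookup as i)) (≢⇒≡ᵇ-false d _ (λ e → <⇒≢ (proj₁ (h i)) (sym e)))) (proj₂ (h i))

agree-bind : ∀ {d n} {τ : Vec ℕ d} {as ρ : Vec ℕ n} x → Agree τ as ρ → Agree (x ∷ τ) (d ∷ as) (x ∷ ρ)
agree-bind {d} {τ = τ} x h .agree fzero = n<1+n d , cong (λ b → if b then x else bot τ d) (≡ᵇ-refl d)
agree-bind x h .agree (fsuc i) = agree (agree-push x h) i

-- Programs are attached directly to functions, without a syntax of recursive functions in between.
-- `prog as d` pushes the value on a stack of height `d` in which the registers `as` hold the
-- arguments.
record Comp {n} (f : Vec ℕ n → ℕ) : Set where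
  constructor comp
  field
    prog : Vec ℕ n → ℕ → Prog
    ok : ∀ {d} (τ : Vec ℕ d) as ρ → Agree τ as ρ → Tri (prog as d) τ (f ρ ∷ τ)
open Comp

extC : ∀ {n} {f g : Vec ℕ n → ℕ} → (∀ ρ → f ρ ≡ g ρ) → Comp f → Comp g
extC e F .prog = prog F
extC e F .ok τ as ρ h = subst (λ v → Tri _ τ (v ∷ τ)) (e ρ) (ok F τ as ρ h)

varC : ∀ {n} (i : Fin n) → Comp (λ ρ → lookup ρ i)
varC i .prog as d = copy (lookup as i) d
varC i .ok τ as ρ (mkAgree h) = subst (λ v → Tri _ τ (v ∷ τ)) (proj₂ (h i)) (copy-tri τ (lookup as i) (proj₁ (h i)))

zeroC : ∀ {n} → Comp {n} (λ _ → 0)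
zeroC .prog as d = op (zer (stk d))
zeroC .ok τ as ρ h = tri-pre (push-zero τ) (zer-at [] 0 τ)

sucC : ∀ {n} {f : Vec ℕ n → ℕ} → Comp f → Comp (λ ρ → suc (f ρ))
sucC F .prog as d = prog F as d ⨾ op (inc (stk d))
sucC F .ok τ as ρ h = tri-seq (ok F τ as ρ h) (inc-at [] _ τ)

predC : ∀ {n} {f : Vec ℕ n → ℕ} → Comp f → Comp (λ ρ → pred (f ρ))
predC F .prog as d = prog F as d ⨾ op (dec (stk d))
predC F .ok τ as ρ h = tri-seq (ok F τ as ρ h) (dec-at [] _ τ)

ifz : ℕ → ℕ → ℕ → ℕ
ifz zero a b = a
ifz (suc _) a b = b

ifzC : ∀ {n} {c f g : Vec ℕ n → ℕ} → Comp c → Comp f → Comp g → Comp (λ ρ → ifz (c ρ) (f ρ) (g ρ))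
ifzC C F G .prog as d = prog C as d ⨾ ite (nonz (stk d)) (op (zer (stk d)) ⨾ prog G as d) (prog F as d)
ifzC {c = c} {f} {g} C F G .ok τ as ρ h = tri-seq (ok C τ as ρ h) (ite-at [] (c ρ) τ yes! no!)
  where
  yes! : c ρ ≢ 0 → Tri _ (c ρ ∷ τ) (ifz (c ρ) (f ρ) (g ρ) ∷ τ)
  yes! ne with c ρ
  ... | zero = ⊥-elim (ne refl)
  ... | suc k = tri-seq (zer-at [] (suc k) τ) (tri-pre (λ i → sym (push-zero τ i)) (ok G τ as ρ h))
  no! : c ρ ≡ 0 → Tri _ (c ρ ∷ τ) (ifz (c ρ) (f ρ) (g ρ) ∷ τ)
  no! e rewrite e = tri-pre (λ i → sym (push-zero τ i)) (ok F τ as ρ h)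

letC : ∀ {n} {f : Vec ℕ n → ℕ} {h : Vec ℕ (suc n) → ℕ} → Comp f → Comp h → Comp (λ ρ → h (f ρ ∷ ρ))
letC F H .prog as d = prog F as d ⨾ prog H (d ∷ as) (suc d) ⨾ nip d
letC F H .ok τ as ρ h = tri-seq (ok F τ as ρ h) (tri-seq (ok H _ _ _ (agree-bind _ h)) (nip-tri _ _ τ))

wkC : ∀ {n} {f : Vec ℕ n → ℕ} → Comp f → Comp (λ (ρ : Vec ℕ (suc n)) → f (tail ρ))
wkC F .prog (a ∷ as) d = prog F as d
wkC F .ok τ (a ∷ as) (x ∷ ρ) h = ok F τ as ρ (mkAgree (λ i → agree h (fsuc i)))

renC : ∀ {m n} {h : Vec ℕ m → ℕ} → Comp h → (is : Vec (Fin n) m) → Comp (λ ρ → h (Vec.map (lookup ρ) is))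
renC H is .prog as d = prog H (Vec.map (lookup as) is) d
renC H is .ok τ as ρ h = ok H τ _ _ (mkAgree λ i → subst₂ (λ a v → a < _ × bot τ a ≡ v)
  (sym (Vecₚ.lookup-map i (lookup as) is)) (sym (Vecₚ.lookup-map i (lookup ρ) is)) (agree h (lookup is i)))

-- The index given to the body counts down, because it is the loop counter itself.
loop : (ℕ → ℕ → ℕ) → ℕ → ℕ → ℕ
loop h zero a = a
loop h (suc k) a = loop h k (h a k)

loopC : ∀ {n} {f g : Vec ℕ n → ℕ} {h : Vec ℕ (2 + n) → ℕ} → Comp f → Comp g → Comp h
  → Comp (λ ρ → loop (λ a k → h (a ∷ k ∷ ρ)) (f ρ) (g ρ))
loopC F G H .prog as d = prog F as d ⨾ prog G as (suc d)
  ⨾ while (nonz (stk d)) (op (dec (stk d)) ⨾ prog H (suc d ∷ d ∷ as) (2 + d) ⨾ nip (suc d)) ⨾ nip d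
loopC {f = f} {g} {h} F G H .ok {d} τ as ρ ag = tri-seq (ok F τ as ρ ag) (tri-seq (ok G _ as ρ (agree-push _ ag))
  (tri-seq (body (f ρ) (g ρ)) (nip-tri _ 0 τ)))
  where
  body : ∀ k a → Tri (while (nonz (stk d)) (op (dec (stk d)) ⨾ prog H (suc d ∷ d ∷ as) (2 + d) ⨾ nip (suc d)))
    (a ∷ k ∷ τ) (loop (λ a k → h (a ∷ k ∷ ρ)) k a ∷ 0 ∷ τ)
  body zero a = while-done (a ∷ []) τ
  body (suc k) a = while-step (a ∷ []) k τ
    (tri-seq (dec-at (a ∷ []) (suc k) τ) (tri-seq (ok H _ _ _ (agree-bind a (agree-bind k ag))) (nip-tri _ a (k ∷ τ))))
    (body k (h (a ∷ k ∷ ρ)))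

muC : ∀ {n} {h : Vec ℕ (suc n) → ℕ} (f : Vec ℕ n → ℕ) → (∀ ρ → h (f ρ ∷ ρ) ≡ 0) → (∀ ρ i → i < f ρ → h (i ∷ ρ) ≢ 0)
  → Comp h → Comp f
muC f z nz H .prog as d = op (zer (stk d)) ⨾ prog H (d ∷ as) (suc d)
  ⨾ while (nonz (stk (suc d))) (op (zer (stk (suc d))) ⨾ op (inc (stk d)) ⨾ prog H (d ∷ as) (suc d))
muC {h = h} f z nz H .ok {d} τ as ρ ag = tri-seq (tri-pre (push-zero τ) (zer-at [] 0 τ))
  (tri-seq (eval 0) (search (f ρ) 0 (+-identityʳ (f ρ))))
  where
  eval : ∀ i → Tri (prog H (d ∷ as) (suc d)) (i ∷ τ) (h (i ∷ ρ) ∷ i ∷ τ)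
  eval i = ok H (i ∷ τ) (d ∷ as) (i ∷ ρ) (agree-bind i ag)
  L = while (nonz (stk (suc d))) (op (zer (stk (suc d))) ⨾ op (inc (stk d)) ⨾ prog H (d ∷ as) (suc d))
  search : ∀ k i → k + i ≡ f ρ → Tri L (h (i ∷ ρ) ∷ i ∷ τ) (f ρ ∷ τ)
  search zero i refl = subst (λ v → Tri L (v ∷ i ∷ τ) (i ∷ τ)) (sym (z ρ))
    (tri-post (λ j → sym (push-zero (i ∷ τ) j)) (while-done [] (i ∷ τ)))
  search (suc k) i e with h (i ∷ ρ) in eh
  ... | zero = ⊥-elim (nz ρ i (≤-trans (m≤n+m (suc i) k) (≤-reflexive (trans (+-suc k i) e))) eh)
  ... | suc v = while-step [] v (i ∷ τ)
    (tri-seq (zer-at [] (suc v) (i ∷ τ)) (tri-seq (inc-at (0 ∷ []) i τ)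
      (tri-pre (λ j → sym (push-zero (suc i ∷ τ) j)) (eval (suc i)))))
    (search k (suc i) (trans (+-suc k i) e))

-- Calls, iteration, and codes of pairs, lists and finite tables

open Finite

record Comp₁ (f : ℕ → ℕ) : Set where
  constructor fn₁
  field
    body₁ : Comp {1} (λ v → f (head v))

record Comp₂ (f : ℕ → ℕ → ℕ) : Set where
  constructor fn₂
  field
    body₂ : Comp {2} (λ v → f (head v) (head (tail v)))

call₁ : ∀ {n f} {g : Vec ℕ n → ℕ} → Comp₁ f → Comp g → Comp (λ ρ → f (g ρ))
call₁ (fn₁ F) G = letC G (renC F (fzero ∷ []))

call₂ : ∀ {n f} {g h : Vec ℕ n → ℕ} → Comp₂ f → Comp g → Comp h → Comp (λ ρ → f (g ρ) (h ρ))
call₂ (fn₂ F) G H = letC G (letC (wkC H) (renC F (fsuc fzero ∷ fzero ∷ [])))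

v₀ : ∀ {n} → Comp {1 + n} (λ ρ → head ρ)
v₀ = extC (λ { (x ∷ _) → refl }) (varC fzero)

v₁ : ∀ {n} → Comp {2 + n} (λ ρ → head (tail ρ))
v₁ = extC (λ { (_ ∷ x ∷ _) → refl }) (varC (fsuc fzero))

v₂ : ∀ {n} → Comp {3 + n} (λ ρ → head (tail (tail ρ)))
v₂ = extC (λ { (_ ∷ _ ∷ x ∷ _) → refl }) (varC (fsuc (fsuc fzero)))

iter : (ℕ → ℕ) → ℕ → ℕ → ℕ
iter f zero a = a
iter f (suc k) a = f (iter f k a)

iter-comm : ∀ f k a → iter f k (f a) ≡ f (iter f k a)
iter-comm f zero a = refl
iter-comm f (suc k) a = cong f (iter-comm f k a)

loop-iter : ∀ f k a → loop (λ x _ → f x) k a ≡ iter f k a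
loop-iter f zero a = refl
loop-iter f (suc k) a = trans (loop-iter f k (f a)) (iter-comm f k a)

iterC : ∀ {n} {f g : Vec ℕ n → ℕ} {h : Vec ℕ (suc n) → ℕ} → Comp f → Comp g → Comp h
  → Comp (λ ρ → iter (λ a → h (a ∷ ρ)) (f ρ) (g ρ))
iterC {f = f} {g} {h} F G H = extC (λ ρ → loop-iter (λ a → h (a ∷ ρ)) (f ρ) (g ρ))
  (loopC {h = λ v → h (head v ∷ tail (tail v))} F G H')
  where
  H' : Comp (λ v → h (head v ∷ tail (tail v)))
  H' .Comp.prog (a ∷ _ ∷ as) d = Comp.prog H (a ∷ as) d
  H' .Comp.ok τ (a ∷ _ ∷ as) (x ∷ _ ∷ ρ) (mkAgree g) =
    Comp.ok H τ (a ∷ as) (x ∷ ρ) (mkAgree λ { fzero → g fzero ; (fsuc i) → g (fsuc (fsuc i)) })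

constC : ∀ {n} k → Comp {n} (λ _ → k)
constC zero = zeroC
constC (suc k) = sucC (constC k)

iter-suc : ∀ k a → iter suc k a ≡ k + a
iter-suc zero a = refl
iter-suc (suc k) a = cong suc (iter-suc k a)

iter-pred : ∀ k a → iter pred k a ≡ a ∸ k
iter-pred zero a = refl
iter-pred (suc k) a = trans (cong pred (iter-pred k a)) (pred[m∸n]≡m∸[1+n] a k)

addC : ∀ {n} {f g : Vec ℕ n → ℕ} → Comp f → Comp g → Comp (λ ρ → f ρ + g ρ)
addC {f = f} {g} F G = extC (λ ρ → iter-suc (f ρ) (g ρ)) (iterC F G (sucC v₀))

monusC : ∀ {n} {f g : Vec ℕ n → ℕ} → Comp f → Comp g → Comp (λ ρ → f ρ ∸ g ρ)
monusC {f = f} {g} F G = extC (λ ρ → iter-pred (g ρ) (f ρ)) (iterC G F (predC v₀))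

-- Cantor pairing

triangle : ℕ → ℕ
triangle zero = 0
triangle (suc s) = suc s + triangle s

triangle-mono : ∀ {s t} → s ≤ t → triangle s ≤ triangle t
triangle-mono z≤n = z≤n
triangle-mono (s≤s h) = +-mono-≤ (s≤s h) (triangle-mono h)

s≤triangle : ∀ s → s ≤ triangle s
s≤triangle zero = z≤n
s≤triangle (suc s) = m≤m+n (suc s) (triangle s)

loop-triangle : ∀ s a → loop (λ a k → a + suc k) s a ≡ a + triangle s
loop-triangle zero a = sym (+-identityʳ a)
loop-triangle (suc s) a = trans (loop-triangle s (a + suc s)) (+-assoc a (suc s) (triangle s))

triangleC : Comp₁ triangle
triangleC = fn₁ (extC (λ { (x ∷ []) → loop-triangle x 0 }) (loopC v₀ zeroC (addC v₀ (sucC v₁))))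

-- A step towards the largest `s` with `triangle s ≤ n`. This `s` is the sum of the two components
-- of the pair coded by `n`, and `n` steps reach it because `s ≤ triangle s`.
grow : ℕ → ℕ → ℕ
grow n s = ifz (triangle (suc s) ∸ n) (suc s) s

diagonal : ℕ → ℕ
diagonal n = iter (grow n) n 0

grow-diagonal : ∀ s y k i → y ≤ s → i ≤ s → s ≤ i + k → iter (grow (triangle s + y)) k i ≡ s
grow-diagonal s y zero i y≤s i≤s s≤i = ≤-antisym i≤s (subst (s ≤_) (+-identityʳ i) s≤i)
grow-diagonal s y (suc k) i y≤s i≤s s≤ = trans (sym (iter-comm (grow n) k i)) (go (m≤n⇒m<n∨m≡n i≤s))
  where
  n = triangle s + y
  go : i < s ⊎ i ≡ s → iter (grow n) k (grow n i) ≡ s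
  go (inj₁ i<s) rewrite m≤n⇒m∸n≡0 {triangle (suc i)} {n} (≤-trans (triangle-mono i<s) (m≤m+n (triangle s) y)) =
    grow-diagonal s y k (suc i) y≤s i<s (subst (s ≤_) (+-suc i k) s≤)
  go (inj₂ refl) with triangle (suc i) ∸ n in e
  ... | zero = ⊥-elim (<-irrefl refl (≤-trans (s≤s (+-monoˡ-≤ (triangle i) y≤s))
      (≤-trans (m∸n≡0⇒m≤n e) (≤-reflexive (+-comm (triangle i) y)))))
  ... | suc _ = grow-diagonal i y k i y≤s i≤s (m≤m+n i k)

diagonal-correct : ∀ s y → y ≤ s → diagonal (triangle s + y) ≡ s
diagonal-correct s y y≤s = grow-diagonal s y (triangle s + y) 0 y≤s z≤n (≤-trans (s≤triangle s) (m≤m+n (triangle s) y))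

diagonalC : Comp₁ diagonal
diagonalC = fn₁ (iterC v₀ zeroC (ifzC (monusC (call₁ triangleC (sucC v₀)) v₁) (sucC v₀) v₀))

opaque
  pr : ℕ → ℕ → ℕ
  pr x y = triangle (x + y) + y

  π₂ : ℕ → ℕ
  π₂ n = n ∸ triangle (diagonal n)

  π₁ : ℕ → ℕ
  π₁ n = diagonal n ∸ π₂ n

  π₂-pr : ∀ x y → π₂ (pr x y) ≡ y
  π₂-pr x y rewrite diagonal-correct (x + y) y (m≤n+m y x) = m+n∸m≡n (triangle (x + y)) y

  π₁-pr : ∀ x y → π₁ (pr x y) ≡ x
  π₁-pr x y rewrite π₂-pr x y | diagonal-correct (x + y) y (m≤n+m y x) = m+n∸n≡m x y

  decompose : ∀ n → Σ ℕ λ s → Σ ℕ λ y → y ≤ s × n ≡ triangle s + y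
  decompose zero = 0 , 0 , z≤n , refl
  decompose (suc n) with decompose n
  ... | s , y , y≤s , e with m≤n⇒m<n∨m≡n y≤s
  ... | inj₁ y<s = s , suc y , y<s , trans (cong suc e) (sym (+-suc (triangle s) y))
  ... | inj₂ refl = suc y , 0 , z≤n , trans (cong suc (trans e (+-comm (triangle y) y))) (sym (+-identityʳ _))

  pr-surj : ∀ n → Σ ℕ λ x → Σ ℕ λ y → pr x y ≡ n
  pr-surj n with decompose n
  ... | s , y , y≤s , e = s ∸ y , y , trans (cong (λ z → triangle z + y) (m∸n+n≡m y≤s)) (sym e)

  x≤pr : ∀ x y → x ≤ pr x y
  x≤pr x y = ≤-trans (m≤m+n x y) (≤-trans (s≤triangle (x + y)) (m≤m+n _ y))

  y≤pr : ∀ x y → y ≤ pr x y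
  y≤pr x y = m≤n+m y (triangle (x + y))

  pr-mono : ∀ {x x' y y'} → x ≤ x' → y ≤ y' → pr x y ≤ pr x' y'
  pr-mono hx hy = +-mono-≤ (triangle-mono (+-mono-≤ hx hy)) hy

  pr00 : pr 0 0 ≡ 0
  pr00 = refl

  prC : ∀ {n} {f g : Vec ℕ n → ℕ} → Comp f → Comp g → Comp (λ ρ → pr (f ρ) (g ρ))
  prC F G = addC (call₁ triangleC (addC F G)) G

  π₂C : ∀ {n} {f : Vec ℕ n → ℕ} → Comp f → Comp (λ ρ → π₂ (f ρ))
  π₂C F = monusC F (call₁ triangleC (call₁ diagonalC F))

  π₁C : ∀ {n} {f : Vec ℕ n → ℕ} → Comp f → Comp (λ ρ → π₁ (f ρ))
  π₁C F = monusC (call₁ diagonalC F) (π₂C F)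

-- Lists of numbers as numbers

cons : ℕ → ℕ → ℕ
cons x u = suc (pr x u)

hd tl : ℕ → ℕ
hd u = π₁ (pred u)
tl u = π₂ (pred u)

consC : ∀ {n} {f g : Vec ℕ n → ℕ} → Comp f → Comp g → Comp (λ ρ → cons (f ρ) (g ρ))
consC F G = sucC (prC F G)

hdC : ∀ {n} {f : Vec ℕ n → ℕ} → Comp f → Comp (λ ρ → hd (f ρ))
hdC F = π₁C (predC F)

tlC : ∀ {n} {f : Vec ℕ n → ℕ} → Comp f → Comp (λ ρ → tl (f ρ))
tlC F = π₂C (predC F)

hd-cons : ∀ x u → hd (cons x u) ≡ x
hd-cons = π₁-pr

tl-cons : ∀ x u → tl (cons x u) ≡ u
tl-cons = π₂-pr

-- The empty list reads like a list of zeros. Since the blank has code 0, a head running off the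
-- stored part of the tape finds a blank without any case distinction.
hd-0 : hd 0 ≡ 0
hd-0 = trans (cong π₁ (sym pr00)) (π₁-pr 0 0)

tl-0 : tl 0 ≡ 0
tl-0 = trans (cong π₂ (sym pr00)) (π₂-pr 0 0)

⌜_⌝ : List ℕ → ℕ
⌜ xs ⌝ = foldr cons 0 xs

⌜⌝-surj : ∀ n → Acc _<_ n → Σ (List ℕ) λ xs → ⌜ xs ⌝ ≡ n
⌜⌝-surj zero _ = [] , refl
⌜⌝-surj (suc n) (acc rs) with pr-surj n
... | x , y , refl with ⌜⌝-surj y (rs (s≤s (y≤pr x y)))
... | xs , e = x ∷ xs , cong (cons x) e

unlist : ℕ → List ℕ
unlist n = proj₁ (⌜⌝-surj n (<-wellFounded n))

⌜unlist⌝ : ∀ n → ⌜ unlist n ⌝ ≡ n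
⌜unlist⌝ n = proj₂ (⌜⌝-surj n (<-wellFounded n))

⌜⌝-injective : ∀ xs ys → ⌜ xs ⌝ ≡ ⌜ ys ⌝ → xs ≡ ys
⌜⌝-injective [] [] e = refl
⌜⌝-injective (x ∷ xs) (y ∷ ys) e = cong₂ _∷_
  (trans (sym (hd-cons x _)) (trans (cong hd e) (hd-cons y _)))
  (⌜⌝-injective xs ys (trans (sym (tl-cons x _)) (trans (cong tl e) (tl-cons y _))))

unlist-⌜⌝ : ∀ xs → unlist ⌜ xs ⌝ ≡ xs
unlist-⌜⌝ xs = ⌜⌝-injective _ _ (⌜unlist⌝ ⌜ xs ⌝)

length≤⌜⌝ : ∀ xs → length xs ≤ ⌜ xs ⌝
length≤⌜⌝ [] = z≤n
length≤⌜⌝ (x ∷ xs) = s≤s (≤-trans (length≤⌜⌝ xs) (y≤pr x _))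

-- The list code itself serves as an upper bound for the number of iterations.
foldStep : (ℕ → ℕ → ℕ) → ℕ → ℕ
foldStep h st = ifz (π₁ st) st (pr (tl (π₁ st)) (h (hd (π₁ st)) (π₂ st)))

foldlN : (ℕ → ℕ → ℕ) → ℕ → ℕ → ℕ
foldlN h z u = π₂ (iter (foldStep h) u (pr u z))

foldlN-correct : ∀ h z xs → foldlN h z ⌜ xs ⌝ ≡ foldl (λ a x → h x a) z xs
foldlN-correct h z xs = trans (cong π₂ (go xs z ⌜ xs ⌝ (length≤⌜⌝ xs))) (π₂-pr 0 _)
  where
  step-nil : ∀ z → foldStep h (pr 0 z) ≡ pr 0 z
  step-nil z rewrite π₁-pr 0 z = refl
  step-cons : ∀ x u z → foldStep h (pr (cons x u) z) ≡ pr u (h x z)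
  step-cons x u z rewrite π₁-pr (cons x u) z | π₂-pr (cons x u) z | tl-cons x u | hd-cons x u = refl
  go : ∀ xs z k → length xs ≤ k → iter (foldStep h) k (pr ⌜ xs ⌝ z) ≡ pr 0 (foldl (λ a x → h x a) z xs)
  go [] z zero _ = refl
  go [] z (suc k) _ = trans (cong (foldStep h) (go [] z k z≤n)) (step-nil z)
  go (x ∷ xs) z (suc k) (s≤s l) = trans (sym (iter-comm (foldStep h) k _))
    (trans (cong (iter (foldStep h) k) (step-cons x ⌜ xs ⌝ z)) (go xs (h x z) k l))

foldlC : ∀ {n} {f g : Vec ℕ n → ℕ} {h : Vec ℕ (2 + n) → ℕ} → Comp f → Comp g → Comp h
  → Comp (λ ρ → foldlN (λ x a → h (x ∷ a ∷ ρ)) (f ρ) (g ρ))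
foldlC {h = h} F G H = π₂C (iterC G (prC G F)
  (extC {g = λ v → foldStep (λ x a → h (x ∷ a ∷ tail v)) (head v)} (λ { (_ ∷ _) → refl }) (ifzC (π₁C v₀) v₀ (prC (tlC (π₁C v₀)) (letC (π₂C v₀) (letC (hdC (π₁C v₁)) H'))))))
  where
  H' : Comp (λ v → h (head v ∷ head (tail v) ∷ tail (tail (tail v))))
  H' .Comp.prog (a ∷ b ∷ _ ∷ as) d = Comp.prog H (a ∷ b ∷ as) d
  H' .Comp.ok τ (a ∷ b ∷ _ ∷ as) (x ∷ y ∷ _ ∷ ρ) (mkAgree g) =
    Comp.ok H τ (a ∷ b ∷ as) (x ∷ y ∷ ρ) (mkAgree λ { fzero → g fzero ; (fsuc fzero) → g (fsuc fzero) ; (fsuc (fsuc i)) → g (fsuc (fsuc (fsuc i))) })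

rev : ℕ → ℕ
rev u = foldlN cons 0 u

rev-⌜⌝ : ∀ xs → rev ⌜ xs ⌝ ≡ ⌜ reverse xs ⌝
rev-⌜⌝ xs = trans (foldlN-correct cons 0 xs)
  (trans (sym (cong (foldl (λ a x → cons x a) 0) (Listₚ.reverse-involutive xs))) (Listₚ.reverse-foldl (λ a x → cons x a) 0 (reverse xs)))

revC : Comp₁ rev
revC = fn₁ (foldlC zeroC v₀ (consC v₀ v₁))

foldrN : (ℕ → ℕ → ℕ) → ℕ → ℕ → ℕ
foldrN h z u = foldlN h z (rev u)

foldrN-correct : ∀ h z xs → foldrN h z ⌜ xs ⌝ ≡ foldr h z xs
foldrN-correct h z xs = trans (cong (foldlN h z) (rev-⌜⌝ xs))
  (trans (foldlN-correct h z (reverse xs)) (Listₚ.reverse-foldl (λ a x → h x a) z xs))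

foldrC : ∀ {n} {f g : Vec ℕ n → ℕ} {h : Vec ℕ (2 + n) → ℕ} → Comp f → Comp g → Comp h
  → Comp (λ ρ → foldrN (λ x a → h (x ∷ a ∷ ρ)) (f ρ) (g ρ))
foldrC F G H = foldlC F (call₁ revC G) H

switch : ∀ {k} → (Fin k → ℕ) → ℕ → ℕ
switch {zero} b i = 0
switch {suc k} b zero = b fzero
switch {suc k} b (suc i) = switch (λ j → b (fsuc j)) i

switch-toℕ : ∀ {k} (b : Fin k → ℕ) i → switch b (toℕ i) ≡ b i
switch-toℕ b fzero = refl
switch-toℕ b (fsuc i) = switch-toℕ (λ j → b (fsuc j)) i

switchC : ∀ {n k} {b : Fin k → Vec ℕ n → ℕ} {f : Vec ℕ n → ℕ} → (∀ i → Comp (b i)) → Comp f → Comp (λ ρ → switch (λ i → b i ρ) (f ρ))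
switchC {k = zero} B F = zeroC
switchC {k = suc k} {b} {f} B F = extC lem (ifzC F (B fzero) (switchC (λ i → B (fsuc i)) (predC F)))
  where
  lem : ∀ ρ → ifz (f ρ) (b fzero ρ) (switch (λ i → b (fsuc i) ρ) (pred (f ρ))) ≡ switch (λ i → b i ρ) (f ρ)
  lem ρ with f ρ
  ... | zero = refl
  ... | suc _ = refl

least : (p : ℕ → ℕ) → ∀ n → p n ≡ 0 → Σ ℕ λ m → p m ≡ 0 × (∀ i → i < m → p i ≢ 0)
least p zero e = 0 , e , λ _ ()
least p (suc n) e with p 0 in e₀
... | zero = 0 , e₀ , λ _ ()
... | suc _ with least (λ i → p (suc i)) n e
... | m , em , h = suc m , em , λ { zero _ e' → 0≢1+n (trans (sym e') e₀) ; (suc i) (s≤s l) → h i l }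

-- Arithmetisation of Turing machines

-- Turing machine runs on codes; the value 0 stands for true

bit : Bool → ℕ
bit true = 0
bit false = 1

bit-true : ∀ b → bit b ≡ 0 → b ≡ true
bit-true true _ = refl

module Run (M : TM) where
  open TM M

  finΓ : Finite (Γ nExtra)
  finΓ = finite-Maybe (finite-⊎ finite-Sym (finite-Fin nExtra))

  γ : Γ nExtra → ℕ
  γ g = toℕ (encode finΓ g)

  confCode : ℕ → ℕ → ℕ → ℕ → ℕ
  confCode q ls h rs = pr q (pr ls (pr h rs))

  -- Tag 1 says that the run goes on; a halted run is `pr 0` of its answer. The tag is thus the
  -- quantity whose first zero is the halting time.
  running : ℕ → ℕ → ℕ → ℕ → ℕ
  running q ls h rs = pr 1 (confCode q ls h rs)

  after : Action nStates nExtra → ℕ → ℕ → ℕ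
  after (halt b) ls rs = pr 0 (bit b)
  -- An empty left side means the left end, where the head stays on the cell just written.
  after (step q w left) ls rs = ifz ls (running (toℕ q) 0 (γ w) rs) (running (toℕ q) (tl ls) (hd ls) (cons (γ w) rs))
  after (step q w right) ls rs = running (toℕ q) (cons (γ w) ls) (hd rs) (tl rs)

  afterC : ∀ {n} {f g : Vec ℕ n → ℕ} a → Comp f → Comp g → Comp (λ ρ → after a (f ρ) (g ρ))
  afterC (halt b) F G = prC zeroC (constC (bit b))
  afterC (step q w left) F G = ifzC F
    (prC (constC 1) (prC (constC (toℕ q)) (prC zeroC (prC (constC (γ w)) G))))
    (prC (constC 1) (prC (constC (toℕ q)) (prC (tlC F) (prC (hdC F) (consC (constC (γ w)) G)))))
  afterC (step q w right) F G =
    prC (constC 1) (prC (constC (toℕ q)) (prC (consC (constC (γ w)) F) (prC (hdC G) (tlC G))))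

  advance-conf : ℕ → ℕ
  advance-conf c = switch (λ q → switch (λ h → after (δ q (decode finΓ h)) (π₁ (π₂ c)) (π₂ (π₂ (π₂ c)))) (π₁ (π₂ (π₂ c)))) (π₁ c)

  stepN : ℕ → ℕ
  stepN st = ifz (π₁ st) st (advance-conf (π₂ st))

  stepC : ∀ {n} {f : Vec ℕ n → ℕ} → Comp f → Comp (λ ρ → stepN (f ρ))
  stepC F = ifzC (π₁C F) F (switchC (λ q → switchC (λ h → afterC (δ q (decode finΓ h)) (π₁C (π₂C c)) (π₂C (π₂C (π₂C c)))) (π₁C (π₂C (π₂C c)))) (π₁C c))
    where c = π₂C F

  stepN-halted : ∀ x → stepN (pr 0 x) ≡ pr 0 x
  stepN-halted x rewrite π₁-pr 0 x = refl

  stepN-running : ∀ q ls h rs → stepN (running (toℕ q) ls (γ h) rs) ≡ after (δ q h) ls rs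
  stepN-running q ls h rs
    rewrite π₁-pr 1 (confCode (toℕ q) ls (γ h) rs) | π₂-pr 1 (confCode (toℕ q) ls (γ h) rs)
          | π₁-pr (toℕ q) (pr ls (pr (γ h) rs)) | π₂-pr (toℕ q) (pr ls (pr (γ h) rs))
          | π₁-pr ls (pr (γ h) rs) | π₂-pr ls (pr (γ h) rs) | π₁-pr (γ h) rs | π₂-pr (γ h) rs
    = trans (switch-toℕ _ q) (trans (switch-toℕ _ (encode finΓ h)) (cong (λ g → after (δ q g) ls rs) (decode-encode finΓ h)))

  tapeCode : List (Γ nExtra) → ℕ
  tapeCode xs = ⌜ lmap γ xs ⌝

  configCode : Config M → ℕ
  configCode (conf q ls h rs) = running (toℕ q) (tapeCode ls) (γ h) (tapeCode rs)

  after-step : ∀ q w mv ls rs → after (step q w mv) (tapeCode ls) (tapeCode rs) ≡ configCode (moveHead {M} q ls w rs mv)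
  after-step q w left [] rs = refl
  after-step q w left (l ∷ ls) rs rewrite tl-cons (γ l) (tapeCode ls) | hd-cons (γ l) (tapeCode ls) = refl
  after-step q w right [] [] rewrite hd-0 | tl-0 = refl
  after-step q w right (l ∷ ls) [] rewrite hd-0 | tl-0 = refl
  after-step q w right [] (r ∷ rs) rewrite hd-cons (γ r) (tapeCode rs) | tl-cons (γ r) (tapeCode rs) = refl
  after-step q w right (l ∷ ls) (r ∷ rs) rewrite hd-cons (γ r) (tapeCode rs) | tl-cons (γ r) (tapeCode rs) = refl

  status : Maybe Bool → ℕ → Set
  status nothing st = π₁ st ≡ 1
  status (just b) st = st ≡ pr 0 (bit b)

  run-status : ∀ t c → status (run M t c) (iter stepN t (configCode c))
  run-status zero (conf q ls h rs) = π₁-pr 1 _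
  run-status (suc t) (conf q ls h rs)
    rewrite sym (iter-comm stepN t (configCode (conf q ls h rs))) | stepN-running q (tapeCode ls) h (tapeCode rs) with δ q h
  ... | halt b = stays t
    where
    stays : ∀ t → iter stepN t (pr 0 (bit b)) ≡ pr 0 (bit b)
    stays zero = refl
    stays (suc t) = trans (cong stepN (stays t)) (stepN-halted (bit b))
  ... | step q' w mv rewrite after-step q' w mv ls rs = run-status t (moveHead {M} q' ls w rs mv)

  symCode : Sym → ℕ
  symCode s = γ (just (inj₁ s))

  initN : ℕ → ℕ
  initN u = running 0 0 (hd u) (tl u)

  initN-correct : ∀ w → initN ⌜ lmap symCode w ⌝ ≡ configCode (initConfig M w)
  initN-correct [] rewrite hd-0 | tl-0 = refl
  initN-correct (x ∷ w) rewrite hd-cons (symCode x) ⌜ lmap symCode w ⌝ | tl-cons (symCode x) ⌜ lmap symCode w ⌝ =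
    cong (λ xs → running 0 0 (symCode x) ⌜ xs ⌝) (Listₚ.map-∘ w)

  -- A machine may diverge on words that code no admissible input, while every function here is
  -- total. Where `guard` is not 0 the search stops at once and the answer is 1, that is, false.
  module Answer {n} {word guard : Vec ℕ n → ℕ} (wordC : Comp word) (guardC : Comp guard)
    (halts : ∀ ρ → guard ρ ≡ 0 → Σ (List Sym) λ w → Σ Bool λ b → word ρ ≡ ⌜ lmap symCode w ⌝ × Halts M w b) where

    state : ℕ → Vec ℕ n → ℕ
    state t ρ = iter stepN t (initN (word ρ))

    unfinished : Vec ℕ (suc n) → ℕ
    unfinished ρ = ifz (guard (tail ρ)) (π₁ (state (head ρ) (tail ρ))) 0

    unfinishedC : Comp unfinished
    unfinishedC = ifzC (wkC guardC) (π₁C (iterC v₀ (prC (constC 1) (prC zeroC (prC zeroC (prC (hdC (wkC wordC)) (tlC (wkC wordC)))))) (stepC v₀))) zeroC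

    state-correct : ∀ ρ w t → word ρ ≡ ⌜ lmap symCode w ⌝ → status (run M t (initConfig M w)) (state t ρ)
    state-correct ρ w t e = subst (λ c → status (run M t (initConfig M w)) (iter stepN t c))
      (sym (trans (cong initN e) (initN-correct w))) (run-status t (initConfig M w))

    finishes : ∀ ρ → Σ ℕ λ t → unfinished (t ∷ ρ) ≡ 0
    finishes ρ with guard ρ in eg
    ... | suc _ = 0 , refl
    ... | zero with halts ρ eg
    ... | w , b , ew , t , h = t , trans (cong π₁ (subst (λ r → status r (state t ρ)) h (state-correct ρ w t ew))) (π₁-pr 0 (bit b))

    haltTime : Vec ℕ n → ℕ
    haltTime ρ = proj₁ (least (λ t → unfinished (t ∷ ρ)) (proj₁ (finishes ρ)) (proj₂ (finishes ρ)))

    haltTimeC : Comp haltTime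
    haltTimeC = muC haltTime
      (λ ρ → proj₁ (proj₂ (least (λ t → unfinished (t ∷ ρ)) (proj₁ (finishes ρ)) (proj₂ (finishes ρ)))))
      (λ ρ → proj₂ (proj₂ (least (λ t → unfinished (t ∷ ρ)) (proj₁ (finishes ρ)) (proj₂ (finishes ρ)))))
      unfinishedC

    answer : Vec ℕ n → ℕ
    answer ρ = ifz (guard ρ) (π₂ (state (haltTime ρ) ρ)) 1

    answerC : Comp answer
    answerC = ifzC guardC (π₂C (iterC haltTimeC (prC (constC 1) (prC zeroC (prC zeroC (prC (hdC wordC) (tlC wordC))))) (stepC v₀))) (constC 1)

    run-unique : ∀ t t' c b b' → run M t c ≡ just b → run M t' c ≡ just b' → b ≡ b'
    run-unique (suc t) (suc t') (conf q ls h rs) b b' e e' with δ q h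
    run-unique (suc t) (suc t') (conf q ls h rs) b .b refl refl | halt .b = refl
    ... | step q' w mv = run-unique t t' (moveHead {M} q' ls w rs mv) b b' e e'

    answer-correct : ∀ ρ w b → guard ρ ≡ 0 → word ρ ≡ ⌜ lmap symCode w ⌝ → Halts M w b → answer ρ ≡ bit b
    answer-correct ρ w b eg ew (t , h) = trans (cong (λ g → ifz g (π₂ st) 1) eg)
      (value (run M (haltTime ρ) (initConfig M w)) refl (state-correct ρ w (haltTime ρ) ew))
      where
      st = state (haltTime ρ) ρ
      done : π₁ st ≡ 0
      done = trans (sym (cong (λ g → ifz g (π₁ st) 0) eg)) (proj₁ (proj₂ (least (λ t → unfinished (t ∷ ρ)) (proj₁ (finishes ρ)) (proj₂ (finishes ρ)))))
      value : ∀ r → run M (haltTime ρ) (initConfig M w) ≡ r → status r st → π₂ st ≡ bit b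
      value (just b') er e = trans (trans (cong π₂ e) (π₂-pr 0 (bit b'))) (cong bit (run-unique (haltTime ρ) t (initConfig M w) b' b er h))
      value nothing er e = ⊥-elim (0≢1+n (trans (sym done) e))

    answer-unguarded : ∀ ρ {g} → guard ρ ≡ suc g → answer ρ ≡ 1
    answer-unguarded ρ eg = cong (λ g → ifz g (π₂ (state (haltTime ρ) ρ)) 1) eg

-- Paths in an injective tree and the choice of the nodes

toList-unique : ∀ {A : Set} {m n} (v : Vec A m) (v' : Vec A n) → toList v ≡ toList v' → Σ (m ≡ n) λ e → subst (Vec A) e v ≡ v'
toList-unique [] [] e = refl , refl
toList-unique (x ∷ v) (y ∷ v') e with toList-unique v v' (Listₚ.∷-injectiveʳ e) | Listₚ.∷-injectiveˡ e
... | refl , refl | refl = refl , refl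

Unique-lookup : ∀ {A : Set} {xs : List A} → Unique xs → ∀ i j → List.lookup xs i ≡ List.lookup xs j → i ≡ j
Unique-lookup (_ ∷ _) fzero fzero _ = refl
Unique-lookup {xs = _ ∷ xs} (p ∷ _) fzero (fsuc j) e = ⊥-elim (All.lookup p (∈-lookup j) e)
Unique-lookup {xs = _ ∷ xs} (p ∷ _) (fsuc i) fzero e = ⊥-elim (All.lookup p (∈-lookup i) (sym e))
Unique-lookup (_ ∷ u) (fsuc i) (fsuc j) e = cong fsuc (Unique-lookup u i j e)

-- The pigeonhole principle: sending a position to its entry is an injection of finite sets.
Unique-bounded : ∀ {xs N} → Unique xs → All (_< N) xs → length xs ≤ N
Unique-bounded {xs} {N} u b = Finₚ.injective⇒≤ {f = f} λ {i} {j} e → Unique-lookup u i j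
  (trans (sym (Finₚ.toℕ-fromℕ< (bd i))) (trans (cong toℕ e) (Finₚ.toℕ-fromℕ< (bd j))))
  where
  bd : ∀ i → List.lookup xs i < N
  bd i = All.lookup b (∈-lookup i)
  f : Fin (length xs) → Fin N
  f i = fromℕ< (bd i)

sum-zero : ∀ m {n} → m + n ≡ 0 → m ≡ 0 × n ≡ 0
sum-zero zero e = refl , e

parity : List ℕ → ℕ
parity = foldr (λ _ a → 1 ∸ a) 0

strict⇒mono : ∀ {f : ℕ → ℕ} → (∀ {i j} → i < j → f i < f j) → ∀ {i j} → i ≤ j → f i ≤ f j
strict⇒mono h i≤j with m≤n⇒m<n∨m≡n i≤j
... | inj₁ i<j = <⇒≤ (h i<j)
... | inj₂ refl = ≤-refl

strict⇒injective : ∀ {f : ℕ → ℕ} → (∀ {i j} → i < j → f i < f j) → ∀ i j → f i ≡ f j → i ≡ j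
strict⇒injective h i j e with <-cmp i j
... | tri< i<j _ _ = ⊥-elim (<⇒≢ (h i<j) e)
... | tri≈ _ i≡j _ = i≡j
... | tri> _ _ j<i = ⊥-elim (<⇒≢ (h j<i) (sym e))

-- Index inj₁ j stands for the node b j, index inj₂ k for the node c k below.
Ix : Set
Ix = ℕ ⊎ ℕ

level : Ix → ℕ
level (inj₁ j) = j
level (inj₂ k) = k

module Tree (S : PrefixTree ℕ) (computable : Computable S) (injective : Injective S) (unbounded : UnboundedDepth S) where
  open PrefixTree S

  Path : List ℕ → Set
  Path xs = Σ ℕ λ n → Σ (Vec ℕ (suc n)) λ v → toList v ≡ xs × R n v

  path-vec : ∀ {n} (v : Vec ℕ (suc n)) → Path (toList v) → R n v
  path-vec v (n' , v' , e , r) with toList-unique v' v e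
  ... | refl , refl = r

  path-prefix : ∀ xs ys → 0 < length xs → Path (xs +++ ys) → Path xs
  path-prefix (x ∷ xs) ys _ p = length xs , x ∷ fromList xs , cong (x ∷_) (Vecₚ.toList∘fromList xs) ,
    prefix (length xs) (length ys) (x ∷ fromList xs) (fromList ys) (path-vec (x ∷ fromList xs ++ fromList ys) (subst Path (sym e) p))
    where
    e : toList (x ∷ fromList xs ++ fromList ys) ≡ x ∷ xs +++ ys
    e = cong (x ∷_) (trans (Vecₚ.toList-++ (fromList xs) (fromList ys)) (cong₂ _+++_ (Vecₚ.toList∘fromList xs) (Vecₚ.toList∘fromList ys)))

  path-injective : ∀ as bs c → Path (as +++ c ∷ []) → Path (bs +++ c ∷ []) → as ≡ bs
  path-injective as bs c p q with injective (length as) (length bs) (fromList as) (fromList bs) c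
      (path-vec (fromList as ∷ʳ c) (subst Path (sym (e as)) p)) (path-vec (fromList bs ∷ʳ c) (subst Path (sym (e bs)) q))
    where
    e : ∀ as → toList (fromList as ∷ʳ c) ≡ as +++ c ∷ []
    e as = trans (Vecₚ.toList-∷ʳ c (fromList as)) (cong (_+++ c ∷ []) (Vecₚ.toList∘fromList as))
  ... | eq , h = trans (sym (Vecₚ.toList∘fromList as)) (trans (same eq (fromList as) (fromList bs) h) (Vecₚ.toList∘fromList bs))
    where
    same : ∀ {m n} (e : m ≡ n) (v : Vec ℕ m) (v' : Vec ℕ n) → subst (Vec ℕ) e v ≡ v' → toList v ≡ toList v'
    same refl v .v refl = refl

  path-dom : ∀ {xs} → Path xs → All Dom xs
  path-dom (n , v , refl , r) = VAllₚ.toList⁺ (R-dom n v r)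

  -- Paths read from the last node back to the root.
  RPath : List ℕ → Set
  RPath xs = Path (reverse xs)

  rpath-nonempty : ¬ RPath []
  rpath-nonempty (n , x ∷ v , () , r)

  rpath-suffix : ∀ xs y zs → RPath (xs +++ y ∷ zs) → RPath (y ∷ zs)
  rpath-suffix xs y zs p = path-prefix (reverse (y ∷ zs)) (reverse xs)
    (subst (0 <_) (sym (Listₚ.length-reverse (y ∷ zs))) (s≤s z≤n)) (subst Path (Listₚ.reverse-++ xs (y ∷ zs)) p)

  rpath-injective : ∀ c as bs → RPath (c ∷ as) → RPath (c ∷ bs) → as ≡ bs
  rpath-injective c as bs p q = Listₚ.reverse-injective (path-injective (reverse as) (reverse bs) c
    (subst Path (Listₚ.unfold-reverse c as) p) (subst Path (Listₚ.unfold-reverse c bs) q))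

  -- The part of the path from the root to `x` is again a path ending in `x`, and by injectivity
  -- there is only one.
  rpath-suffix-unique : ∀ zs x as → RPath zs → x ∈ zs → RPath (x ∷ as) → Σ (List ℕ) λ pre → zs ≡ pre +++ x ∷ as
  rpath-suffix-unique zs x as p x∈ q with ∈-∃++ x∈
  ... | pre , bs , refl = pre , cong (λ l → pre +++ x ∷ l) (rpath-injective x bs as (rpath-suffix pre x bs p) q)

  -- A second occurrence of `x` would give two paths to `x`, one of them a proper part of the other.
  rpath-head∉ : ∀ {x} as → RPath (x ∷ as) → ¬ x ∈ as
  rpath-head∉ {x} as p x∈ with ∈-∃++ x∈
  ... | pre , bs , refl with rpath-injective x (pre +++ x ∷ bs) bs p (rpath-suffix (x ∷ pre) x bs p)
  ... | e = m+1+n≢n (length pre) {length bs} (trans (sym (Listₚ.length-++ pre {x ∷ bs})) (cong length e))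

  -- Together with the pigeonhole principle this bounds the length of a path whose nodes lie below a
  -- given number.
  rpath-unique : ∀ zs → RPath zs → Unique zs
  rpath-unique [] p = []
  rpath-unique (x ∷ []) p = [] ∷ []
  rpath-unique (x ∷ y ∷ zs) p = All.tabulate (λ z∈ e → rpath-head∉ (y ∷ zs) p (subst (_∈ y ∷ zs) (sym e) z∈))
    ∷ rpath-unique (y ∷ zs) (rpath-suffix (x ∷ []) y zs p)

  rpath-dom : ∀ zs → RPath zs → ∀ {x} → x ∈ zs → Dom x
  rpath-dom zs p x∈ = All.lookup (path-dom p) (reverse⁺ x∈)

  -- Decision procedures; the value 0 means that the property holds

  Mdom Mrel : TM
  Mdom = proj₁ computable
  Mrel = proj₁ (proj₂ computable)

  module RunDom = Run Mdom
  module RunRel = Run Mrel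

  iter-replicate : ∀ x k zs → iter (cons x) k ⌜ zs ⌝ ≡ ⌜ replicate k x +++ zs ⌝
  iter-replicate x zero zs = refl
  iter-replicate x (suc k) zs = cong (cons x) (iter-replicate x k zs)

  domWord : Vec ℕ 1 → ℕ
  domWord ρ = iter (cons (RunDom.symCode s1)) (head ρ) 0

  domWord-correct : ∀ x → domWord (x ∷ []) ≡ ⌜ lmap RunDom.symCode (encℕ x) ⌝
  domWord-correct x = trans (iter-replicate _ x []) (cong ⌜_⌝ (trans (Listₚ.++-identityʳ _) (sym (Listₚ.map-replicate RunDom.symCode x s1))))

  domWordC : Comp domWord
  domWordC = iterC v₀ zeroC (consC (constC (RunDom.symCode s1)) v₀)

  dom-halts : ∀ ρ → 0 ≡ 0 → Σ (List Sym) λ w → Σ Bool λ b → domWord ρ ≡ ⌜ lmap RunDom.symCode w ⌝ × Halts Mdom w b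
  dom-halts (x ∷ []) _ = let b , h , _ = proj₁ (proj₂ (proj₂ computable)) x in encℕ x , b , domWord-correct x , h

  module DomAnswer = RunDom.Answer domWordC zeroC dom-halts

  opaque
    domN : ℕ → ℕ
    domN x = DomAnswer.answer (x ∷ [])

    domC : Comp₁ domN
    domC = fn₁ (extC (λ { (x ∷ []) → refl }) DomAnswer.answerC)

    domN-sound : ∀ x → domN x ≡ 0 → Dom x
    domN-sound x e = let b , h , i = proj₁ (proj₂ (proj₂ computable)) x in
      proj₁ i (bit-true b (trans (sym (DomAnswer.answer-correct (x ∷ []) (encℕ x) b refl (domWord-correct x) h)) e))

    domN-complete : ∀ x → Dom x → domN x ≡ 0
    domN-complete x d = let b , h , i = proj₁ (proj₂ (proj₂ computable)) x in
      trans (DomAnswer.answer-correct (x ∷ []) (encℕ x) b refl (domWord-correct x) h) (cong bit (proj₂ i d))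

  allDom : ℕ → ℕ
  allDom = foldrN (λ x a → domN x + a) 0

  allDomC : Comp₁ allDom
  allDomC = fn₁ (foldrC zeroC v₀ (addC (call₁ domC v₀) v₁))

  allDom-sound : ∀ xs → allDom ⌜ xs ⌝ ≡ 0 → All Dom xs
  allDom-sound xs e = sound xs (trans (sym (foldrN-correct _ 0 xs)) e)
    where
    sound : ∀ xs → foldr (λ x a → domN x + a) 0 xs ≡ 0 → All Dom xs
    sound [] e = []
    sound (x ∷ xs) e = let e₁ , e₂ = sum-zero (domN x) e in domN-sound x e₁ ∷ sound xs e₂

  allDom-complete : ∀ {xs} → All Dom xs → allDom ⌜ xs ⌝ ≡ 0
  allDom-complete {xs} ds = trans (foldrN-correct _ 0 xs) (complete ds)
    where
    complete : ∀ {xs} → All Dom xs → foldr (λ x a → domN x + a) 0 xs ≡ 0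
    complete [] = refl
    complete {x ∷ _} (d ∷ ds) rewrite domN-complete x d = complete ds

  query : List ℕ → List Sym
  query xs = replicate (length xs) sa +++ concatMap (λ x → sd ∷ encℕ x) xs

  code-sa code-sd code-s1 : ℕ
  code-sa = RunRel.symCode sa
  code-sd = RunRel.symCode sd
  code-s1 = RunRel.symCode s1

  queryN : ℕ → ℕ
  queryN u = foldrN (λ _ a → cons code-sa a) (foldrN (λ x a → cons code-sd (iter (cons code-s1) x a)) 0 u) u

  queryC : ∀ {n} {f : Vec ℕ n → ℕ} → Comp f → Comp (λ ρ → queryN (f ρ))
  queryC F = foldrC (foldrC zeroC F (consC (constC code-sd) (iterC v₀ v₁ (consC (constC code-s1) v₀)))) F (consC (constC code-sa) v₁)

  queryN-correct : ∀ xs → queryN ⌜ xs ⌝ ≡ ⌜ lmap RunRel.symCode (query xs) ⌝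
  queryN-correct xs = trans (foldrN-correct _ _ xs)
    (trans (cong (λ z → foldr (λ _ a → cons code-sa a) z xs) (trans (foldrN-correct _ 0 xs) (nodes xs))) (index xs))
    where
    nodes : ∀ xs → foldr (λ x a → cons code-sd (iter (cons code-s1) x a)) 0 xs ≡ ⌜ lmap RunRel.symCode (concatMap (λ x → sd ∷ encℕ x) xs) ⌝
    nodes [] = refl
    nodes (x ∷ xs) = cong (cons code-sd) (trans (cong (iter (cons code-s1) x) (nodes xs)) (trans (iter-replicate _ x _)
      (cong ⌜_⌝ (sym (trans (Listₚ.map-++ RunRel.symCode (encℕ x) _) (cong (_+++ _) (Listₚ.map-replicate RunRel.symCode x s1)))))))
    index : ∀ (xs : List ℕ) {w} → foldr (λ _ a → cons code-sa a) ⌜ lmap RunRel.symCode w ⌝ xs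
      ≡ ⌜ lmap RunRel.symCode (replicate (length xs) sa +++ w) ⌝
    index [] = refl
    index (x ∷ xs) = cong (cons code-sa) (index xs)

  -- `Computable` promises halting only for nonempty tuples over the domain. The empty list, which
  -- has code 0, is excluded by the second summand.
  relGuard : Vec ℕ 1 → ℕ
  relGuard ρ = allDom (head ρ) + ifz (head ρ) 1 0

  rel-halts : ∀ xs → All Dom xs → xs ≢ [] → Σ Bool λ b → Halts Mrel (query xs) b × ((b ≡ true) ⇔ Path xs)
  rel-halts [] _ ne = ⊥-elim (ne refl)
  rel-halts (x ∷ xs) ds _ with proj₂ (proj₂ (proj₂ computable)) (length xs) (x ∷ fromList xs)
      (VAllₚ.toList⁻ (subst (All Dom) (cong (x ∷_) (sym (Vecₚ.toList∘fromList xs))) ds))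
  ... | b , h , i = b ,
    subst (λ l → Halts Mrel (replicate (suc (length xs)) sa +++ sd ∷ (encℕ x +++ concatMap (λ x → sd ∷ encℕ x) l)) b) (Vecₚ.toList∘fromList xs) h ,
    (λ e → length xs , x ∷ fromList xs , cong (x ∷_) (Vecₚ.toList∘fromList xs) , proj₁ i e) ,
    (λ p → proj₂ i (path-vec (x ∷ fromList xs) (subst Path (cong (x ∷_) (sym (Vecₚ.toList∘fromList xs))) p)))

  guard-sound : ∀ xs → relGuard (⌜ xs ⌝ ∷ []) ≡ 0 → All Dom xs × xs ≢ []
  guard-sound xs e with sum-zero (allDom ⌜ xs ⌝) e
  ... | e₁ , e₂ = allDom-sound xs e₁ , λ { refl → 1+n≢0 e₂ }

  relGuardC : Comp relGuard
  relGuardC = addC (call₁ allDomC v₀) (ifzC v₀ (constC 1) zeroC)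

  guarded-halts : ∀ ρ → relGuard ρ ≡ 0
    → Σ (List Sym) λ w → Σ Bool λ b → queryN (head ρ) ≡ ⌜ lmap RunRel.symCode w ⌝ × Halts Mrel w b
  guarded-halts (u ∷ []) h =
    let xs = unlist u
        ds , ne = guard-sound xs (subst (λ u → relGuard (u ∷ []) ≡ 0) (sym (⌜unlist⌝ u)) h)
        b , t , _ = rel-halts xs ds ne
    in query xs , b , trans (cong queryN (sym (⌜unlist⌝ u))) (queryN-correct xs) , t

  module RelAnswer = RunRel.Answer (queryC v₀) relGuardC guarded-halts

  opaque
    relN : ℕ → ℕ
    relN u = RelAnswer.answer (u ∷ [])

    relC : Comp₁ relN
    relC = fn₁ (extC (λ { (x ∷ []) → refl }) RelAnswer.answerC)

    relN-sound : ∀ xs → relN ⌜ xs ⌝ ≡ 0 → Path xs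
    relN-sound xs e = sound (relGuard (⌜ xs ⌝ ∷ [])) refl
      where
      sound : ∀ g → relGuard (⌜ xs ⌝ ∷ []) ≡ g → Path xs
      sound zero eg = let ds , ne = guard-sound xs eg
                          b , h , i = rel-halts xs ds ne
        in proj₁ i (bit-true b (trans (sym (RelAnswer.answer-correct (⌜ xs ⌝ ∷ []) (query xs) b eg (queryN-correct xs) h)) e))
      sound (suc g) eg = ⊥-elim (1+n≢0 (trans (sym (RelAnswer.answer-unguarded (⌜ xs ⌝ ∷ []) eg)) e))

    relN-complete : ∀ xs → Path xs → relN ⌜ xs ⌝ ≡ 0
    relN-complete [] (n , x ∷ v , () , r)
    relN-complete xs@(_ ∷ _) p = let b , h , i = rel-halts xs (path-dom p) (λ ()) in
      trans (RelAnswer.answer-correct (⌜ xs ⌝ ∷ []) (query xs) b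
        (cong₂ _+_ (allDom-complete (path-dom p)) refl) (queryN-correct xs) h) (cong bit (proj₂ i p))

  -- The sequences c and p: c k ends an even-length path with parent p k, both above everything used before.

  parityN : ℕ → ℕ
  parityN = foldrN (λ _ a → 1 ∸ a) 0

  -- With 0 for truth, a sum is a conjunction and `u ∸ x` expresses `u ≤ x`.
  unfit : ℕ → ℕ → ℕ
  unfit u z = relN (rev z) + (parityN z + ((u ∸ hd z) + (u ∸ hd (tl z))))

  unfitC : Comp {2} (λ ρ → unfit (head (tail ρ)) (head ρ))
  unfitC = addC (call₁ relC (call₁ revC v₀)) (addC (foldrC zeroC v₀ (monusC (constC 1) v₁))
    (addC (monusC v₁ (hdC v₀)) (monusC v₁ (hdC (tlC v₀)))))

  record Fit (u z : ℕ) : Set where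
    constructor fit
    field
      child parent : ℕ
      above : List ℕ
      code≡ : z ≡ ⌜ child ∷ parent ∷ above ⌝
      path : RPath (child ∷ parent ∷ above)
      even : parity above ≡ 0
      u≤child : u ≤ child
      u≤parent : u ≤ parent

  parity-≤1 : ∀ xs → parity xs ≤ 1
  parity-≤1 [] = z≤n
  parity-≤1 (x ∷ xs) = m∸n≤m 1 (parity xs)

  parity-+2 : ∀ xs → 1 ∸ (1 ∸ parity xs) ≡ parity xs
  parity-+2 xs = m∸[m∸n]≡n (parity-≤1 xs)

  unfit-sound : ∀ u zs → unfit u ⌜ zs ⌝ ≡ 0 → Fit u ⌜ zs ⌝
  unfit-sound u zs h = shape zs (relN-sound (reverse zs) (trans (cong relN (sym (rev-⌜⌝ zs))) h₁))
      (trans (sym (foldrN-correct (λ _ a → 1 ∸ a) 0 zs)) h₂) h₃ h₄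
    where
    h₁ = proj₁ (sum-zero (relN (rev ⌜ zs ⌝)) h)
    h₂ = proj₁ (sum-zero (parityN ⌜ zs ⌝) (proj₂ (sum-zero (relN (rev ⌜ zs ⌝)) h)))
    h₃₄ = sum-zero (u ∸ hd ⌜ zs ⌝) (proj₂ (sum-zero (parityN ⌜ zs ⌝) (proj₂ (sum-zero (relN (rev ⌜ zs ⌝)) h))))
    h₃ = proj₁ h₃₄
    h₄ = proj₂ h₃₄
    shape : ∀ zs → RPath zs → parity zs ≡ 0 → u ∸ hd ⌜ zs ⌝ ≡ 0 → u ∸ hd (tl ⌜ zs ⌝) ≡ 0 → Fit u ⌜ zs ⌝
    shape [] q _ _ _ = ⊥-elim (rpath-nonempty q)
    shape (x ∷ []) q () _ _
    shape (x ∷ y ∷ zs) q ev h₃ h₄ = fit x y zs refl q (trans (sym (parity-+2 zs)) ev)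
      (m∸n≡0⇒m≤n (trans (cong (u ∸_) (sym (hd-cons x ⌜ y ∷ zs ⌝))) h₃))
      (m∸n≡0⇒m≤n (trans (cong (u ∸_) (sym (trans (cong hd (tl-cons x ⌜ y ∷ zs ⌝)) (hd-cons y ⌜ zs ⌝)))) h₄))

  fit-complete : ∀ u z → Fit u z → unfit u z ≡ 0
  fit-complete u z (fit c q zs refl p ev uc uq) = cong₂ _+_ (trans (cong relN (rev-⌜⌝ (c ∷ q ∷ zs))) (relN-complete _ p))
    (cong₂ _+_ (trans (foldrN-correct (λ _ a → 1 ∸ a) 0 (c ∷ q ∷ zs)) (trans (parity-+2 zs) ev))
      (cong₂ _+_ (trans (cong (u ∸_) (hd-cons c _)) (m≤n⇒m∸n≡0 uc))
        (trans (cong (u ∸_) (trans (cong hd (tl-cons c _)) (hd-cons q _))) (m≤n⇒m∸n≡0 uq))))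

  drop-two : ∀ n {l} → suc (suc l) ≡ suc n + suc n → l ≡ n + n
  drop-two n h = suc-injective (suc-injective (trans h (cong suc (+-suc n n))))

  even-length : ∀ n zs → length zs ≡ n + n → parity zs ≡ 0
  even-length zero [] h = refl
  even-length (suc n) (x ∷ []) h = ⊥-elim (0≢1+n (suc-injective (trans h (cong suc (+-suc n n)))))
  even-length (suc n) (x ∷ y ∷ zs) h = trans (parity-+2 zs) (even-length n zs (drop-two n h))

  rpath-rest : ∀ x y zs → RPath (x ∷ y ∷ zs) → RPath zs ⊎ zs ≡ []
  rpath-rest x y [] p = inj₂ refl
  rpath-rest x y (z ∷ zs) p = inj₁ (rpath-suffix (x ∷ y ∷ []) z zs p)

  -- Going down the pairs of a long path, either a pair with both entries ≥ u occurs, or there are too many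
  -- distinct nodes < u.
  find-fit : ∀ u n zs → length zs ≡ n + n → (RPath zs ⊎ zs ≡ []) → Σ ℕ (Fit u)
    ⊎ Σ (List ℕ) λ ys → length ys ≡ n × All (_< u) ys × Unique ys × (∀ {y} → y ∈ ys → y ∈ zs)
  find-fit u zero zs l p = inj₂ ([] , refl , [] , [] , λ ())
  find-fit u (suc n) [] () p
  find-fit u (suc n) (x ∷ []) l p = ⊥-elim (0≢1+n (suc-injective (trans l (cong suc (+-suc n n)))))
  find-fit u (suc n) (x ∷ y ∷ zs) l (inj₁ p) with u ≤? x | u ≤? y | find-fit u n zs (drop-two n l) (rpath-rest x y zs p)
  ... | yes u≤x | yes u≤y | _ = inj₁ (_ , fit x y zs refl p (even-length n zs (drop-two n l)) u≤x u≤y)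
  ... | _ | _ | inj₁ f = inj₁ f
  ... | no x<u | _ | inj₂ (ys , ly , by , uy , iy) = inj₂ (x ∷ ys , cong suc ly , ≰⇒> x<u ∷ by ,
    All.tabulate (λ y∈ h → rpath-head∉ (y ∷ zs) p (subst (_∈ y ∷ zs) (sym h) (there (iy y∈)))) ∷ uy ,
    λ { (here h) → here h ; (there y∈) → there (there (iy y∈)) })
  ... | yes _ | no y<u | inj₂ (ys , ly , by , uy , iy) = inj₂ (y ∷ ys , cong suc ly , ≰⇒> y<u ∷ by ,
    All.tabulate (λ y∈ h → rpath-head∉ zs (rpath-suffix (x ∷ []) y zs p) (subst (_∈ zs) (sym h) (iy y∈))) ∷ uy ,
    λ { (here h) → there (here h) ; (there y∈) → there (there (iy y∈)) })

  fit-exists : ∀ u → Σ ℕ (Fit u)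
  -- A path of `2 u + 2` nodes consists of `u + 1` pairs. If none fits, each contributes a node
  -- below `u`, which is one too many.
  fit-exists u with unbounded (u + suc u)
  ... | v , r with find-fit u (suc u) (reverse (toList v)) (trans (Listₚ.length-reverse (toList v)) (Vecₚ.length-toList v))
        (inj₁ (subst Path (sym (Listₚ.reverse-involutive (toList v))) (_ , v , refl , r)))
  ... | inj₁ f = f
  ... | inj₂ (ys , ly , by , uy , _) = ⊥-elim (<-irrefl refl (subst (_≤ u) ly (Unique-bounded uy by)))

  opaque
   least-fit : ∀ u → Σ ℕ λ z → unfit u z ≡ 0 × (∀ i → i < z → unfit u i ≢ 0)
   least-fit u = least (unfit u) (proj₁ (fit-exists u)) (fit-complete u _ (proj₂ (fit-exists u)))

  nextZ : ℕ → ℕ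
  nextZ u = proj₁ (least-fit u)

  nextZC : Comp₁ nextZ
  nextZC = fn₁ (muC (λ ρ → nextZ (head ρ)) (λ { (u ∷ []) → proj₁ (proj₂ (least-fit u)) })
    (λ { (u ∷ []) → proj₂ (proj₂ (least-fit u)) }) unfitC)

  opaque
    -- Codes of the chosen paths. A code exceeds all entries of its list; so asking that the next
    -- child and parent be no smaller than the previous code makes both `c` and `p` strictly
    -- increasing.
    zseq : ℕ → ℕ
    zseq k = iter nextZ k 0

    zseqC : Comp₁ zseq
    zseqC = fn₁ (iterC v₀ zeroC (call₁ nextZC v₀))

    c p : ℕ → ℕ
    c k = hd (zseq (suc k))
    p k = hd (tl (zseq (suc k)))

    cC : Comp₁ c
    cC = fn₁ (hdC (call₁ zseqC (sucC v₀)))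

    zseq-suc : ∀ k → zseq (suc k) ≡ nextZ (zseq k)
    zseq-suc k = refl

    c≡ : ∀ k → c k ≡ hd (zseq (suc k))
    c≡ k = refl

    p≡ : ∀ k → p k ≡ hd (tl (zseq (suc k)))
    p≡ k = refl

  record Chosen (k : ℕ) : Set where
    constructor chosen
    field
      above : List ℕ
      path : RPath (c k ∷ p k ∷ above)
      even : parity above ≡ 0
      z≤c : zseq k ≤ c k
      z≤p : zseq k ≤ p k
      c<z : c k < zseq (suc k)
      p<z : p k < zseq (suc k)

  choose : ∀ k → Chosen k
  choose k = from-fit (subst (Fit (zseq k)) (⌜unlist⌝ (zseq (suc k))) (unfit-sound (zseq k) (unlist (zseq (suc k)))
      (subst (λ z → unfit (zseq k) z ≡ 0) (trans (sym (zseq-suc k)) (sym (⌜unlist⌝ (zseq (suc k))))) (proj₁ (proj₂ (least-fit (zseq k)))))))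
    where
    from-fit : Fit (zseq k) (zseq (suc k)) → Chosen k
    from-fit (fit c' p' zs h path ev u≤c u≤p) = chosen zs (subst₂ (λ x y → RPath (x ∷ y ∷ zs)) (sym ec) (sym ep) path) ev
      (subst (zseq k ≤_) (sym ec) u≤c) (subst (zseq k ≤_) (sym ep) u≤p)
      (subst₂ _<_ (sym ec) (sym h) (s≤s (x≤pr c' _)))
      (subst₂ _<_ (sym ep) (sym h) (s≤s (≤-trans (≤-trans (x≤pr p' _) (n≤1+n _)) (y≤pr c' _))))
      where
      ec : c k ≡ c'
      ec = trans (trans (c≡ k) (cong hd h)) (hd-cons c' _)
      ep : p k ≡ p'
      ep = trans (trans (p≡ k) (cong (λ z → hd (tl z)) h)) (trans (cong hd (tl-cons c' _)) (hd-cons p' _))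

  open Chosen

  zseq-mono : ∀ {i j} → i ≤ j → zseq i ≤ zseq j
  zseq-mono {j = zero} z≤n = ≤-refl
  zseq-mono {i} {suc j} i≤ with m≤n⇒m<n∨m≡n i≤
  ... | inj₂ refl = ≤-refl
  ... | inj₁ (s≤s i≤j) = ≤-trans (zseq-mono i≤j) (<⇒≤ (≤-<-trans (z≤c (choose j)) (c<z (choose j))))

  k≤zseq : ∀ k → k ≤ zseq k
  k≤zseq zero = z≤n
  k≤zseq (suc k) = ≤-<-trans (≤-trans (k≤zseq k) (z≤c (choose k))) (c<z (choose k))

  c-strict : ∀ {i j} → i < j → c i < c j
  c-strict {i} {j} i<j = <-≤-trans (c<z (choose i)) (≤-trans (zseq-mono i<j) (z≤c (choose j)))

  p-strict : ∀ {i j} → i < j → p i < p j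
  p-strict {i} {j} i<j = <-≤-trans (p<z (choose i)) (≤-trans (zseq-mono i<j) (z≤p (choose j)))

  NotC : ℕ → Set
  NotC x = ∀ k → c k ≢ x

  -- The nodes c k sit at odd depth, their parents at even depth.
  odd-not-c : ∀ x as → RPath (x ∷ as) → parity as ≡ 0 → NotC x
  odd-not-c x as q ev k h = 1+n≢0 (trans (cong (1 ∸_) (sym (even (choose k)))) (trans (cong parity same) ev))
    where
    same : p k ∷ above (choose k) ≡ as
    same = rpath-injective x (p k ∷ above (choose k)) as (subst (λ y → RPath (y ∷ p k ∷ above (choose k))) h (path (choose k))) q

  p-not-c : ∀ k → NotC (p k)
  p-not-c k = odd-not-c (p k) (above (choose k)) (rpath-suffix (c k ∷ []) (p k) (above (choose k)) (path (choose k))) (even (choose k))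

  root-path : RPath (root ∷ [])
  root-path = 0 , root ∷ [] , refl , proj₂ (R₁-root root) refl

  root-not-c : NotC root
  root-not-c = odd-not-c root [] root-path refl

  p-dom : ∀ k → Dom (p k)
  p-dom k = rpath-dom (c k ∷ p k ∷ above (choose k)) (path (choose k)) (there (here refl))

  c-dom : ∀ k → Dom (c k)
  c-dom k = rpath-dom (c k ∷ p k ∷ above (choose k)) (path (choose k)) (here refl)

  isEq : ℕ → ℕ → ℕ
  isEq x y = ifz ((x ∸ y) + (y ∸ x)) 1 0

  isEq-refl : ∀ x → isEq x x ≡ 1
  isEq-refl x rewrite n∸n≡0 x = refl

  isEq-≢ : ∀ x y → x ≢ y → isEq x y ≡ 0
  isEq-≢ x y ne with (x ∸ y) + (y ∸ x) in e
  ... | zero = let e₁ , e₂ = sum-zero (x ∸ y) e in ⊥-elim (ne (≤-antisym (m∸n≡0⇒m≤n e₁) (m∸n≡0⇒m≤n e₂)))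
  ... | suc _ = refl

  -- Only `k ≤ x` have to be tried, because `k ≤ zseq k ≤ c k`. This makes the set of the `c k`
  -- decidable.
  hitsC : ℕ → ℕ
  hitsC x = loop (λ a k → a + isEq (c k) x) (suc x) 0

  hitsC-sound : ∀ x → hitsC x ≡ 0 → NotC x
  hitsC-sound x e k refl = 1+n≢0 (trans (sym (isEq-refl (c k))) (none (suc (c k)) 0 e k (s≤s (≤-trans (k≤zseq k) (z≤c (choose k))))))
    where
    first : ∀ n a → loop (λ a k → a + isEq (c k) x) n a ≡ 0 → a ≡ 0
    first zero a e = e
    first (suc n) a e = proj₁ (sum-zero a (first n (a + isEq (c n) x) e))
    none : ∀ n a → loop (λ a k → a + isEq (c k) x) n a ≡ 0 → ∀ k → k < n → isEq (c k) x ≡ 0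
    none (suc n) a e k (s≤s k≤n) with m≤n⇒m<n∨m≡n k≤n
    ... | inj₁ k<n = none n _ e k k<n
    ... | inj₂ refl = proj₂ (sum-zero a (first k _ e))

  hitsC-complete : ∀ x → NotC x → hitsC x ≡ 0
  hitsC-complete x h = none (suc x)
    where
    none : ∀ n → loop (λ a k → a + isEq (c k) x) n 0 ≡ 0
    none zero = refl
    none (suc n) rewrite isEq-≢ (c n) x (h n) = none n

  hitsC-C : Comp₁ hitsC
  hitsC-C = fn₁ (loopC (sucC v₀) zeroC (addC v₀ (ifzC (addC (monusC (call₁ cC v₁) v₂) (monusC v₂ (call₁ cC v₁))) (constC 1) zeroC)))

  -- b enumerates increasingly the nodes other than the c k.

  notB : ℕ → ℕ → ℕ
  notB u x = (u ∸ x) + (domN x + hitsC x)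

  -- The parents `p u` are themselves an unbounded supply of nodes outside the sequence `c`.
  notB-exists : ∀ u → Σ ℕ λ x → notB u x ≡ 0
  notB-exists u = p u , cong₂ _+_ (m≤n⇒m∸n≡0 (≤-trans (k≤zseq u) (z≤p (choose u))))
    (cong₂ _+_ (domN-complete _ (p-dom u)) (hitsC-complete _ (p-not-c u)))

  opaque
   least-B : ∀ u → Σ ℕ λ x → notB u x ≡ 0 × (∀ i → i < x → notB u i ≢ 0)
   least-B u = least (notB u) (proj₁ (notB-exists u)) (proj₂ (notB-exists u))

  nextB : ℕ → ℕ
  nextB u = proj₁ (least-B u)

  nextBC : Comp₁ nextB
  nextBC = fn₁ (muC (λ ρ → nextB (head ρ)) (λ { (u ∷ []) → proj₁ (proj₂ (least-B u)) })
    (λ { (u ∷ []) → proj₂ (proj₂ (least-B u)) })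
    (extC {g = λ v → notB (head (tail v)) (head v)} (λ _ → refl) (addC (monusC v₁ v₀) (addC (call₁ domC v₀) (call₁ hitsC-C v₀)))))

  nextB-spec : ∀ u → u ≤ nextB u × Dom (nextB u) × NotC (nextB u)
  nextB-spec u with sum-zero (u ∸ nextB u) (proj₁ (proj₂ (least-B u)))
  ... | e₁ , e with sum-zero (domN (nextB u)) e
  ... | e₂ , e₃ = m∸n≡0⇒m≤n e₁ , domN-sound _ e₂ , hitsC-sound _ e₃

  nextB-least : ∀ u x → u ≤ x → Dom x → NotC x → nextB u ≤ x
  nextB-least u x u≤x d nc = ≮⇒≥ λ x< → proj₂ (proj₂ (least-B u)) x x<
    (cong₂ _+_ (m≤n⇒m∸n≡0 u≤x) (cong₂ _+_ (domN-complete x d) (hitsC-complete x nc)))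

  opaque
    past b : ℕ → ℕ
    past j = iter (λ u → suc (nextB u)) j 0
    b j = nextB (past j)

    bC : Comp₁ b
    bC = fn₁ (call₁ nextBC (iterC v₀ zeroC (sucC (call₁ nextBC v₀))))

    past-0 : past 0 ≡ 0
    past-0 = refl

    past-suc : ∀ j → past (suc j) ≡ suc (b j)
    past-suc j = refl

    b-spec : ∀ j → past j ≤ b j × Dom (b j) × NotC (b j)
    b-spec j = nextB-spec (past j)

    b-least : ∀ j x → past j ≤ x → Dom x → NotC x → b j ≤ x
    b-least j = nextB-least (past j)

  b-dom : ∀ j → Dom (b j)
  b-dom j = proj₁ (proj₂ (b-spec j))

  b-not-c : ∀ j → NotC (b j)
  b-not-c j = proj₂ (proj₂ (b-spec j))

  b-strict : ∀ {i j} → i < j → b i < b j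
  b-strict {i} {suc j} (s≤s i≤j) = after (m≤n⇒m<n∨m≡n i≤j)
    where
    b<b : b j < b (suc j)
    b<b = subst (_≤ b (suc j)) (past-suc j) (proj₁ (b-spec (suc j)))
    after : i < j ⊎ i ≡ j → b i < b (suc j)
    after (inj₁ i<j) = <-trans (b-strict i<j) b<b
    after (inj₂ refl) = b<b

  j≤past : ∀ j → j ≤ past j
  j≤past zero = z≤n
  j≤past (suc j) = subst (suc j ≤_) (sym (past-suc j)) (s≤s (≤-trans (j≤past j) (proj₁ (b-spec j))))

  b-surjective : ∀ x → Dom x → NotC x → Σ ℕ λ j → b j ≡ x
  b-surjective x d nc = search (suc x) 0 (≤-reflexive (sym (+-identityʳ (suc x)))) (subst (_≤ x) (sym past-0) z≤n)
    where
    search : ∀ n j → suc x ≤ n + j → past j ≤ x → Σ ℕ λ j → b j ≡ x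
    search zero j l p≤ = ⊥-elim (<-irrefl refl (≤-trans l (≤-trans (j≤past j) p≤)))
    search (suc n) j l p≤ = next (m≤n⇒m<n∨m≡n (b-least j x p≤ d nc))
      where
      next : b j < x ⊎ b j ≡ x → Σ ℕ λ j → b j ≡ x
      next (inj₁ lt) = search n (suc j) (subst (suc x ≤_) (sym (+-suc n j)) l) (subst (_≤ x) (sym (past-suc j)) lt)
      next (inj₂ h) = j , h

  b-mono : ∀ {i j} → i ≤ j → b i ≤ b j
  b-mono = strict⇒mono b-strict

  -- Both `b` and `p` increase strictly. So the position of `p (suc k)` in `b` lies beyond that of
  -- `p k`, and induction applies.
  p-rank : ∀ k → Σ ℕ λ i → k ≤ i × b i ≡ p k
  p-rank k = rank k (b-surjective (p k) (p-dom k) (p-not-c k))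
    where
    rank : ∀ k → (Σ ℕ λ i → b i ≡ p k) → Σ ℕ λ i → k ≤ i × b i ≡ p k
    rank zero (i , h) = i , z≤n , h
    rank (suc k) (i , h) = let i' , k≤i' , h' = p-rank k in
      i , ≤-<-trans k≤i' (≰⇒> λ i≤i' → <-irrefl refl (<-≤-trans (p-strict (n<1+n k)) (subst₂ _≤_ h h' (b-mono i≤i')))) , h

  -- A path through c k passes through p k.
  through-c : ∀ zs k → RPath zs → c k ∈ zs → Σ ℕ λ i → k ≤ i × b i ∈ zs
  through-c zs k q c∈ =
    let pre , h = rpath-suffix-unique zs (c k) (p k ∷ above (choose k)) q c∈ (path (choose k))
        i , k≤i , h' = p-rank k
    in i , k≤i , subst (_∈ zs) (sym h') (subst (p k ∈_) (sym h) (∈-++⁺ʳ pre {c k ∷ p k ∷ above (choose k)} (there (here refl))))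

  e : Ix → ℕ
  e (inj₁ j) = b j
  e (inj₂ k) = c k

  e-injective : ∀ x y → e x ≡ e y → x ≡ y
  e-injective (inj₁ i) (inj₁ j) h = cong inj₁ (strict⇒injective b-strict i j h)
  e-injective (inj₁ i) (inj₂ j) h = ⊥-elim (b-not-c i j (sym h))
  e-injective (inj₂ i) (inj₁ j) h = ⊥-elim (b-not-c j i h)
  e-injective (inj₂ i) (inj₂ j) h = cong inj₂ (strict⇒injective c-strict i j h)

  e-dom : ∀ x → Dom (e x)
  e-dom (inj₁ j) = b-dom j
  e-dom (inj₂ k) = c-dom k

  e-surjective : ∀ x → Dom x → Σ Ix λ i → e i ≡ x
  e-surjective x d with hitsC x in eh
  ... | zero = let j , h = b-surjective x d (hitsC-sound x eh) in inj₁ j , h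
  ... | suc _ = let k , h = search (suc x) 0 (≤-reflexive (sym (+-identityʳ (suc x)))) (λ _ ()) in inj₂ k , h
    where
    search : ∀ n k → suc x ≤ n + k → (∀ i → i < k → c i ≢ x) → Σ ℕ λ k → c k ≡ x
    search zero k l h = ⊥-elim (1+n≢0 (trans (sym eh) (hitsC-complete x λ i ci →
      h i (≤-trans (s≤s (≤-trans (≤-trans (k≤zseq i) (z≤c (choose i))) (≤-reflexive ci))) l) ci)))
    search (suc n) k l h with c k ≟ x
    ... | yes ck = k , ck
    ... | no ne = search n (suc k) (subst (suc x ≤_) (sym (+-suc n k)) l) below
      where
      below : ∀ i → i < suc k → c i ≢ x
      below i (s≤s i≤k) with m≤n⇒m<n∨m≡n i≤k
      ... | inj₁ i<k = h i i<k
      ... | inj₂ refl = ne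

-- Output symbols and their comparison with the input

open EState
open Tri
open Comp

-- `walk b` takes the pointer `aux` to the next cell whose mark is `b` and emits a 1 for each cell
-- it moves. So a name `1^x` can be spelled by a list of symbols that does not mention `x`.
data Out : Set where
  emit : Sym → Out
  reset : Out
  walk : Bool → Out
  end : Out

outCode : Out → ℕ
outCode (emit s) = toℕ (symIx s)
outCode reset = 6
outCode (walk true) = 7
outCode (walk false) = 8
outCode end = 9

-- Number of cells from a to the first cell with mark b, cut off at f.
gap : List ℕ → Bool → ℕ → ℕ → ℕ
gap ms b zero a = 0
gap ms b (suc f) a = if (a ∈ᵇ ms) ≡ᵒ not b then suc (gap ms b f (suc a)) else 0

target : List ℕ → ℕ → Bool → ℕ → ℕ
target ms top b a = suc a + gap ms b top (suc a)

play : List ℕ → ℕ → ℕ → List Sym → List Out → List (List Sym)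
play ms top a v [] = []
play ms top a v (emit s ∷ os) = play ms top a (v +++ s ∷ []) os
play ms top a v (reset ∷ os) = play ms top 0 v os
play ms top a v (walk b ∷ os) = play ms top (target ms top b a) (v +++ replicate (suc (gap ms b top (suc a))) s1) os
play ms top a v (end ∷ os) = v ∷ play ms top a [] os

-- Each walk finds its cell before the cut-off `top` takes effect. Hence `gap` is the true distance,
-- and the while loop stops there.
Valid : List ℕ → ℕ → ℕ → List Out → Set
Valid ms top a [] = ⊤
Valid ms top a (emit s ∷ os) = Valid ms top a os
Valid ms top a (reset ∷ os) = Valid ms top 0 os
Valid ms top a (walk b ∷ os) = ((target ms top b a ∈ᵇ ms) ≡ᵒ not b) ≡ false × Valid ms top (target ms top b a) os
Valid ms top a (end ∷ os) = Valid ms top a os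

handleCost : List ℕ → ℕ → ℕ → Out → ℕ
handleCost ms top a (emit s) = 3
handleCost ms top a reset = 1
handleCost ms top a (walk b) = 5 + 5 * gap ms b top (suc a)
handleCost ms top a end = 5

nextAux : List ℕ → ℕ → ℕ → Out → ℕ
nextAux ms top a (emit s) = a
nextAux ms top a reset = 0
nextAux ms top a (walk b) = target ms top b a
nextAux ms top a end = a

gap≤ : ∀ ms b f a → gap ms b f a ≤ f
gap≤ ms b zero a = z≤n
gap≤ ms b (suc f) a with (a ∈ᵇ ms) ≡ᵒ not b
... | true = s≤s (gap≤ ms b f (suc a))
... | false = z≤n

handleCost≤ : ∀ ms top a o → handleCost ms top a o ≤ 5 + 5 * top
handleCost≤ ms top a (emit s) = s≤s (s≤s (s≤s z≤n))
handleCost≤ ms top a reset = s≤s z≤n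
handleCost≤ ms top a (walk b) = +-monoʳ-≤ 5 (*-monoʳ-≤ 5 (gap≤ ms b top (suc a)))
handleCost≤ ms top a end = m≤m+n 5 (5 * top)

-- Every branch of a handler takes the same time, so that the clock does not depend on the input word.

emitP : Sym → Prog
emitP x = ite (nonz bad) (op (inc bad) ⨾ op (inc bad)) (ite (reads (just x)) (op (inc cp)) (op (inc bad)))

endP : Prog
endP = ite (nonz bad) (op (inc bad) ⨾ op (inc bad)) (ite (reads nothing) (op hit) (op (inc bad))) ⨾ op (zer cp) ⨾ op (zer bad)

walkP : Bool → Prog
walkP b = emitP s1 ⨾ op (inc aux) ⨾ while (marked (not b)) (emitP s1 ⨾ op (inc aux))

handler : Out → Prog
handler (emit s) = emitP s
handler reset = op (zer aux)
handler (walk b) = walkP b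
handler end = endP

-- `v` is the output since the last `end`. While it is a prefix of the input, `cp` stands behind
-- that prefix; after a mismatch `bad` remembers it and `cp` is arbitrary.
data Inv (w v : List Sym) (c bd : ℕ) : Set where
  match : ∀ r → w ≡ v +++ r → c ≡ length v → bd ≡ 0 → Inv w v c bd
  fail : (∀ r → w ≢ v +++ r) → 1 ≤ bd → Inv w v c bd

record Same (s s' : EState) : Set where
  constructor mkSame
  field
    stack≡ : ∀ i → stack s' i ≡ stack s i
    aux≡ : auxv s' ≡ auxv s
    fnd≡ : fnd s' ≡ fnd s
    marks≡ : emarks s' ≡ emarks s

positive : ∀ {n} → 1 ≤ n → not (n ≡ᵇ 0) ≡ true
positive (s≤s _) = refl

‼-append : ∀ (v r : List Sym) → ((v +++ r) ‼ length v) ≡ (r ‼ 0)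
‼-append [] r = refl
‼-append (x ∷ v) r = ‼-append v r

≡ˢ-sound : ∀ x y → (just x ≡ˢ just y) ≡ true → x ≡ y
≡ˢ-sound x y h = trans (sym (ixSym-symIx x)) (trans (cong ixSym (Finₚ.toℕ-injective (lem (toℕ (symIx x)) (toℕ (symIx y)) h))) (ixSym-symIx y))
  where
  lem : ∀ m n → (m ≡ᵇ n) ≡ true → m ≡ n
  lem zero zero _ = refl
  lem (suc m) (suc n) h = cong suc (lem m n h)

emit-exec : ∀ w x v s → Inv w v (cpv s) (badv s) → Σ EState λ s' → Exec w (emitP x) s s' × Same s s'
  × Inv w (v +++ x ∷ []) (cpv s') (badv s') × time s' ≡ 3 + time s
emit-exec w x v s (fail h 1≤) = _ , e-ite₁ (positive 1≤) (e-seq (e-op (inc bad)) (e-op (inc bad))) , mkSame (λ _ → refl) refl refl refl ,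
  fail (λ r e → h (x ∷ r) (trans e (Listₚ.++-assoc v (x ∷ []) r))) (s≤s z≤n) , refl
emit-exec w x v s (match [] ew ec eb) = _ , e-ite₀ (cong (λ n → not (n ≡ᵇ 0)) eb) (e-ite₀ (cong (_≡ˢ just x) (trans (cong₂ _‼_ ew ec) (‼-append v []))) (e-op (inc bad))) ,
  mkSame (λ _ → refl) refl refl refl ,
  fail (λ r' e → m+1+n≢m (length v) {length r'} (trans (sym (Listₚ.length-++ v)) (cong length (trans (sym (Listₚ.++-assoc v (x ∷ []) r')) (trans (sym e) (trans ew (Listₚ.++-identityʳ v))))))) (s≤s z≤n) , refl
emit-exec w x v s (match (y ∷ r') ew ec eb) with (just y ≡ˢ just x) in t'
... | true = _ , e-ite₀ (cong (λ n → not (n ≡ᵇ 0)) eb) (e-ite₁ (trans (cong (_≡ˢ just x) (trans (cong₂ _‼_ ew ec) (‼-append v (y ∷ r')))) t') (e-op (inc cp))) ,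
  mkSame (λ _ → refl) refl refl refl ,
  match r' (trans ew (trans (cong (λ z → v +++ z ∷ r') (≡ˢ-sound y x t')) (sym (Listₚ.++-assoc v (x ∷ []) r'))))
    (trans (cong suc ec) (trans (+-comm 1 (length v)) (sym (Listₚ.length-++ v)))) eb , refl
... | false = _ , e-ite₀ (cong (λ n → not (n ≡ᵇ 0)) eb) (e-ite₀ (trans (cong (_≡ˢ just x) (trans (cong₂ _‼_ ew ec) (‼-append v (y ∷ r')))) t') (e-op (inc bad))) ,
  mkSame (λ _ → refl) refl refl refl ,
  fail (λ r″ e → neq (Listₚ.∷-injectiveˡ (Listₚ.++-cancelˡ v (y ∷ r') (x ∷ r″) (trans (sym ew) (trans e (Listₚ.++-assoc v (x ∷ []) r″)))))) (s≤s z≤n) , refl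
  where
  neq : y ≢ x
  neq refl with trans (sym (≡ᵇ-refl (toℕ (symIx y)))) t'
  ... | ()

record Handled (w : List Sym) (v : List Sym) (ws : List (List Sym)) (a : ℕ) (s s' : EState) : Set where
  constructor handled
  field
    stack≡ : ∀ i → stack s' i ≡ stack s i
    aux≡ : auxv s' ≡ a
    marks≡ : emarks s' ≡ emarks s
    inv : Inv w v (cpv s') (badv s')
    hits : w ∈ ws → 1 ≤ fnd s'
    misses : ¬ w ∈ ws → fnd s' ≡ fnd s
    keeps : fnd s ≤ fnd s'

replicate-snoc : ∀ (v : List Sym) n → (v +++ s1 ∷ []) +++ replicate n s1 ≡ v +++ replicate (suc n) s1
replicate-snoc v n = Listₚ.++-assoc v (s1 ∷ []) (replicate n s1)

-- Each cell costs five steps: one for the test, three for emitting and one for moving. The test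
-- that ends the loop is the additional 1.
walk-exec : ∀ w b f v s ms → emarks s ≡ ms → Inv w v (cpv s) (badv s)
  → (((auxv s + gap ms b f (auxv s)) ∈ᵇ ms) ≡ᵒ not b) ≡ false
  → Σ EState λ s' → Exec w (while (marked (not b)) (emitP s1 ⨾ op (inc aux))) s s'
    × Handled w (v +++ replicate (gap ms b f (auxv s)) s1) [] (auxv s + gap ms b f (auxv s)) s s'
    × time s' ≡ 1 + 5 * gap ms b f (auxv s) + time s
walk-exec w b zero v s ms refl i h = tick s , e-while₀ (subst (λ z → ((z ∈ᵇ ms) ≡ᵒ not b) ≡ false) (+-identityʳ _) h) ,
  handled (λ _ → refl) (sym (+-identityʳ _)) refl (subst (λ v → Inv w v (cpv s) (badv s)) (sym (Listₚ.++-identityʳ v)) i) (λ ()) (λ _ → refl) ≤-refl , refl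
walk-exec w b (suc f) v s ms refl i h with (auxv s ∈ᵇ ms) ≡ᵒ not b in et
... | false = tick s , e-while₀ et ,
  handled (λ _ → refl) (sym (+-identityʳ _)) refl (subst (λ v → Inv w v (cpv s) (badv s)) (sym (Listₚ.++-identityʳ v)) i) (λ ()) (λ _ → refl) ≤-refl , refl
... | true with emit-exec w s1 v (tick s) i
... | s' , ex , mkSame st ax fn mk , i' , tm with walk-exec w b f (v +++ s1 ∷ []) (doOp (inc aux) s') ms mk i'
      (subst (λ z → ((z ∈ᵇ ms) ≡ᵒ not b) ≡ false) (trans (+-suc (auxv s) (gap ms b f (suc (auxv s)))) (cong (λ z → suc z + gap ms b f (suc z)) (sym ax))) h)
... | s″ , ex' , handled st' ax' mk' i″ _ mi _ , tm' = s″ , e-while₁ et (e-seq ex (e-op (inc aux))) ex' ,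
  handled (λ j → trans (st' j) (st j)) (trans ax' (trans (cong (λ z → suc z + gap ms b f (suc z)) ax) (sym (+-suc (auxv s) g)))) (trans mk' mk)
    (subst (λ v → Inv w v (cpv s″) (badv s″)) (trans (cong (λ z → (v +++ s1 ∷ []) +++ replicate (gap ms b f (suc z)) s1) ax) (replicate-snoc v g)) i″)
    (λ ()) (λ _ → trans (mi (λ ())) fn) (≤-reflexive (sym (trans (mi (λ ())) fn))) ,
  trans tm' (trans (cong₂ (λ z t → 1 + 5 * gap ms b f (suc z) + suc t) ax tm) (arith g (time s)))
  where
  g = gap ms b f (suc (auxv s))
  arith : ∀ g t → 1 + 5 * g + suc (3 + suc t) ≡ 1 + 5 * suc g + t
  arith = solve 2 (λ g t → con 1 :+ con 5 :* g :+ (con 5 :+ t) := con 1 :+ con 5 :* (con 1 :+ g) :+ t) refl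

spell : List ℕ → ℕ → ℕ → List Sym → Out → List Sym
spell ms top a v (emit s) = v +++ s ∷ []
spell ms top a v reset = v
spell ms top a v (walk b) = v +++ replicate (suc (gap ms b top (suc a))) s1
spell ms top a v end = []

completed : List Sym → Out → List (List Sym)
completed v end = v ∷ []
completed v _ = []

play-∷ : ∀ ms top a v o os → play ms top a v (o ∷ os) ≡ completed v o +++ play ms top (nextAux ms top a o) (spell ms top a v o) os
play-∷ ms top a v (emit s) os = refl
play-∷ ms top a v reset os = refl
play-∷ ms top a v (walk b) os = refl
play-∷ ms top a v end os = refl

Valid₁ : List ℕ → ℕ → ℕ → Out → Set
Valid₁ ms top a (walk b) = ((target ms top b a ∈ᵇ ms) ≡ᵒ not b) ≡ false
Valid₁ ms top a _ = ⊤

Valid-∷ : ∀ ms top a o os → Valid ms top a (o ∷ os) → Valid₁ ms top a o × Valid ms top (nextAux ms top a o) os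
Valid-∷ ms top a (emit s) os h = tt , h
Valid-∷ ms top a reset os h = tt , h
Valid-∷ ms top a (walk b) os h = h
Valid-∷ ms top a end os h = tt , h

handle-exec : ∀ w ms top v o s → emarks s ≡ ms → Inv w v (cpv s) (badv s) → Valid₁ ms top (auxv s) o
  → Σ EState λ s' → Exec w (handler o) s s' × Handled w (spell ms top (auxv s) v o) (completed v o) (nextAux ms top (auxv s) o) s s'
    × time s' ≡ handleCost ms top (auxv s) o + time s
handle-exec w ms top v (emit x) s e i h with emit-exec w x v s i
... | s' , ex , mkSame st ax fn mk , i' , tm = s' , ex , handled st ax mk i' (λ ()) (λ _ → fn) (≤-reflexive (sym fn)) , tm
handle-exec w ms top v reset s e i h = _ , e-op (zer aux) , handled (λ _ → refl) refl refl i (λ ()) (λ _ → refl) ≤-refl , refl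
handle-exec w ms top v (walk b) s e i h with emit-exec w s1 v s i
... | s' , ex , mkSame st ax fn mk , i' , tm with walk-exec w b top (v +++ s1 ∷ []) (doOp (inc aux) s') ms (trans mk e) i'
      (subst (λ z → (((suc z + gap ms b top (suc z)) ∈ᵇ ms) ≡ᵒ not b) ≡ false) (sym ax) h)
... | s″ , ex' , handled st' ax' mk' i″ _ mi _ , tm' = s″ , e-seq ex (e-seq (e-op (inc aux)) ex') ,
  handled (λ j → trans (st' j) (st j)) (trans ax' (cong (λ z → suc z + gap ms b top (suc z)) ax)) (trans mk' mk)
    (subst (λ v → Inv w v (cpv s″) (badv s″)) (trans (cong (λ z → (v +++ s1 ∷ []) +++ replicate (gap ms b top (suc z)) s1) ax) (replicate-snoc v g)) i″)
    (λ ()) (λ _ → trans (mi (λ ())) fn) (≤-reflexive (sym (trans (mi (λ ())) fn))) ,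
  trans tm' (trans (cong₂ (λ z t → 1 + 5 * gap ms b top (suc z) + suc t) ax tm) (arith g (time s)))
  where
  g = gap ms b top (suc (auxv s))
  arith : ∀ g t → 1 + 5 * g + suc (3 + t) ≡ 5 + 5 * g + t
  arith = solve 2 (λ g t → con 1 :+ con 5 :* g :+ (con 4 :+ t) := con 5 :+ con 5 :* g :+ t) refl
handle-exec w ms top v end s e (fail h 1≤) _ = _ ,
  e-seq (e-ite₁ (positive 1≤) (e-seq (e-op (inc bad)) (e-op (inc bad)))) (e-seq (e-op (zer cp)) (e-op (zer bad))) ,
  handled (λ _ → refl) refl refl (match w refl refl refl) (λ { (here w≡v) → ⊥-elim (h [] (trans w≡v (sym (Listₚ.++-identityʳ v)))) }) (λ _ → refl) ≤-refl , refl
handle-exec w ms top v end s e (match [] ew ec eb) _ = _ ,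
  e-seq (e-ite₀ (cong (λ n → not (n ≡ᵇ 0)) eb) (e-ite₁ (cong (_≡ˢ nothing) (trans (cong₂ _‼_ ew ec) (‼-append v []))) (e-op hit))) (e-seq (e-op (zer cp)) (e-op (zer bad))) ,
  handled (λ _ → refl) refl refl (match w refl refl refl) (λ _ → s≤s z≤n) (λ ne → ⊥-elim (ne (here (trans ew (Listₚ.++-identityʳ v))))) (n≤1+n _) , refl
handle-exec w ms top v end s e (match (y ∷ r) ew ec eb) _ = _ ,
  e-seq (e-ite₀ (cong (λ n → not (n ≡ᵇ 0)) eb) (e-ite₀ (cong (_≡ˢ nothing) (trans (cong₂ _‼_ ew ec) (‼-append v (y ∷ r)))) (e-op (inc bad)))) (e-seq (e-op (zer cp)) (e-op (zer bad))) ,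
  handled (λ _ → refl) refl refl (match w refl refl refl)
    (λ { (here w≡v) → ⊥-elim (m+1+n≢m (length v) {length r} (trans (sym (Listₚ.length-++ v)) (cong length (trans (sym ew) w≡v)))) }) (λ _ → refl) ≤-refl , refl

dispatch : List Prog → Prog
dispatch [] = op (zer (stk 1))
dispatch (p ∷ ps) = ite (nonz (stk 1)) (op (dec (stk 1)) ⨾ dispatch ps) p

record Dispatched (w : List Sym) (ps : List Prog) (p : Prog) (k u j : ℕ) (s : EState) : Set where
  constructor dispatched
  field
    state : EState
    models : state ⊨ (u ∷ 0 ∷ j ∷ [])
    framed : Frame s state
    time≡ : time state ≡ suc (2 * k) + time s
    execs : ∀ s' → Exec w p state s' → Exec w (dispatch ps) s s'

dispatch-exec : ∀ w k ps p u j s → (ps ‼ k) ≡ just p → s ⊨ (u ∷ k ∷ j ∷ []) → Dispatched w ps p k u j s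
dispatch-exec w zero (p ∷ ps) .p u j s refl h = dispatched (tick s) h (frame refl refl refl refl refl) refl
  (λ s' ex → e-ite₀ (test-at (u ∷ []) 0 (j ∷ []) w s h) ex)
dispatch-exec w (suc k) (p' ∷ ps) p u j s e h with runs (dec-at (u ∷ []) (suc k) (j ∷ [])) w (tick s) h
... | s₁ , ex₁ , h₁ , f₁ , t₁ with dispatch-exec w k ps p u j s₁ e h₁
... | dispatched s₂ h₂ f₂ t₂ exs = dispatched s₂ h₂ (frame-trans (frame refl refl refl refl refl) (frame-trans f₁ f₂))
  (trans t₂ (trans (cong (suc (2 * k) +_) t₁) (solve 2 (λ k t → con 1 :+ con 2 :* k :+ (con 2 :+ t) := con 1 :+ con 2 :* (con 1 :+ k) :+ t) refl k (time s))))
  (λ s' ex → e-ite₁ (test-at (u ∷ []) (suc k) (j ∷ []) w s h) (e-seq ex₁ (exs s' ex)))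

handlers : List Prog
handlers = lmap handler (emit s0 ∷ emit s1 ∷ emit sa ∷ emit sb ∷ emit sc ∷ emit sd ∷ reset ∷ walk true ∷ walk false ∷ end ∷ [])

handlers-at : ∀ o → (handlers ‼ outCode o) ≡ just (handler o)
handlers-at (emit s0) = refl
handlers-at (emit s1) = refl
handlers-at (emit sa) = refl
handlers-at (emit sb) = refl
handlers-at (emit sc) = refl
handlers-at (emit sd) = refl
handlers-at reset = refl
handlers-at (walk true) = refl
handlers-at (walk false) = refl
handlers-at end = refl

outCode≤9 : ∀ o → outCode o ≤ 9
outCode≤9 (emit s) = ≤-trans (<⇒≤ (Finₚ.toℕ<n (symIx s))) (m≤m+n 6 3)
outCode≤9 reset = m≤m+n 6 3
outCode≤9 (walk true) = m≤m+n 7 2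
outCode≤9 (walk false) = m≤m+n 8 1
outCode≤9 end = ≤-refl

-- Moves the head of the list in register 2 to register 1, which is zero, and replaces the list by its tail.
opaque
  fetch : Prog
  fetch = prog (hdC v₀) (2 ∷ []) 3 ⨾ while (nonz (stk 3)) (op (dec (stk 3)) ⨾ op (inc (stk 1))) ⨾ prog (tlC v₀) (2 ∷ []) 3 ⨾ nip 2

  fetch-tri : ∀ u j → Tri fetch (u ∷ 0 ∷ j ∷ []) (tl u ∷ hd u ∷ j ∷ [])
  fetch-tri u j = tri-seq (ok (hdC v₀) (u ∷ 0 ∷ j ∷ []) (2 ∷ []) (u ∷ []) (mkAgree λ { fzero → ≤-refl , refl }))
    (tri-seq (tri-post (λ i → sym (push-zero (u ∷ hd u ∷ j ∷ []) i)) (subst (λ v → Tri L (hd u ∷ u ∷ 0 ∷ j ∷ []) (0 ∷ u ∷ v ∷ j ∷ [])) (+-identityʳ (hd u)) (move (hd u) 0)))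
    (tri-seq (ok (tlC v₀) (u ∷ hd u ∷ j ∷ []) (2 ∷ []) (u ∷ []) (mkAgree λ { fzero → ≤-refl , refl }))
      (nip-tri (tl u) u (hd u ∷ j ∷ []))))
    where
    L : Prog
    L = while (nonz (stk 3)) (op (dec (stk 3)) ⨾ op (inc (stk 1)))
    move : ∀ x y → Tri L (x ∷ u ∷ y ∷ j ∷ []) (0 ∷ u ∷ x + y ∷ j ∷ [])
    move zero y = while-done [] (u ∷ y ∷ j ∷ [])
    move (suc x) y = while-step [] x (u ∷ y ∷ j ∷ []) (tri-seq (dec-at [] (suc x) (u ∷ y ∷ j ∷ [])) (inc-at (x ∷ u ∷ []) y (j ∷ [])))
      (subst (λ v → Tri L (x ∷ u ∷ suc y ∷ j ∷ []) (0 ∷ u ∷ v ∷ j ∷ [])) (+-suc x y) (move x (suc y)))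

outsCode : List Out → ℕ
outsCode os = ⌜ lmap outCode os ⌝

fetch-out : ∀ o os j → Tri fetch (outsCode (o ∷ os) ∷ 0 ∷ j ∷ []) (outsCode os ∷ outCode o ∷ j ∷ [])
fetch-out o os j = subst₂ (λ t h → Tri fetch (outsCode (o ∷ os) ∷ 0 ∷ j ∷ []) (t ∷ h ∷ j ∷ []))
  (tl-cons (outCode o) (outsCode os)) (hd-cons (outCode o) (outsCode os)) (fetch-tri (outsCode (o ∷ os)) j)

-- The silent version reads the output without acting on it. Its cost is independent of the marks,
-- so that this time can be spent before the mark is set, and it bounds the number of symbols.
silentBody loudBody : Prog
silentBody = fetch ⨾ op (zer (stk 1))
loudBody = fetch ⨾ dispatch handlers

silentLoop : ∀ os j → Tri (while (nonz (stk 2)) silentBody) (outsCode os ∷ 0 ∷ j ∷ []) (0 ∷ 0 ∷ j ∷ [])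
silentLoop [] j = while-done [] (0 ∷ j ∷ [])
silentLoop (o ∷ os) j = while-step [] (pr (outCode o) (outsCode os)) (0 ∷ j ∷ [])
  (tri-seq (fetch-out o os j) (zer-at (outsCode os ∷ []) (outCode o) (j ∷ []))) (silentLoop os j)

loudCost : List ℕ → ℕ → ℕ → List Out → ℕ → ℕ
loudCost ms top a [] j = 1
loudCost ms top a (o ∷ os) j = loudCost ms top (nextAux ms top a o) os j
  + (handleCost ms top a o + (suc (2 * outCode o) + (cost (fetch-out o os j) + 1)))

-- Per symbol, the handler takes at most `5 + 5 * top` steps and the dispatch at most 19, as the
-- codes of symbols are at most 9.
loudCost≤ : ∀ ms top a os j → loudCost ms top a os j ≤ cost (silentLoop os j) + length os * (24 + 5 * top)
loudCost≤ ms top a [] j = ≤-refl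
loudCost≤ ms top a (o ∷ os) j = begin
  loudCost ms top a' os j + (handleCost ms top a o + (suc (2 * outCode o) + (F + 1)))
    ≤⟨ +-mono-≤ (loudCost≤ ms top a' os j) (+-mono-≤ (handleCost≤ ms top a o) (+-monoˡ-≤ (F + 1) (s≤s (*-monoʳ-≤ 2 (outCode≤9 o))))) ⟩
  (cost (silentLoop os j) + length os * H) + ((5 + 5 * top) + (19 + (F + 1)))
    ≡⟨ solve 4 (λ c n t f → (c :+ n) :+ ((con 5 :+ t) :+ (con 19 :+ (f :+ con 1))) := (con 1 :+ c :+ f) :+ ((con 24 :+ t) :+ n)) refl
         (cost (silentLoop os j)) (length os * H) (5 * top) F ⟩
  (suc (cost (silentLoop os j)) + F) + (H + length os * H)
    ≤⟨ +-monoˡ-≤ (H + length os * H) (s≤s (+-monoʳ-≤ (cost (silentLoop os j)) (n≤1+n F))) ⟩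
  suc (cost (silentLoop os j) + suc F) + (H + length os * H) ∎
  where
  open ≤-Reasoning
  a' = nextAux ms top a o
  F = cost (fetch-out o os j)
  H = 24 + 5 * top

length≤silent : ∀ os j → length os ≤ cost (silentLoop os j)
length≤silent [] j = z≤n
length≤silent (o ∷ os) j = s≤s (≤-trans (length≤silent os j) (m≤m+n _ _))

record Played (w : List Sym) (ws : List (List Sym)) (s s' : EState) : Set where
  constructor played
  field
    marks≡ : emarks s' ≡ emarks s
    hits : w ∈ ws → 1 ≤ fnd s'
    misses : ¬ w ∈ ws → fnd s' ≡ fnd s
    keeps : fnd s ≤ fnd s'

loud-exec : ∀ w ms top os v j s → s ⊨ (outsCode os ∷ 0 ∷ j ∷ []) → emarks s ≡ ms → Inv w v (cpv s) (badv s) → Valid ms top (auxv s) os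
  → Σ EState λ s' → Exec w (while (nonz (stk 2)) loudBody) s s' × s' ⊨ (0 ∷ 0 ∷ j ∷ [])
    × Played w (play ms top (auxv s) v os) s s' × time s' ≡ loudCost ms top (auxv s) os j + time s
loud-exec w ms top [] v j s h e i va = tick s , e-while₀ (test-at [] 0 (0 ∷ j ∷ []) w s h) , h , played refl (λ ()) (λ _ → refl) ≤-refl , refl
loud-exec w ms top (o ∷ os) v j s h e i va with runs (fetch-out o os j) w (tick s) h
... | s₁ , ex₁ , h₁ , frame c₁ a₁ b₁ f₁ m₁ , t₁ with dispatch-exec w (outCode o) handlers (handler o) (outsCode os) j s₁ (handlers-at o) h₁
... | dispatched s₂ h₂ (frame c₂ a₂ b₂ f₂ m₂) t₂ exs with handle-exec w ms top v o s₂ (trans m₂ (trans m₁ e))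
        (subst₂ (Inv w v) (sym (trans c₂ c₁)) (sym (trans b₂ b₁)) i)
        (subst (λ a → Valid₁ ms top a o) (sym (trans a₂ a₁)) (proj₁ (Valid-∷ ms top (auxv s) o os va)))
... | s₃ , ex₃ , handled st₃ ax₃ m₃ i₃ hi₃ mi₃ ke₃ , t₃ with loud-exec w ms top os (spell ms top (auxv s₂) v o) j s₃
        (λ k → trans (st₃ k) (h₂ k)) (trans m₃ (trans m₂ (trans m₁ e))) i₃
        (subst (λ a → Valid ms top a os) (sym (trans ax₃ (cong (λ a → nextAux ms top a o) (trans a₂ a₁)))) (proj₂ (Valid-∷ ms top (auxv s) o os va)))
... | s₄ , ex₄ , h₄ , played m₄ hi₄ mi₄ ke₄ , t₄ = s₄ ,
  e-while₁ (test-at [] (outsCode (o ∷ os)) (0 ∷ j ∷ []) w s h) (e-seq ex₁ (exs s₃ ex₃)) ex₄ , h₄ ,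
  played (trans m₄ (trans m₃ (trans m₂ m₁))) hits' misses' (≤-trans (≤-reflexive (sym (trans f₂ f₁))) (≤-trans ke₃ ke₄)) , timing
  where
  a≡ : auxv s₂ ≡ auxv s
  a≡ = trans a₂ a₁
  rest≡ : play ms top (auxv s₃) (spell ms top (auxv s₂) v o) os ≡ play ms top (nextAux ms top (auxv s) o) (spell ms top (auxv s) v o) os
  rest≡ = cong₂ (λ a b → play ms top a (spell ms top b v o) os) (trans ax₃ (cong (λ a → nextAux ms top a o) a≡)) a≡
  split-∈ : ∀ o v {rest : List (List Sym)} → w ∈ completed v o +++ rest → w ∈ completed v o ⊎ w ∈ rest
  split-∈ (emit _) v m = inj₂ m
  split-∈ reset v m = inj₂ m
  split-∈ (walk _) v m = inj₂ m
  split-∈ end v (here m) = inj₁ (here m)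
  split-∈ end v (there m) = inj₂ m
  join-∈ : ∀ o v {rest : List (List Sym)} → w ∈ completed v o ⊎ w ∈ rest → w ∈ completed v o +++ rest
  join-∈ (emit _) v (inj₂ m) = m
  join-∈ reset v (inj₂ m) = m
  join-∈ (walk _) v (inj₂ m) = m
  join-∈ end v (inj₁ (here m)) = here m
  join-∈ end v (inj₂ m) = there m
  hits' : w ∈ play ms top (auxv s) v (o ∷ os) → 1 ≤ fnd s₄
  hits' m with split-∈ o v (subst (w ∈_) (play-∷ ms top (auxv s) v o os) m)
  ... | inj₁ m' = ≤-trans (hi₃ m') ke₄
  ... | inj₂ m' = hi₄ (subst (w ∈_) (sym rest≡) m')
  misses' : ¬ w ∈ play ms top (auxv s) v (o ∷ os) → fnd s₄ ≡ fnd s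
  misses' n = trans (mi₄ (λ m → n (subst (w ∈_) (sym (play-∷ ms top (auxv s) v o os)) (join-∈ o v (inj₂ (subst (w ∈_) rest≡ m))))))
    (trans (mi₃ (λ m → n (subst (w ∈_) (sym (play-∷ ms top (auxv s) v o os)) (join-∈ o v (inj₁ m))))) (trans f₂ f₁))
  timing : time s₄ ≡ loudCost ms top (auxv s) (o ∷ os) j + time s
  timing = trans t₄ (trans (cong₂ _+_ (cong (λ a → loudCost ms top a os j) (trans ax₃ (cong (λ a → nextAux ms top a o) a≡)))
      (trans t₃ (cong₂ _+_ (cong (λ a → handleCost ms top a o) a≡) (trans t₂ (cong (suc (2 * outCode o) +_) t₁)))))
    (solve 5 (λ l h d f t → l :+ (h :+ (d :+ (f :+ (con 1 :+ t)))) := l :+ (h :+ (d :+ (f :+ con 1))) :+ t) refl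
      (loudCost ms top (nextAux ms top (auxv s) o) os j) (handleCost ms top (auxv s) o) (suc (2 * outCode o)) (cost (fetch-out o os j)) (time s)))

-- The stages and their clock

rep : ℕ → Prog → Prog
rep zero p = p
rep (suc k) p = p ⨾ rep k p

rep-tri : ∀ {n p} {ρ : Vec ℕ n} k → Tri p ρ ρ → Tri (rep k p) ρ ρ
rep-tri zero P = P
rep-tri (suc k) P = tri-seq P (rep-tri k P)

rep-cost : ∀ {n p} {ρ : Vec ℕ n} k (P : Tri p ρ ρ) → cost (rep-tri k P) ≡ suc k * cost P
rep-cost zero P = sym (+-identityʳ (cost P))
rep-cost (suc k) P = trans (+-comm (cost (rep-tri k P)) (cost P)) (cong (cost P +_) (rep-cost k P))

-- With 10 s ≤ M the bound s (25 + 5 M) is at most half of M (5 + M).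
quadratic : ∀ M s t → 3 ≤ M → 10 * s ≤ M → t ≤ s * (25 + 5 * M) → suc (t + (4 + M)) ≤ suc M * suc (suc M)
quadratic M s t 3≤M 10s≤M t≤ = *-cancelˡ-≤ 2 (begin
  2 * suc (t + (4 + M)) ≡⟨ solve 2 (λ t M → con 2 :* (con 1 :+ (t :+ (con 4 :+ M))) := con 10 :+ con 2 :* M :+ con 2 :* t) refl t M ⟩
  10 + 2 * M + 2 * t ≤⟨ +-monoʳ-≤ (10 + 2 * M) (*-monoʳ-≤ 2 t≤) ⟩
  10 + 2 * M + 2 * (s * (25 + 5 * M)) ≡⟨ cong (10 + 2 * M +_) (solve 2 (λ s M → con 2 :* (s :* (con 25 :+ con 5 :* M)) := con 10 :* s :* (con 5 :+ M)) refl s M) ⟩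
  10 + 2 * M + 10 * s * (5 + M) ≤⟨ +-monoʳ-≤ (10 + 2 * M) (*-monoˡ-≤ (5 + M) 10s≤M) ⟩
  10 + 2 * M + M * (5 + M) ≡⟨ solve 1 (λ M → con 10 :+ con 2 :* M :+ M :* (con 5 :+ M) := con 4 :+ con 6 :* M :+ M :* M :+ (con 6 :+ M)) refl M ⟩
  4 + 6 * M + M * M + (6 + M) ≤⟨ +-monoʳ-≤ (4 + 6 * M + M * M) (≤-trans (+-monoˡ-≤ M (*-monoʳ-≤ 2 3≤M)) (≤-trans (≤-reflexive (solve 1 (λ M → con 2 :* M :+ M := con 3 :* M) refl M)) (*-monoˡ-≤ M 3≤M))) ⟩
  4 + 6 * M + M * M + M * M ≡⟨ solve 1 (λ M → con 4 :+ con 6 :* M :+ M :* M :+ M :* M := con 2 :* ((con 1 :+ M) :* (con 2 :+ M))) refl M ⟩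
  2 * (suc M * suc (suc M)) ∎)
  where open ≤-Reasoning

module Stages (outs : ℕ → List Out) (outsC : Comp₁ (λ j → outsCode (outs j))) where

  opaque
    load : Prog
    load = prog (Comp₁.body₁ outsC) (0 ∷ []) 2

    load-tri : ∀ j → Tri load (0 ∷ j ∷ []) (outsCode (outs j) ∷ 0 ∷ j ∷ [])
    load-tri j = ok (Comp₁.body₁ outsC) (0 ∷ j ∷ []) (0 ∷ []) (j ∷ []) (mkAgree λ { fzero → s≤s z≤n , refl })

  pass : Prog → Prog
  pass body = load ⨾ while (nonz (stk 2)) body

  -- Ten silent passes make the clock at the mark exceed the running time of the loud pass up to a factor.
  opaque
    silentPass : ∀ j → Tri (pass silentBody) (j ∷ []) (j ∷ [])
    silentPass j = tri-pre (push-zero (j ∷ [])) (tri-post (λ i → trans (sym (push-zero (0 ∷ j ∷ []) i)) (sym (push-zero (j ∷ []) i)))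
      (tri-seq (load-tri j) (silentLoop (outs j) j)))

    silent≡ : ∀ j → cost (silentPass j) ≡ cost (silentLoop (outs j) j) + cost (load-tri j)
    silent≡ j = refl

    warmup : Prog
    warmup = rep 9 (pass silentBody)

    warmup-tri : ∀ j → Tri warmup (j ∷ []) (j ∷ [])
    warmup-tri j = rep-tri 9 (silentPass j)

    warmup-cost : ∀ j → cost (warmup-tri j) ≡ 10 * cost (silentPass j)
    warmup-cost j = rep-cost 9 (silentPass j)

  stage : Prog
  stage = warmup ⨾ op mark ⨾ op (zer aux) ⨾ op (zer cp) ⨾ op (zer bad) ⨾ pass loudBody ⨾ op (inc (stk 0))

  silent : ℕ → ℕ
  silent j = cost (silentPass j)

  markAfter : ℕ → ℕ → ℕ
  markAfter j t = cost (warmup-tri j) + t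

  -- No cost depends on the input word, so starting times and marks can be defined by recursion on
  -- the stages, without reference to an actual run.
  clockMarks : ℕ → ℕ × List ℕ
  clockMarks zero = 0 , []
  clockMarks (suc j) = let t , ms = clockMarks j
                           m = markAfter j t
                       -- The 4 counts the mark and the three resets after the warm-up, the
                       -- successor the increment of the stage number.
                       in suc (loudCost (m ∷ ms) m 0 (outs j) j + (cost (load-tri j) + (4 + m))) , m ∷ ms

  startTime : ℕ → ℕ
  startTime j = proj₁ (clockMarks j)

  marks : ℕ → List ℕ
  marks j = proj₂ (clockMarks j)

  m : ℕ → ℕ
  m j = markAfter j (startTime j)

  words : ℕ → List (List Sym)
  words j = play (marks (suc j)) (m j) 0 [] (outs j)

  m<start : ∀ j → 4 + m j < startTime (suc j)
  m<start j = s≤s (≤-trans (m≤n+m (4 + m j) (cost (load-tri j))) (m≤n+m _ (loudCost (marks (suc j)) (m j) 0 (outs j) j)))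

  m≡ : ∀ j → m j ≡ 10 * silent j + startTime j
  m≡ j = cong (_+ startTime j) (warmup-cost j)

  length≤sil : ∀ j → length (outs j) ≤ silent j
  length≤sil j = ≤-trans (length≤silent (outs j) j) (≤-trans (m≤m+n _ _) (≤-reflexive (sym (silent≡ j))))

  1≤silent : ∀ j → 1 ≤ silent j
  1≤silent j = ≤-trans (pos (outs j)) (≤-trans (m≤m+n _ _) (≤-reflexive (sym (silent≡ j))))
    where
    pos : ∀ os → 1 ≤ cost (silentLoop os j)
    pos [] = ≤-refl
    pos (o ∷ os) = s≤s z≤n

  10≤m : ∀ j → 10 ≤ m j
  10≤m j = ≤-trans (*-monoʳ-≤ 10 (1≤silent j)) (≤-trans (m≤m+n _ (startTime j)) (≤-reflexive (sym (m≡ j))))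

  start≤m : ∀ j → startTime j ≤ m j
  start≤m j = m≤n+m (startTime j) (cost (warmup-tri j))

  m-gap : ∀ j → 2 + m j ≤ m (suc j)
  m-gap j = ≤-trans (≤-trans (m≤n+m (2 + m j) 3) (m<start j)) (start≤m (suc j))

  -- The last pass handles at most `silent j` symbols at a cost linear in `m j` each, and `m j` is
  -- at least ten times `silent j`. So a word longer than `m j` allows stage `j` to be completed.
  start-bound : ∀ j ℓ → m j < ℓ → startTime (suc j) ≤ ℓ * suc ℓ
  start-bound j ℓ m<ℓ = ≤-trans (≤-trans (≤-reflexive (cong suc (sym (+-assoc L (cost (load-tri j)) (4 + m j)))))
      (quadratic (m j) (silent j) (L + cost (load-tri j)) (≤-trans (m≤m+n 3 7) (10≤m j))
        (≤-trans (m≤m+n (10 * silent j) (startTime j)) (≤-reflexive (sym (m≡ j)))) loud))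
      (*-mono-≤ m<ℓ (s≤s m<ℓ))
    where
    open ≤-Reasoning
    L C H : ℕ
    L = loudCost (marks (suc j)) (m j) 0 (outs j) j
    C = cost (silentLoop (outs j) j)
    H = 24 + 5 * m j
    loud : L + cost (load-tri j) ≤ silent j * (25 + 5 * m j)
    loud = begin
      L + cost (load-tri j) ≤⟨ +-monoˡ-≤ (cost (load-tri j)) (loudCost≤ (marks (suc j)) (m j) 0 (outs j) j) ⟩
      C + length (outs j) * H + cost (load-tri j) ≡⟨ solve 3 (λ c n l → c :+ n :+ l := (c :+ l) :+ n) refl C (length (outs j) * H) (cost (load-tri j)) ⟩
      C + cost (load-tri j) + length (outs j) * H ≡⟨ cong (_+ length (outs j) * H) (sym (silent≡ j)) ⟩
      silent j + length (outs j) * H ≤⟨ +-monoʳ-≤ (silent j) (*-monoˡ-≤ H (length≤sil j)) ⟩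
      silent j + silent j * H ≡⟨ sym (*-suc (silent j) H) ⟩
      silent j * suc H ∎

  j≤start : ∀ j → j ≤ startTime j
  j≤start zero = z≤n
  j≤start (suc j) = ≤-trans (s≤s (≤-trans (j≤start j) (≤-trans (start≤m j) (m≤n+m (m j) 4)))) (m<start j)

  module Running (valid : ∀ j → Valid (marks (suc j)) (m j) 0 (outs j)) (w : List Sym) where
    open Flat (looping stage) w

    record AtStage (j : ℕ) (s : EState) : Set where
      constructor atStage
      field
        models : s ⊨ (j ∷ [])
        time≡ : time s ≡ startTime j
        marks≡ : emarks s ≡ marks j

    stage-exec : ∀ j s → AtStage j s → Σ EState λ s' → Exec w stage s s' × AtStage (suc j) s'
      × (w ∈ words j → 1 ≤ fnd s') × (¬ w ∈ words j → fnd s' ≡ fnd s)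
    stage-exec j s (atStage h t mk) with runs (warmup-tri j) w s h
    ... | s₁ , ex₁ , h₁ , frame _ _ _ f₁ m₁ , t₁ with runs (tri-pre {ρ = j ∷ []} (push-zero (j ∷ [])) (load-tri j)) w
            (doOp (zer bad) (doOp (zer cp) (doOp (zer aux) (doOp mark s₁)))) h₁
    ... | s₂ , ex₂ , h₂ , frame c₂ a₂ b₂ f₂ m₂ , t₂ with loud-exec w (marks (suc j)) (m j) (outs j) [] j s₂ h₂
            (trans m₂ (cong₂ _∷_ (trans t₁ (cong (cost (warmup-tri j) +_) t)) (trans m₁ mk)))
            (match w refl c₂ b₂) (subst (λ a → Valid (marks (suc j)) (m j) a (outs j)) (sym a₂) (valid j))
    ... | s₃ , ex₃ , h₃ , played m₃ hi mi _ , t₃ with runs (inc-at [] j []) w s₃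
            (λ i → trans (h₃ i) (trans (sym (push-zero (0 ∷ j ∷ []) i)) (sym (push-zero (j ∷ []) i))))
    ... | s₄ , ex₄ , h₄ , frame _ _ _ f₄ m₄ , t₄ = s₄ ,
      e-seq ex₁ (e-seq (e-op mark) (e-seq (e-op (zer aux)) (e-seq (e-op (zer cp)) (e-seq (e-op (zer bad)) (e-seq (e-seq ex₂ ex₃) ex₄))))) ,
      atStage h₄
        (trans t₄ (cong suc (trans t₃ (cong₂ _+_ (cong (λ a → loudCost (marks (suc j)) (m j) a (outs j) j) a₂)
          (trans t₂ (cong (λ z → cost (load-tri j) + (4 + z)) (trans t₁ (cong (cost (warmup-tri j) +_) t))))))))
        (trans m₄ (trans m₃ (trans m₂ (cong₂ _∷_ (trans t₁ (cong (cost (warmup-tri j) +_) t)) (trans m₁ mk))))) ,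
      (λ w∈ → subst (1 ≤_) (sym f₄) (hi (subst (λ a → w ∈ play (marks (suc j)) (m j) a [] (outs j)) (sym a₂) w∈))) ,
      (λ w∉ → trans f₄ (trans (mi (λ w∈ → w∉ (subst (λ a → w ∈ play (marks (suc j)) (m j) a [] (outs j)) a₂ w∈))) (trans f₂ f₁)))

    stages : ∀ j → Σ EState λ s → erun (startTime j) (entry stage , start) ≡ (entry stage , s) × AtStage j s
      × ((∀ i → i < j → ¬ w ∈ words i) → fnd s ≡ 0) × (∀ i → i < j → w ∈ words i → 1 ≤ fnd s)
    stages zero = start , refl , atStage (λ { zero → refl ; (suc _) → refl }) refl refl , (λ _ → refl) , λ _ ()
    stages (suc j) with stages j
    ... | s , r , at@(atStage _ t _) , none , some with stage-exec j s at
    ... | s' , ex , at'@(atStage _ t' _) , hi , mi with exec-leads ex (λ x → x) (entry stage) (λ _ → refl)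
    ... | n , tn , rn = s' , reached , at' , none' , some'
      where
      n≡ : startTime (suc j) ≡ startTime j + n
      n≡ = trans (sym t') (trans tn (trans (cong (n +_) t) (+-comm n (startTime j))))
      reached : erun (startTime (suc j)) (entry stage , start) ≡ (entry stage , s')
      reached = trans (cong (λ z → erun z (entry stage , start)) n≡) (trans (erun-+ (startTime j) n _) (trans (cong (erun n) r) rn))
      none' : (∀ i → i < suc j → ¬ w ∈ words i) → fnd s' ≡ 0
      none' h = trans (mi (h j (n<1+n j))) (none (λ i i<j → h i (m<n⇒m<1+n i<j)))
      grows : fnd s ≤ fnd s'
      grows = subst (λ c → fnd s ≤ fnd (proj₂ c)) rn (fnd-mono n (entry stage , s))
      some' : ∀ i → i < suc j → w ∈ words i → 1 ≤ fnd s'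
      some' i (s≤s i≤j) w∈ with m≤n⇒m<n∨m≡n i≤j
      ... | inj₁ i<j = ≤-trans (some i i<j w∈) grows
      ... | inj₂ refl = hi w∈

    open Decider stage

    accepts : ∀ j → m j < length w → w ∈ words j → verdictOf w ≡ true
    accepts j m< w∈ = lem (≤-trans (some j ≤-refl w∈) grows)
      where
      N = length w * suc (length w)
      s = proj₁ (stages (suc j))
      r = proj₁ (proj₂ (stages (suc j)))
      some = proj₂ (proj₂ (proj₂ (proj₂ (stages (suc j)))))
      k = N ∸ startTime (suc j)
      grows : fnd s ≤ fnd (proj₂ (erun N (entry stage , start)))
      grows = subst (λ c → fnd s ≤ fnd (proj₂ c))
        (trans (cong (erun k) (sym r)) (trans (sym (erun-+ (startTime (suc j)) k (entry stage , start)))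
          (cong (λ z → erun z (entry stage , start)) (m+[n∸m]≡n (start-bound j (length w) m<)))))
        (fnd-mono k (entry stage , s))
      lem : ∀ {n} → 1 ≤ n → nonzero n ≡ true
      lem (s≤s _) = refl

    -- Every stage takes time, so the cut-off `N` comes no later than the start of stage `N`; up to
    -- that start no success has been counted.
    rejects : (∀ j → ¬ w ∈ words j) → verdictOf w ≡ false
    rejects h = lem (n≤0⇒n≡0 (≤-trans grows (≤-reflexive (none (λ i _ → h i)))))
      where
      N = length w * suc (length w)
      s = proj₁ (stages N)
      r = proj₁ (proj₂ (stages N))
      none = proj₁ (proj₂ (proj₂ (proj₂ (stages N))))
      k = startTime N ∸ N
      grows : fnd (proj₂ (erun N (entry stage , start))) ≤ fnd s
      grows = subst (λ c → fnd (proj₂ (erun N (entry stage , start))) ≤ fnd (proj₂ c))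
        (trans (sym (erun-+ N k (entry stage , start))) (trans (cong (λ z → erun z (entry stage , start)) (m+[n∸m]≡n (j≤start N))) r))
        (fnd-mono k (erun N (entry stage , start)))
      lem : ∀ {n} → n ≡ 0 → nonzero n ≡ false
      lem refl = refl

-- The output of a stage

pr-π : ∀ n → pr (π₁ n) (π₂ n) ≡ n
pr-π n with pr-surj n
... | x , y , refl = cong₂ pr (π₁-pr x y) (π₂-pr x y)

π₁≤ : ∀ n → π₁ n ≤ n
π₁≤ n = subst (π₁ n ≤_) (pr-π n) (x≤pr (π₁ n) (π₂ n))

loopList : ∀ {A : Set} → (A → ℕ → A) → ℕ → A → A
loopList f zero a = a
loopList f (suc k) a = loopList f k (f a k)

-- Strings that are not of the form `1^(m j)`. Those with a 0 are spelled outright, block by block.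
-- Among the others, `1^x` with `x` the `a`-th unmarked cell, counted from 0, is reached from cell 0
-- by `a` walks.
outFill : ℕ → List ℕ → List Out
outFill a [] = reset ∷ replicate a (walk false)
outFill a rs@(_ ∷ _) = replicate a (emit s1) +++ concatMap (λ r → emit s0 ∷ replicate r (emit s1)) rs

iter-outs : ∀ o k os → iter (cons (outCode o)) k (outsCode os) ≡ outsCode (replicate k o +++ os)
iter-outs o zero os = refl
iter-outs o (suc k) os = cong (cons (outCode o)) (iter-outs o k os)

-- The numerals are values of `outCode`: 0 and 1 emit bits, 6 is `reset` and 8 is `walk false`. The
-- constants 2, 4, 5, 7 and 9 below are to be read likewise.
fillN : ℕ → ℕ → ℕ
fillN k a = ifz (π₂ k) (cons 6 (iter (cons 8) (π₁ k) a))
  (iter (cons 1) (π₁ k) (foldrN (λ r a → cons 0 (iter (cons 1) r a)) a (π₂ k)))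

fillC : Comp₂ fillN
fillC = fn₂ (ifzC (π₂C v₀) (consC (constC 6) (iterC (π₁C v₀) v₁ (consC (constC 8) v₀)))
  (iterC (π₁C v₀) (foldrC v₁ (π₂C v₀) (consC zeroC (iterC v₀ v₁ (consC (constC 1) v₀)))) (consC (constC 1) v₀)))

fillN-correct : ∀ k os → fillN k (outsCode os) ≡ outsCode (outFill (π₁ k) (unlist (π₂ k)) +++ os)
fillN-correct k os = trans (cong (λ z → ifz z (cons 6 (iter (cons 8) (π₁ k) (outsCode os)))
    (iter (cons 1) (π₁ k) (foldrN (λ r a → cons 0 (iter (cons 1) r a)) (outsCode os) z))) (sym (⌜unlist⌝ (π₂ k))))
  (shape (unlist (π₂ k)))
  where
  blocks : ∀ rs → foldr (λ r a → cons 0 (iter (cons 1) r a)) (outsCode os) rs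
    ≡ outsCode (concatMap (λ r → emit s0 ∷ replicate r (emit s1)) rs +++ os)
  blocks [] = refl
  blocks (r ∷ rs) = cong (cons 0) (trans (cong (iter (cons 1) r) (blocks rs)) (trans (iter-outs (emit s1) r _)
    (cong outsCode (sym (Listₚ.++-assoc (replicate r (emit s1)) _ os)))))
  shape : ∀ rs → ifz ⌜ rs ⌝ (cons 6 (iter (cons 8) (π₁ k) (outsCode os)))
    (iter (cons 1) (π₁ k) (foldrN (λ r a → cons 0 (iter (cons 1) r a)) (outsCode os) ⌜ rs ⌝)) ≡ outsCode (outFill (π₁ k) rs +++ os)
  shape [] = cong (cons 6) (iter-outs (walk false) (π₁ k) os)
  shape rs@(_ ∷ _) = trans (cong (iter (cons 1) (π₁ k)) (trans (foldrN-correct (λ r a → cons 0 (iter (cons 1) r a)) (outsCode os) rs) (blocks rs)))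
    (trans (iter-outs (emit s1) (π₁ k) _) (cong outsCode (sym (Listₚ.++-assoc (replicate (π₁ k) (emit s1)) _ os))))

nameN : ℕ → ℕ → ℕ
nameN i a = ifz (π₁ i) (cons 6 (iter (cons 7) (suc (π₂ i)) a)) (fillN (π₂ i) a)

nameC : Comp₂ nameN
nameC = fn₂ (ifzC (π₁C v₀) (consC (constC 6) (iterC (sucC (π₂C v₀)) v₁ (consC (constC 7) v₀))) (call₂ fillC (π₂C v₀) v₁))

outName : Ix → List Out
-- The walks stop at the marks `m 0`, ..., `m j` in turn.
outName (inj₁ j) = reset ∷ replicate (suc j) (walk true)
outName (inj₂ k) = outFill (π₁ k) (unlist (π₂ k))

select : ℕ → ℕ → Ix
select zero j = inj₁ j
select (suc _) k = inj₂ k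

ixOf : ℕ → Ix
ixOf i = select (π₁ i) (π₂ i)

ixCode : Ix → ℕ
ixCode (inj₁ j) = pr 0 j
ixCode (inj₂ k) = pr 1 k

ixOf-ixCode : ∀ i → ixOf (ixCode i) ≡ i
ixOf-ixCode (inj₁ j) = cong₂ select (π₁-pr 0 j) (π₂-pr 0 j)
ixOf-ixCode (inj₂ k) = cong₂ select (π₁-pr 1 k) (π₂-pr 1 k)

nameN-correct : ∀ i os → nameN i (outsCode os) ≡ outsCode (outName (ixOf i) +++ os)
nameN-correct i os with π₁ i
... | zero = cong (cons 6) (iter-outs (walk true) (suc (π₂ i)) os)
... | suc _ = fillN-correct (π₂ i) os

outWord : List Ix → List Out → List Out
outWord is os = replicate (length is) (emit sa) +++ foldr (λ i os → emit sd ∷ (outName i +++ os)) (end ∷ os) is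

-- Only the root forms a path of one node. Listing these words too lets the same machine answer the
-- constant queries.
outConst : List Ix → List Out → List Out
outConst (i ∷ []) os = emit sc ∷ (outName i +++ end ∷ os)
outConst _ os = os

wordN : ℕ → ℕ → ℕ
wordN g a = foldrN (λ _ a → cons 2 a) (foldrN (λ i a → cons 5 (nameN i a)) (cons 9 a) g) g

wordC : Comp₂ wordN
wordC = fn₂ (foldrC (foldrC (consC (constC 9) v₁) v₀ (consC (constC 5) (call₂ nameC v₀ v₁))) v₀ (consC (constC 2) v₁))

wordN-correct : ∀ xs os → wordN ⌜ xs ⌝ (outsCode os) ≡ outsCode (outWord (lmap ixOf xs) os)
wordN-correct xs os = trans (foldrN-correct _ _ xs) (trans (cong (λ z → foldr (λ _ a → cons 2 a) z xs) (trans (foldrN-correct _ _ xs) (nodes xs)))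
  (prefixed xs))
  where
  nodes : ∀ xs → foldr (λ i a → cons 5 (nameN i a)) (cons 9 (outsCode os)) xs
    ≡ outsCode (foldr (λ i os → emit sd ∷ (outName i +++ os)) (end ∷ os) (lmap ixOf xs))
  nodes [] = refl
  nodes (x ∷ xs) = cong (cons 5) (trans (cong (nameN x) (nodes xs)) (nameN-correct x _))
  prefixed : ∀ (xs : List ℕ) {os} → foldr (λ _ a → cons 2 a) (outsCode os) xs ≡ outsCode (replicate (length (lmap ixOf xs)) (emit sa) +++ os)
  prefixed [] = refl
  prefixed (x ∷ xs) = cong (cons 2) (prefixed xs)

constN : ℕ → ℕ → ℕ
constN g a = ifz g a (ifz (tl g) (cons 4 (nameN (hd g) (cons 9 a))) a)

constNC : Comp₂ constN
constNC = fn₂ (ifzC v₀ v₁ (ifzC (tlC v₀) (consC (constC 4) (call₂ nameC (hdC v₀) (consC (constC 9) v₁))) v₁))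

constN-correct : ∀ xs os → constN ⌜ xs ⌝ (outsCode os) ≡ outsCode (outConst (lmap ixOf xs) os)
constN-correct [] os = refl
constN-correct (x ∷ []) os rewrite tl-cons x 0 | hd-cons x 0 = cong (cons 4) (nameN-correct x (end ∷ os))
constN-correct (x ∷ y ∷ xs) os rewrite tl-cons x ⌜ y ∷ xs ⌝ = refl

module Names (S : PrefixTree ℕ) (computable : Computable S) (injective : Injective S) (unbounded : UnboundedDepth S) where
  open PrefixTree S
  open Tree S computable injective unbounded
  open Chosen

  eN : ℕ → ℕ
  eN i = ifz (π₁ i) (b (π₂ i)) (c (π₂ i))

  eN-correct : ∀ i → eN i ≡ e (ixOf i)
  eN-correct i with π₁ i
  ... | zero = refl
  ... | suc _ = refl

  mapE : ℕ → ℕ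
  mapE = foldrN (λ i a → cons (eN i) a) 0

  mapE-correct : ∀ xs → mapE ⌜ xs ⌝ ≡ ⌜ lmap e (lmap ixOf xs) ⌝
  mapE-correct xs = trans (foldrN-correct _ 0 xs) (go xs)
    where
    go : ∀ xs → foldr (λ i a → cons (eN i) a) 0 xs ≡ ⌜ lmap e (lmap ixOf xs) ⌝
    go [] = refl
    go (x ∷ xs) = cong₂ cons (eN-correct x) (go xs)

  tooBig : ℕ → ℕ → ℕ
  tooBig j = foldrN (λ i a → (π₂ i ∸ j) + a) 0

  -- Zero if g codes a path whose indices are all at most j.
  invalid : ℕ → ℕ → ℕ
  invalid j g = tooBig j g + relN (mapE g)

  invalidC : Comp₂ invalid
  invalidC = fn₂ (addC (foldrC zeroC v₁ (addC (monusC (π₂C v₀) v₂) v₁))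
    (call₁ relC (foldrC zeroC v₁ (consC (ifzC (π₁C v₀) (call₁ bC (π₂C v₀)) (call₁ cC (π₂C v₀))) v₁))))

  level-ixOf : ∀ x → level (ixOf x) ≡ π₂ x
  level-ixOf x with π₁ x
  ... | zero = refl
  ... | suc _ = refl

  tooBig-sound : ∀ j xs → foldr (λ i a → (π₂ i ∸ j) + a) 0 xs ≡ 0 → All (λ i → level i ≤ j) (lmap ixOf xs)
  tooBig-sound j [] h = []
  tooBig-sound j (x ∷ xs) h = let h₁ , h₂ = sum-zero (π₂ x ∸ j) h in
    subst (_≤ j) (sym (level-ixOf x)) (m∸n≡0⇒m≤n h₁) ∷ tooBig-sound j xs h₂

  tooBig-complete : ∀ j xs → All (λ i → level i ≤ j) (lmap ixOf xs) → foldr (λ i a → (π₂ i ∸ j) + a) 0 xs ≡ 0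
  tooBig-complete j [] [] = refl
  tooBig-complete j (x ∷ xs) (h ∷ hs) = cong₂ _+_ (m≤n⇒m∸n≡0 (subst (_≤ j) (level-ixOf x) h)) (tooBig-complete j xs hs)

  invalid-sound : ∀ j xs → invalid j ⌜ xs ⌝ ≡ 0 → All (λ i → level i ≤ j) (lmap ixOf xs) × Path (lmap e (lmap ixOf xs))
  invalid-sound j xs h = let h₁ , h₂ = sum-zero (tooBig j ⌜ xs ⌝) h in
    tooBig-sound j xs (trans (sym (foldrN-correct _ 0 xs)) h₁) ,
    relN-sound (lmap e (lmap ixOf xs)) (trans (cong relN (sym (mapE-correct xs))) h₂)

  invalid-complete : ∀ j xs → All (λ i → level i ≤ j) (lmap ixOf xs) → Path (lmap e (lmap ixOf xs)) → invalid j ⌜ xs ⌝ ≡ 0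
  invalid-complete j xs s p = cong₂ _+_ (trans (foldrN-correct _ 0 xs) (tooBig-complete j xs s))
    (trans (cong relN (mapE-correct xs)) (relN-complete _ p))

  -- Bounds the code of every path with indices at most j.
  range : ℕ → ℕ
  range j = suc (iter (cons (pr 1 j)) (zseq (suc j) + suc (b j)) 0)

  entryN : ℕ → ℕ → ℕ → ℕ
  entryN j a g = ifz (invalid j g) (wordN g (constN g a)) a

  outEntry : ℕ → List Out → ℕ → List Out
  outEntry j os g = if invalid j g ≡ᵇ 0 then outWord (lmap ixOf (unlist g)) (outConst (lmap ixOf (unlist g)) os) else os

  entryN-correct : ∀ j os g → entryN j (outsCode os) g ≡ outsCode (outEntry j os g)
  entryN-correct j os g with invalid j g
  ... | suc _ = refl
  ... | zero = trans (cong (λ z → wordN z (constN z (outsCode os))) (sym (⌜unlist⌝ g)))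
    (trans (cong (wordN ⌜ unlist g ⌝) (constN-correct (unlist g) os)) (wordN-correct (unlist g) _))

  outs : ℕ → List Out
  outs j = loopList (outEntry j) (range j) []

  opaque
    outsC : Comp₁ (λ j → outsCode (outs j))
    outsC = fn₁ (extC (λ { (j ∷ []) → go j (range j) [] })
      (loopC {h = λ v → entryN (head (tail (tail v))) (head v) (head (tail v))}
        (sucC (iterC (addC (call₁ zseqC (sucC v₀)) (sucC (call₁ bC v₀))) zeroC (consC (prC (constC 1) v₁) v₀))) zeroC
        (ifzC (call₂ invalidC v₂ v₁) (call₂ wordC v₁ (call₂ constNC v₁ v₀)) v₀)))
      where
      go : ∀ j k os → loop (λ a g → entryN j a g) k (outsCode os) ≡ outsCode (loopList (outEntry j) k os)
      go j zero os = refl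
      go j (suc k) os = trans (cong (loop (λ a g → entryN j a g) k) (entryN-correct j os k)) (go j k (outEntry j os k))

-- Names of the nodes

replicate-+ : ∀ {A : Set} m n (x : A) → replicate m x +++ replicate n x ≡ replicate (m + n) x
replicate-+ zero n x = refl
replicate-+ (suc m) n x = cong (x ∷_) (replicate-+ m n x)

-- A bit string 1^a 0 1^r₁ 0 1^r₂ … as the numbers a, r₁, r₂, …

str : ℕ → List ℕ → 𝔹
str a rs = replicate a true +++ concatMap (λ r → false ∷ replicate r true) rs

parse : 𝔹 → ℕ × List ℕ
parse [] = 0 , []
parse (true ∷ σ) = suc (proj₁ (parse σ)) , proj₂ (parse σ)
parse (false ∷ σ) = 0 , proj₁ (parse σ) ∷ proj₂ (parse σ)

str-parse : ∀ σ → str (proj₁ (parse σ)) (proj₂ (parse σ)) ≡ σ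
str-parse [] = refl
str-parse (true ∷ σ) = cong (true ∷_) (str-parse σ)
str-parse (false ∷ σ) = cong (false ∷_) (str-parse σ)

parse-str : ∀ a rs → parse (str a rs) ≡ (a , rs)
parse-str (suc a) rs = cong (λ z → suc (proj₁ z) , proj₂ z) (parse-str a rs)
parse-str zero [] = refl
parse-str zero (r ∷ rs) = cong (λ z → 0 , proj₁ z ∷ proj₂ z) (parse-str r rs)

str-injective : ∀ a rs a' rs' → str a rs ≡ str a' rs' → a ≡ a' × rs ≡ rs'
str-injective a rs a' rs' h = cong proj₁ eq , cong proj₂ eq
  where
  eq : (a , rs) ≡ (a' , rs')
  eq = trans (sym (parse-str a rs)) (trans (cong parse h) (parse-str a' rs'))

gap-correct : ∀ ms b f d a → d ≤ f → (∀ i → i < d → (((a + i) ∈ᵇ ms) ≡ᵒ not b) ≡ true) → (((a + d) ∈ᵇ ms) ≡ᵒ not b) ≡ false → gap ms b f a ≡ d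
gap-correct ms b zero .zero a z≤n _ _ = refl
gap-correct ms b (suc f) zero a _ _ stop = cong (λ t → if t then suc (gap ms b f (suc a)) else 0)
  (subst (λ z → ((z ∈ᵇ ms) ≡ᵒ not b) ≡ false) (+-identityʳ a) stop)
gap-correct ms b (suc f) (suc d) a (s≤s d≤f) before stop =
  trans (cong (λ t → if t then suc (gap ms b f (suc a)) else 0) (subst (λ z → ((z ∈ᵇ ms) ≡ᵒ not b) ≡ true) (+-identityʳ a) (before 0 (s≤s z≤n))))
    (cong suc (gap-correct ms b f d (suc a) d≤f
      (λ i i<d → subst (λ z → ((z ∈ᵇ ms) ≡ᵒ not b) ≡ true) (+-suc a i) (before (suc i) (s≤s i<d)))
      (subst (λ z → ((z ∈ᵇ ms) ≡ᵒ not b) ≡ false) (+-suc a d) stop)))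

-- The output symbols os spell the text x, taking the pointer aux from a to a'.
record Says (ms : List ℕ) (top a : ℕ) (os : List Out) (x : List Sym) (a' : ℕ) : Set where
  constructor says
  field
    plays : ∀ v os' → play ms top a v (os +++ os') ≡ play ms top a' (v +++ x) os'
    valid : ∀ os' → Valid ms top a' os' → Valid ms top a (os +++ os')

module _ {ms : List ℕ} {top : ℕ} where

  says-[] : ∀ {a} → Says ms top a [] [] a
  says-[] {a} = says (λ v os' → cong (λ v → play ms top a v os') (sym (Listₚ.++-identityʳ v))) (λ _ h → h)

  says-++ : ∀ {a os x a' os' x' a″} → Says ms top a os x a' → Says ms top a' os' x' a″ → Says ms top a (os +++ os') (x +++ x') a″
  says-++ {a} {os} {x} {a'} {os'} {x'} {a″} (says p v) (says p' v') = says
    (λ v os″ → trans (cong (play ms top a v) (Listₚ.++-assoc os os' os″)) (trans (p v (os' +++ os″))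
      (trans (p' (v +++ x) os″) (cong (λ v → play ms top a″ v os″) (Listₚ.++-assoc v x x')))))
    (λ os″ h → subst (Valid ms top a) (sym (Listₚ.++-assoc os os' os″)) (v (os' +++ os″) (v' os″ h)))

  says-emit : ∀ {a os x a'} s → Says ms top a os x a' → Says ms top a (emit s ∷ os) (s ∷ x) a'
  says-emit {a' = a'} s (says p v) = says (λ v os' → trans (p (v +++ s ∷ []) os') (cong (λ v → play ms top a' v os') (Listₚ.++-assoc v (s ∷ []) _))) v

  says-reset : ∀ {a os x a'} → Says ms top 0 os x a' → Says ms top a (reset ∷ os) x a'
  says-reset (says p v) = says p v

  says-walk : ∀ b a d → d ≤ top → (∀ i → i < d → (((suc a + i) ∈ᵇ ms) ≡ᵒ not b) ≡ true) → (((suc a + d) ∈ᵇ ms) ≡ᵒ not b) ≡ false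
    → Says ms top a (walk b ∷ []) (replicate (suc d) s1) (suc a + d)
  says-walk b a d d≤ before stop = says
    (λ v os' → cong (λ d → play ms top (suc a + d) (v +++ replicate (suc d) s1) os') eq)
    (λ os' h → subst (λ d → (((suc a + d) ∈ᵇ ms) ≡ᵒ not b) ≡ false) (sym eq) stop , subst (λ d → Valid ms top (suc a + d) os') (sym eq) h)
    where
    eq : gap ms b top (suc a) ≡ d
    eq = gap-correct ms b top d (suc a) d≤ before stop

  says-emits : ∀ {a} n s → Says ms top a (replicate n (emit s)) (replicate n s) a
  says-emits zero s = says-[]
  says-emits (suc n) s = says-emit s (says-emits n s)

  -- A list of outputs that spells the words ws, wherever the pointer aux starts.
  Plays : List Out → List (List Sym) → Set
  Plays os ws = ∀ a → Valid ms top a os × play ms top a [] os ≡ ws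

  plays-word : ∀ {os x os' ws} → (∀ a → Σ ℕ λ a' → Says ms top a os x a') → Plays os' ws → Plays (os +++ end ∷ os') (x ∷ ws)
  plays-word h p a with h a
  ... | a' , says pl va = va _ (proj₁ (p a')) , trans (pl [] _) (cong (_ ∷_) (proj₂ (p a')))

module Naming (m : ℕ → ℕ) (10≤m : ∀ j → 10 ≤ m j) (m-gap : ∀ j → 2 + m j ≤ m (suc j)) where

  marks : ℕ → List ℕ
  marks zero = []
  marks (suc j) = m j ∷ marks j

  m-strict : ∀ {i j} → i < j → m i < m j
  m-strict {i} {suc j} (s≤s i≤j) with m≤n⇒m<n∨m≡n i≤j
  ... | inj₁ i<j = <-trans (m-strict i<j) (≤-trans (n≤1+n _) (m-gap j))
  ... | inj₂ refl = ≤-trans (n≤1+n _) (m-gap j)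

  -- Unmarked cells satisfy `un a ≤ 2 * a`. So those with `a ≤ J` lie below `m J`, where the marks
  -- present in stage `J` are final.
  m-double : ∀ j → 10 + 2 * j ≤ m j
  m-double zero = 10≤m 0
  m-double (suc j) = ≤-trans (≤-reflexive (trans (cong (10 +_) (*-suc 2 j)) (sym (+-assoc 10 2 (2 * j)))) ) (≤-trans (s≤s (s≤s (m-double j))) (m-gap j))

  j<m : ∀ j → j < m j
  j<m j = ≤-trans (s≤s (≤-trans (m≤m+n j (j + 0)) (m≤n+m (2 * j) 9))) (m-double j)

  marks-sound : ∀ x n → (x ∈ᵇ marks n) ≡ true → Σ ℕ λ i → i < n × m i ≡ x
  marks-sound x (suc n) h with x ≟ m n
  ... | yes refl = n , n<1+n n , refl
  ... | no ne with marks-sound x n (trans (sym (cong (_∨ (x ∈ᵇ marks n)) (≢⇒≡ᵇ-false x (m n) ne))) h)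
  ... | i , i<n , e = i , m<n⇒m<1+n i<n , e

  marks-complete : ∀ i n → i < n → (m i ∈ᵇ marks n) ≡ true
  marks-complete i (suc n) (s≤s i≤n) with m≤n⇒m<n∨m≡n i≤n
  ... | inj₂ refl = cong (_∨ (m i ∈ᵇ marks i)) (≡ᵇ-refl (m i))
  ... | inj₁ i<n = trans (cong ((m i ≡ᵇ m n) ∨_) (marks-complete i n i<n)) (∨-true (m i ≡ᵇ m n))
    where
    ∨-true : ∀ b → (b ∨ true) ≡ true
    ∨-true true = refl
    ∨-true false = refl

  -- Since `j < m j`, a mark on cell `x` is among the first `x` marks. This makes the infinite set
  -- of marks decidable.
  isM : ℕ → Bool
  isM x = x ∈ᵇ marks x

  true≢false : ∀ {b : Bool} → b ≡ true → b ≡ false → ⊥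
  true≢false refl ()

  isM-m : ∀ j → isM (m j) ≡ true
  isM-m j = marks-complete j (m j) (j<m j)

  -- Later marks lie beyond `m n`: what the program sees in stage `n` on the cells up to `m n` never
  -- changes again.
  marks-isM : ∀ x n → x ≤ m n → (x ∈ᵇ marks (suc n)) ≡ isM x
  marks-isM x n x≤ with x ∈ᵇ marks (suc n) in e₁ | isM x in e₂
  ... | true | true = refl
  ... | false | false = refl
  ... | true | false with marks-sound x (suc n) e₁
  ... | i , _ , refl = ⊥-elim (true≢false (isM-m i) e₂)
  marks-isM x n x≤ | false | true with marks-sound x x e₂
  ... | i , _ , refl = ⊥-elim (true≢false (marks-complete i (suc n) (s≤s (≮⇒≥ λ n<i → <⇒≱ (m-strict n<i) x≤))) e₁)

  between : ∀ i x → m i < x → x < m (suc i) → isM x ≡ false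
  between i x lo hi with isM x in h
  ... | false = refl
  ... | true with marks-sound x x h
  ... | k , _ , refl = ⊥-elim (<⇒≱ hi (strict⇒mono m-strict (≰⇒> λ k≤i → <⇒≱ lo (strict⇒mono m-strict k≤i))))

  before : ∀ x → x < m 0 → isM x ≡ false
  before x hi with isM x in h
  ... | false = refl
  ... | true with marks-sound x x h
  ... | zero , _ , refl = ⊥-elim (<-irrefl refl hi)
  ... | suc k , _ , refl = ⊥-elim (<⇒≱ hi (<⇒≤ (m-strict (s≤s z≤n))))

  not-consecutive : ∀ x → isM x ≡ true → isM (suc x) ≡ false
  not-consecutive x h with marks-sound x x h
  ... | i , _ , refl = between i (suc (m i)) ≤-refl (m-gap i)

  -- un a is the a-th unmarked cell.
  un : ℕ → ℕ
  un zero = 0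
  un (suc a) = if isM (suc (un a)) then 2 + un a else suc (un a)

  un-unmarked : ∀ a → isM (un a) ≡ false
  un-unmarked zero = refl
  un-unmarked (suc a) with isM (suc (un a)) in h
  ... | true = not-consecutive (suc (un a)) h
  ... | false = h

  un-step : ∀ a → un a < un (suc a)
  un-step a with isM (suc (un a))
  ... | true = s≤s (n≤1+n _)
  ... | false = ≤-refl

  un-strict : ∀ {i j} → i < j → un i < un j
  un-strict {i} {suc j} (s≤s i≤j) with m≤n⇒m<n∨m≡n i≤j
  ... | inj₁ i<j = <-trans (un-strict i<j) (un-step j)
  ... | inj₂ refl = un-step j

  -- Marks are at least two apart, so at most one cell is skipped at each step.
  un≤ : ∀ a → un a ≤ 2 * a
  un≤ zero = z≤n
  un≤ (suc a) = ≤-trans (le (isM (suc (un a)))) (≤-trans (s≤s (s≤s (un≤ a))) (≤-reflexive (sym (*-suc 2 a))))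
    where
    le : ∀ b → (if b then 2 + un a else suc (un a)) ≤ 2 + un a
    le true = ≤-refl
    le false = n≤1+n _

  classify : ∀ x → (Σ ℕ λ j → m j ≡ x) ⊎ (Σ ℕ λ a → un a ≡ x)
  classify x with isM x in h
  ... | true = let j , _ , e = marks-sound x x h in inj₁ (j , e)
  ... | false = inj₂ (unmarked x h)
    where
    unmarked : ∀ x → isM x ≡ false → Σ ℕ λ a → un a ≡ x
    unmarked zero h = 0 , refl
    unmarked (suc x) h with isM x in hx
    unmarked (suc x) h | false with unmarked x hx
    ... | a , refl = suc a , cong (λ b → if b then 2 + un a else suc (un a)) h
    unmarked (suc zero) h | true = ⊥-elim (true≢false hx refl)
    unmarked (suc (suc x)) h | true with isM x in hx'
    ... | true = ⊥-elim (true≢false hx (not-consecutive x hx'))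
    ... | false with unmarked x hx'
    ... | a , refl = suc a , cong (λ b → if b then 2 + un a else suc (un a)) hx

  fillName : ℕ → List ℕ → 𝔹
  fillName a [] = str (un a) []
  fillName a rs@(_ ∷ _) = str a rs

  name : Ix → 𝔹
  name (inj₁ j) = str (m j) []
  name (inj₂ k) = fillName (π₁ k) (unlist (π₂ k))

  fillName-injective : ∀ a rs a' rs' → fillName a rs ≡ fillName a' rs' → a ≡ a' × rs ≡ rs'
  fillName-injective a [] a' [] h = strict⇒injective un-strict a a' (proj₁ (str-injective _ [] _ [] h)) , refl
  fillName-injective a [] a' (r ∷ rs) h with str-injective (un a) [] a' (r ∷ rs) h
  ... | _ , ()
  fillName-injective a (r ∷ rs) a' [] h with str-injective a (r ∷ rs) (un a') [] h
  ... | _ , ()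
  fillName-injective a (r ∷ rs) a' (r' ∷ rs') h = str-injective a (r ∷ rs) a' (r' ∷ rs') h

  long≢fill : ∀ j a rs → str (m j) [] ≢ fillName a rs
  long≢fill j a [] h = true≢false (isM-m j) (trans (cong isM (proj₁ (str-injective (m j) [] (un a) [] h))) (un-unmarked a))
  long≢fill j a (r ∷ rs) h with str-injective (m j) [] a (r ∷ rs) h
  ... | _ , ()

  name-injective : ∀ i i' → name i ≡ name i' → i ≡ i'
  name-injective (inj₁ j) (inj₁ j') h = cong inj₁ (strict⇒injective m-strict j j' (proj₁ (str-injective (m j) [] (m j') [] h)))
  name-injective (inj₁ j) (inj₂ k) h = ⊥-elim (long≢fill j (π₁ k) (unlist (π₂ k)) h)
  name-injective (inj₂ k) (inj₁ j) h = ⊥-elim (long≢fill j (π₁ k) (unlist (π₂ k)) (sym h))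
  name-injective (inj₂ k) (inj₂ k') h with fillName-injective (π₁ k) (unlist (π₂ k)) (π₁ k') (unlist (π₂ k')) h
  ... | h₁ , h₂ = cong inj₂ (trans (sym (pr-π k)) (trans (cong₂ pr h₁ (trans (sym (⌜unlist⌝ (π₂ k))) (trans (cong ⌜_⌝ h₂) (⌜unlist⌝ (π₂ k'))))) (pr-π k')))

  fill-pr : ∀ a rs → name (inj₂ (pr a ⌜ rs ⌝)) ≡ fillName a rs
  fill-pr a rs = cong₂ fillName (π₁-pr a ⌜ rs ⌝) (trans (cong unlist (π₂-pr a ⌜ rs ⌝)) (unlist-⌜⌝ rs))

  name-surjective : ∀ σ → Σ Ix λ i → name i ≡ σ
  name-surjective σ = subst (λ σ → Σ Ix λ i → name i ≡ σ) (str-parse σ) (go (proj₁ (parse σ)) (proj₂ (parse σ)))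
    where
    go : ∀ a rs → Σ Ix λ i → name i ≡ str a rs
    go a (r ∷ rs) = inj₂ (pr a ⌜ r ∷ rs ⌝) , fill-pr a (r ∷ rs)
    go a [] with classify a
    ... | inj₁ (j , refl) = inj₁ j , refl
    ... | inj₂ (a' , refl) = inj₂ (pr a' 0) , fill-pr a' []

  module _ (J : ℕ) where

    ms : List ℕ
    ms = marks (suc J)

    status : ∀ {x b b'} → x ≤ m J → isM x ≡ b → ((x ∈ᵇ ms) ≡ᵒ b') ≡ (b ≡ᵒ b')
    status {x} {b' = b'} le h = cong (_≡ᵒ b') (trans (marks-isM x J le) h)

    says-mark : ∀ a j → j ≤ J → a < m j → (∀ x → a < x → x < m j → isM x ≡ false)
      → Σ ℕ λ d → a + d ≡ m j × Says ms (m J) a (walk true ∷ []) (replicate d s1) (m j)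
    says-mark a j j≤J a< h = suc d , trans (+-suc a d) gap≡ , subst (Says ms (m J) a (walk true ∷ []) (replicate (suc d) s1)) gap≡
        (says-walk true a d (≤-trans (m≤n+m d (suc a)) (≤-trans (≤-reflexive gap≡) mj≤))
          (λ i i<d → status {b = false} (≤-trans (<⇒≤ (lt i<d)) mj≤) (h (suc a + i) (s≤s (m≤m+n a i)) (lt i<d)))
          (status {b = true} (≤-trans (≤-reflexive gap≡) mj≤) (trans (cong isM gap≡) (isM-m j))))
      where
      d = m j ∸ suc a
      gap≡ : suc a + d ≡ m j
      gap≡ = m+[n∸m]≡n a<
      mj≤ : m j ≤ m J
      mj≤ = strict⇒mono m-strict j≤J
      lt : ∀ {i} → i < d → suc a + i < m j
      lt i<d = ≤-trans (+-monoʳ-< (suc a) i<d) (≤-reflexive gap≡)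

    says-marks : ∀ j → j ≤ J → Says ms (m J) 0 (replicate (suc j) (walk true)) (replicate (m j) s1) (m j)
    says-marks zero j≤ with says-mark 0 0 j≤ (≤-trans (s≤s z≤n) (10≤m 0)) (λ x _ hi → before x hi)
    ... | d , refl , sy = sy
    says-marks (suc j) j≤ with says-mark (m j) (suc j) j≤ (m-strict (n<1+n j)) (between j)
    ... | d , e , sy = subst₂ (λ os x → Says ms (m J) 0 os x (m (suc j))) (snoc (suc j)) (trans (replicate-+ (m j) d s1) (cong (λ z → replicate z s1) e))
        (says-++ (says-marks j (≤-trans (n≤1+n j) j≤)) sy)
      where
      snoc : ∀ n → replicate n (walk true) +++ walk true ∷ [] ≡ replicate (suc n) (walk true)
      snoc n = trans (replicate-+ n 1 (walk true)) (cong (λ z → replicate z (walk true)) (+-comm n 1))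

    says-un : ∀ a → a ≤ J → Says ms (m J) 0 (replicate a (walk false)) (replicate (un a) s1) (un a)
    says-un zero a≤ = says-[]
    says-un (suc a) a≤ = subst (λ os → Says ms (m J) 0 os (replicate (un (suc a)) s1) (un (suc a)))
        (trans (replicate-+ a 1 (walk false)) (cong (λ z → replicate z (walk false)) (+-comm a 1)))
        (next (isM (suc (un a))) refl)
      where
      -- A walk from `un a` looks no further than cell `2 + un a`, so it meets only marks that are
      -- final.
      far : 3 + un a ≤ m J
      far = ≤-trans (≤-trans (s≤s (s≤s (s≤s (≤-trans (un≤ a) (*-monoʳ-≤ 2 (≤-trans (n≤1+n a) a≤)))))) (m≤n+m (3 + 2 * J) 7)) (m-double J)
      prev : Says ms (m J) 0 (replicate a (walk false)) (replicate (un a) s1) (un a)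
      prev = says-un a (≤-trans (n≤1+n a) a≤)
      next : ∀ t → isM (suc (un a)) ≡ t → Says ms (m J) 0 (replicate a (walk false) +++ walk false ∷ []) (replicate (un (suc a)) s1) (un (suc a))
      next false h = subst₂ (Says ms (m J) 0 (replicate a (walk false) +++ walk false ∷ []))
        (trans (replicate-+ (un a) 1 s1) (cong (λ z → replicate z s1) (trans (+-comm (un a) 1) eq))) (trans (+-identityʳ _) eq)
        (says-++ prev (says-walk false (un a) 0 z≤n (λ _ ())
          (status {b = false} (≤-trans (≤-reflexive (+-identityʳ _)) (≤-trans (m≤n+m (suc (un a)) 2) far)) (trans (cong isM (+-identityʳ _)) h))))
        where
        eq : suc (un a) ≡ un (suc a)
        eq = sym (cong (λ b → if b then 2 + un a else suc (un a)) h)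
      next true h = subst₂ (Says ms (m J) 0 (replicate a (walk false) +++ walk false ∷ []))
        (trans (replicate-+ (un a) 2 s1) (cong (λ z → replicate z s1) (trans (+-comm (un a) 2) eq))) (trans (+-comm (suc (un a)) 1) eq)
        (says-++ prev (says-walk false (un a) 1 (≤-trans (m≤m+n 1 9) (10≤m J))
          (λ { zero _ → status {b = true} (≤-trans (≤-reflexive (+-identityʳ _)) (≤-trans (m≤n+m (suc (un a)) 2) far)) (trans (cong isM (+-identityʳ _)) h) ; (suc i) (s≤s ()) })
          (status {b = false} (≤-trans (≤-reflexive (+-comm (suc (un a)) 1)) (≤-trans (n≤1+n _) far))
            (trans (cong isM (+-comm (suc (un a)) 1)) (not-consecutive (suc (un a)) h)))))
        where
        eq : 2 + un a ≡ un (suc a)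
        eq = sym (cong (λ b → if b then 2 + un a else suc (un a)) h)

    enc-ones : ∀ n → enc𝔹 (str n []) ≡ replicate n s1
    enc-ones n = trans (cong enc𝔹 (Listₚ.++-identityʳ (replicate n true))) (Listₚ.map-replicate encBit n true)

    says-name : ∀ i → level i ≤ J → ∀ a → Σ ℕ λ a' → Says ms (m J) a (outName i) (enc𝔹 (name i)) a'
    says-name (inj₁ j) j≤ a = m j , subst (λ x → Says ms (m J) a (outName (inj₁ j)) x (m j)) (sym (enc-ones (m j))) (says-reset (says-marks j j≤))
    says-name (inj₂ k) k≤ a = fill (π₁ k) (unlist (π₂ k)) (≤-trans (π₁≤ k) k≤)
      where
      blocks : ∀ rs → Says ms (m J) a (concatMap (λ r → emit s0 ∷ replicate r (emit s1)) rs) (enc𝔹 (concatMap (λ r → false ∷ replicate r true) rs)) a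
      blocks [] = says-[]
      blocks (r ∷ rs) = subst (λ x → Says ms (m J) a (concatMap (λ r → emit s0 ∷ replicate r (emit s1)) (r ∷ rs)) (s0 ∷ x) a)
        (sym (trans (Listₚ.map-++ encBit (replicate r true) _) (cong (_+++ enc𝔹 (concatMap (λ r → false ∷ replicate r true) rs)) (Listₚ.map-replicate encBit r true))))
        (says-emit s0 (says-++ (says-emits r s1) (blocks rs)))
      fill : ∀ n rs → n ≤ J → Σ ℕ λ a' → Says ms (m J) a (outFill n rs) (enc𝔹 (fillName n rs)) a'
      fill n [] n≤ = un n , subst (λ x → Says ms (m J) a (outFill n []) x (un n)) (sym (enc-ones (un n))) (says-reset (says-un n n≤))
      fill n (r ∷ rs) n≤ = a , subst (λ x → Says ms (m J) a (outFill n (r ∷ rs)) x a)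
        (sym (trans (Listₚ.map-++ encBit (replicate n true) _) (cong (_+++ enc𝔹 (concatMap (λ r → false ∷ replicate r true) (r ∷ rs))) (Listₚ.map-replicate encBit n true))))
        (says-++ (says-emits n s1) (blocks (r ∷ rs)))

-- Listed words and queries

Blocks : List 𝔹 → List Sym
Blocks = concatMap (λ y → sd ∷ enc𝔹 y)

-- No bit is encoded by `sd`, so the separator shows where a name ends.
enc-block-injective : ∀ y y' zs zs' → enc𝔹 y +++ Blocks zs ≡ enc𝔹 y' +++ Blocks zs' → y ≡ y' × Blocks zs ≡ Blocks zs'
enc-block-injective [] [] zs zs' h = refl , h
enc-block-injective [] (b ∷ y') zs zs' h = ⊥-elim (clash zs b h)
  where
  clash : ∀ zs b {r} → Blocks zs ≢ encBit b ∷ r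
  clash (z ∷ zs) true ()
  clash (z ∷ zs) false ()
enc-block-injective (b ∷ y) [] zs zs' h = ⊥-elim (clash zs' b (sym h))
  where
  clash : ∀ zs b {r} → Blocks zs ≢ encBit b ∷ r
  clash (z ∷ zs) true ()
  clash (z ∷ zs) false ()
enc-block-injective (b ∷ y) (b' ∷ y') zs zs' h with enc-block-injective y y' zs zs' (Listₚ.∷-injectiveʳ h)
... | refl , h' = cong (_∷ y) (bit-injective b b' (Listₚ.∷-injectiveˡ h)) , h'
  where
  bit-injective : ∀ b b' → encBit b ≡ encBit b' → b ≡ b'
  bit-injective true true _ = refl
  bit-injective false false _ = refl

Blocks-injective : ∀ ys ys' → Blocks ys ≡ Blocks ys' → ys ≡ ys'
Blocks-injective [] [] h = refl
Blocks-injective (y ∷ ys) (y' ∷ ys') h with enc-block-injective y y' ys ys' (Listₚ.∷-injectiveʳ h)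
... | refl , h' = cong (y ∷_) (Blocks-injective ys ys' h')

query-injective : ∀ m n ys ys' → replicate m sa +++ Blocks ys ≡ replicate n sa +++ Blocks ys' → ys ≡ ys'
query-injective zero zero ys ys' h = Blocks-injective ys ys' h
query-injective (suc m) (suc n) ys ys' h = query-injective m n ys ys' (Listₚ.∷-injectiveʳ h)
query-injective zero (suc n) [] ys' ()
query-injective zero (suc n) (y ∷ ys) ys' ()
query-injective (suc m) zero ys [] ()
query-injective (suc m) zero ys (y ∷ ys') ()

enc𝔹-injective : ∀ y y' → enc𝔹 y ≡ enc𝔹 y' → y ≡ y'
enc𝔹-injective y y' h = proj₁ (enc-block-injective y y' [] [] (cong (_+++ []) h))

code-bound : ∀ B N xs → All (_≤ B) xs → length xs ≤ N → ⌜ xs ⌝ ≤ iter (cons B) N 0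
code-bound B N [] _ _ = z≤n
code-bound B (suc N) (x ∷ xs) (x≤ ∷ xs≤) (s≤s l) = s≤s (pr-mono x≤ (code-bound B N xs xs≤ l))

loopList-∈ : ∀ {A : Set} (f : ℕ → List A) k ws {w} → w ∈ loopList (λ ws g → f g +++ ws) k ws → w ∈ ws ⊎ Σ ℕ λ g → w ∈ f g
loopList-∈ f zero ws h = inj₁ h
loopList-∈ f (suc k) ws h with loopList-∈ f k (f k +++ ws) h
... | inj₂ r = inj₂ r
... | inj₁ h' with ∈-++⁻ (f k) h'
... | inj₁ h″ = inj₂ (k , h″)
... | inj₂ h″ = inj₁ h″

∈-loopList : ∀ {A : Set} (f : ℕ → List A) k ws {w} → w ∈ ws ⊎ (Σ ℕ λ g → g < k × w ∈ f g) → w ∈ loopList (λ ws g → f g +++ ws) k ws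
∈-loopList f zero ws (inj₁ h) = h
∈-loopList f (suc k) ws (inj₁ h) = ∈-loopList f k _ (inj₁ (∈-++⁺ʳ (f k) h))
∈-loopList f (suc k) ws (inj₂ (g , s≤s g≤k , h)) with m≤n⇒m<n∨m≡n g≤k
... | inj₁ g<k = ∈-loopList f k _ (inj₂ (g , g<k , h))
... | inj₂ refl = ∈-loopList f k _ (inj₁ (∈-++⁺ˡ h))

module Words (S : PrefixTree ℕ) (computable : Computable S) (injective : Injective S) (unbounded : UnboundedDepth S)
  (m : ℕ → ℕ) (10≤m : ∀ j → 10 ≤ m j) (m-gap : ∀ j → 2 + m j ≤ m (suc j)) where
  open Tree S computable injective unbounded
  open Names S computable injective unbounded
  open Naming m 10≤m m-gap
  open Chosen

  word : List Ix → List Sym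
  word is = replicate (length is) sa +++ Blocks (lmap name is)

  constWords : List Ix → List (List Sym)
  constWords (i ∷ []) = (sc ∷ enc𝔹 (name i)) ∷ []
  constWords _ = []

  module _ (J : ℕ) where

    says-nodes : ∀ is → All (λ i → level i ≤ J) is → ∀ a
      → Σ ℕ λ a' → Says (ms J) (m J) a (concatMap (λ i → emit sd ∷ outName i) is) (Blocks (lmap name is)) a'
    says-nodes [] [] a = a , says-[]
    says-nodes (i ∷ is) (l ∷ ls) a =
      let a₁ , sy₁ = says-name J i l a
          a₂ , sy₂ = says-nodes is ls a₁
      in a₂ , says-emit sd (says-++ sy₁ sy₂)

    says-word : ∀ is → All (λ i → level i ≤ J) is → ∀ a
      → Σ ℕ λ a' → Says (ms J) (m J) a (replicate (length is) (emit sa) +++ concatMap (λ i → emit sd ∷ outName i) is) (word is) a'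
    says-word is ls a = let a' , sy = says-nodes is ls a in a' , says-++ (says-emits (length is) sa) sy

    outWord≡ : ∀ is os → outWord is os ≡ (replicate (length is) (emit sa) +++ concatMap (λ i → emit sd ∷ outName i) is) +++ end ∷ os
    outWord≡ is os = trans (cong (replicate (length is) (emit sa) +++_) (nodes is)) (sym (Listₚ.++-assoc (replicate (length is) (emit sa)) _ (end ∷ os)))
      where
      nodes : ∀ is → foldr (λ i os → emit sd ∷ (outName i +++ os)) (end ∷ os) is ≡ concatMap (λ i → emit sd ∷ outName i) is +++ end ∷ os
      nodes [] = refl
      nodes (i ∷ is) = cong (emit sd ∷_) (trans (cong (outName i +++_) (nodes is)) (sym (Listₚ.++-assoc (outName i) _ (end ∷ os))))

    PlaysJ : List Out → List (List Sym) → Set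
    PlaysJ = Plays {ms J} {m J}

    plays-const : ∀ is os ws → All (λ i → level i ≤ J) is → PlaysJ os ws → PlaysJ (outConst is os) (constWords is +++ ws)
    plays-const [] os ws _ p = p
    plays-const (i ∷ []) os ws (l ∷ []) p = plays-word {os = emit sc ∷ outName i} (λ a → let a' , sy = says-name J i l a in a' , says-emit sc sy) p
    plays-const (_ ∷ _ ∷ _) os ws _ p = p

    entryWords : ℕ → List (List Sym)
    entryWords g = if invalid J g ≡ᵇ 0 then word (lmap ixOf (unlist g)) ∷ constWords (lmap ixOf (unlist g)) else []

    decoded : ∀ g → invalid J g ≡ 0 → All (λ i → level i ≤ J) (lmap ixOf (unlist g)) × Path (lmap e (lmap ixOf (unlist g)))
    decoded g h = invalid-sound J (unlist g) (trans (cong (invalid J) (⌜unlist⌝ g)) h)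

    plays-entry : ∀ g os ws → PlaysJ os ws → PlaysJ (outEntry J os g) (entryWords g +++ ws)
    plays-entry g os ws p = go (invalid J g) refl
      where
      is = lmap ixOf (unlist g)
      go : ∀ v → invalid J g ≡ v → PlaysJ (if v ≡ᵇ 0 then outWord is (outConst is os) else os) ((if v ≡ᵇ 0 then word is ∷ constWords is else []) +++ ws)
      go (suc _) h = p
      go zero h = subst (λ os → PlaysJ os (word is ∷ (constWords is +++ ws))) (sym (outWord≡ is (outConst is os)))
        (plays-word (says-word is (proj₁ (decoded g h))) (plays-const is os ws (proj₁ (decoded g h)) p))

    wordList : List (List Sym)
    wordList = loopList (λ ws g → entryWords g +++ ws) (range J) []

    plays : PlaysJ (outs J) wordList
    plays = go (range J) [] [] (λ a → tt , refl)
      where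
      go : ∀ k os ws → PlaysJ os ws → PlaysJ (loopList (outEntry J) k os) (loopList (λ ws g → entryWords g +++ ws) k ws)
      go zero os ws p = p
      go (suc k) os ws p = go k _ _ (plays-entry k os ws p)

    wordList-sound : ∀ {w} → w ∈ wordList → Σ (List Ix) λ is → Path (lmap e is) × w ∈ word is ∷ constWords is
    wordList-sound {w} h = found (loopList-∈ entryWords (range J) [] h)
      where
      found : w ∈ [] ⊎ (Σ ℕ λ g → w ∈ entryWords g) → Σ (List Ix) λ is → Path (lmap e is) × w ∈ word is ∷ constWords is
      found (inj₂ (g , h)) = go (invalid J g) refl h
        where
        is = lmap ixOf (unlist g)
        go : ∀ v → invalid J g ≡ v → w ∈ (if v ≡ᵇ 0 then word is ∷ constWords is else []) → Σ (List Ix) λ is → Path (lmap e is) × w ∈ word is ∷ constWords is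
        go zero hv h = is , proj₂ (decoded g hv) , h

    small : ∀ i → level i ≤ J → e i < zseq (suc J) + suc (b J)
    small (inj₁ j) l = ≤-trans (s≤s (b-mono l)) (m≤n+m (suc (b J)) (zseq (suc J)))
    small (inj₂ k) l = ≤-trans (c<z (choose k)) (≤-trans (zseq-mono (s≤s l)) (m≤m+n (zseq (suc J)) (suc (b J))))

    ixCode≤ : ∀ i → level i ≤ J → ixCode i ≤ pr 1 J
    ixCode≤ (inj₁ j) l = pr-mono z≤n l
    ixCode≤ (inj₂ k) l = pr-mono ≤-refl l

    ixOf-codes : ∀ is → lmap ixOf (lmap ixCode is) ≡ is
    ixOf-codes [] = refl
    ixOf-codes (i ∷ is) = cong₂ _∷_ (ixOf-ixCode i) (ixOf-codes is)

    wordList-complete : ∀ is → All (λ i → level i ≤ J) is → Path (lmap e is) → ∀ {w} → w ∈ word is ∷ constWords is → w ∈ wordList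
    wordList-complete is ls path {w} h = ∈-loopList entryWords (range J) [] (inj₂ (g , s≤s g≤ , inside))
      where
      codes = lmap ixCode is
      g = ⌜ codes ⌝
      -- The nodes of a path are distinct, and those of index at most `J` lie below this bound, so
      -- there are at most that many.
      short : length codes ≤ zseq (suc J) + suc (b J)
      short = subst (_≤ _) (trans (Listₚ.length-reverse (lmap e is)) (trans (Listₚ.length-map e is) (sym (Listₚ.length-map ixCode is))))
        (Unique-bounded (rpath-unique (reverse (lmap e is)) (subst Path (sym (Listₚ.reverse-involutive (lmap e is))) path))
          (All.tabulate λ x∈ → let i , i∈ , x≡ = ∈-map⁻ e (reverse⁻ x∈) in subst (_< _) (sym x≡) (small i (All.lookup ls i∈))))
      g≤ : g ≤ iter (cons (pr 1 J)) (zseq (suc J) + suc (b J)) 0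
      g≤ = code-bound (pr 1 J) _ codes (All.tabulate λ x∈ → let i , i∈ , x≡ = ∈-map⁻ ixCode x∈ in subst (_≤ _) (sym x≡) (ixCode≤ i (All.lookup ls i∈))) short
      zero! : invalid J g ≡ 0
      zero! = invalid-complete J codes (subst (All (λ i → level i ≤ J)) (sym (ixOf-codes is)) ls) (subst (λ is → Path (lmap e is)) (sym (ixOf-codes is)) path)
      inside : w ∈ entryWords g
      inside = subst (λ v → w ∈ (if v ≡ᵇ 0 then word (lmap ixOf (unlist g)) ∷ constWords (lmap ixOf (unlist g)) else [])) (sym zero!)
        (subst (λ is → w ∈ word is ∷ constWords is) (sym (trans (cong (lmap ixOf) (unlist-⌜⌝ codes)) (ixOf-codes is))) h)

  -- On every path the largest index is attained at some node b j, whose name is long.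
  top-level : ∀ is → Path (lmap e is) → Σ ℕ λ J → inj₁ J ∈ is × All (λ i → level i ≤ J) is
  top-level [] (n , x ∷ v , () , r)
  top-level is@(i ∷ is') path = let x , x∈ , l = maximal i is' in go x x∈ l
    where
    maximal : ∀ i is → Σ Ix λ x → x ∈ i ∷ is × All (λ y → level y ≤ level x) (i ∷ is)
    maximal i [] = i , here refl , ≤-refl ∷ []
    maximal i (i' ∷ is) with maximal i' is
    ... | x , x∈ , l with ≤-total (level i) (level x)
    ... | inj₁ i≤x = x , there x∈ , i≤x ∷ l
    ... | inj₂ x≤i = i , here refl , ≤-refl ∷ All.map (λ h → ≤-trans h x≤i) l
    go : ∀ x → x ∈ is → All (λ y → level y ≤ level x) is → Σ ℕ λ J → inj₁ J ∈ is × All (λ i → level i ≤ J) is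
    go (inj₁ j) x∈ l = j , x∈ , l
    -- The path contains `p k`, which is some `b j` with `k ≤ j`. As `k` is maximal, `j` bounds all
    -- indices as well.
    go (inj₂ k) x∈ l =
      let j , k≤j , b∈ = through-c (reverse (lmap e is)) k (subst Path (sym (Listₚ.reverse-involutive (lmap e is))) path) (reverse⁺ (∈-map⁺ e x∈))
          y , y∈ , b≡ = ∈-map⁻ e (reverse⁻ b∈)
          y≡ = e-injective (inj₁ j) y b≡
      in j , subst (_∈ is) (sym y≡) y∈ , All.map (λ h → ≤-trans h k≤j) l

  name-length : ∀ J → length (enc𝔹 (name (inj₁ J))) ≡ m J
  name-length J = trans (cong length (enc-ones J (m J))) (Listₚ.length-replicate (m J))

  -- The length that acceptance requires: the name of `b J` alone pays for the stage that lists the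
  -- word.
  long : ∀ {J} is → inj₁ J ∈ is → m J < length (word is)
  long {J} is J∈ = ≤-trans (s≤s (≤-reflexive (sym (name-length J)))) (≤-trans (block is J∈) (≤-trans (m≤n+m _ (length (replicate (length is) sa))) (≤-reflexive (sym (Listₚ.length-++ (replicate (length is) sa))))))
    where
    block : ∀ {i} is → i ∈ is → length (enc𝔹 (name i)) < length (Blocks (lmap name is))
    block {i} (.i ∷ is) (here refl) = s≤s (≤-trans (m≤m+n _ _) (≤-reflexive (sym (Listₚ.length-++ (enc𝔹 (name i))))))
    block (y ∷ is) (there h) = ≤-trans (block is h) (≤-trans (m≤n+m _ (length (enc𝔹 (name y)))) (≤-trans (≤-reflexive (sym (Listₚ.length-++ (enc𝔹 (name y))))) (n≤1+n _)))

  ixn : 𝔹 → Ix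
  ixn σ = proj₁ (name-surjective σ)

  name-ixn : ∀ σ → name (ixn σ) ≡ σ
  name-ixn σ = proj₂ (name-surjective σ)

  ixn-name : ∀ i → ixn (name i) ≡ i
  ixn-name i = name-injective (ixn (name i)) i (name-ixn (name i))

  names-ixn : ∀ ys → lmap name (lmap ixn ys) ≡ ys
  names-ixn [] = refl
  names-ixn (y ∷ ys) = cong₂ _∷_ (name-ixn y) (names-ixn ys)

-- The isomorphic tree on strings and its decision procedure

module Copy (S : PrefixTree ℕ) (computable : Computable S) (injective : Injective S) (unbounded : UnboundedDepth S)
  (m : ℕ → ℕ) (10≤m : ∀ j → 10 ≤ m j) (m-gap : ∀ j → 2 + m j ≤ m (suc j)) where
  open PrefixTree S
  open Tree S computable injective unbounded
  open Naming m 10≤m m-gap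
  open Words S computable injective unbounded m 10≤m m-gap

  from : 𝔹 → ℕ
  from σ = e (ixn σ)

  to : ℕ → 𝔹
  to x with domN x ≟ 0
  ... | yes h = name (proj₁ (e-surjective x (domN-sound x h)))
  -- An arbitrary value: isomorphisms are tested on the domain only.
  ... | no _ = []

  to-e : ∀ i → to (e i) ≡ name i
  to-e i with domN (e i) ≟ 0
  ... | yes h = cong name (e-injective (proj₁ (e-surjective (e i) (domN-sound (e i) h))) i (proj₂ (e-surjective (e i) (domN-sound (e i) h))))
  ... | no ne = ⊥-elim (ne (domN-complete (e i) (e-dom i)))

  to-from : ∀ σ → to (from σ) ≡ σ
  to-from σ = trans (to-e (ixn σ)) (name-ixn σ)

  from-to : ∀ x → Dom x → from (to x) ≡ x
  from-to x d = let i , h = e-surjective x d in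
    subst (λ x → from (to x) ≡ x) h (trans (cong from (to-e i)) (cong e (ixn-name i)))

  from-injective : ∀ {σ τ} → from σ ≡ from τ → σ ≡ τ
  from-injective {σ} {τ} h = trans (sym (to-from σ)) (trans (cong to h) (to-from τ))

  map-from-injective : ∀ {n} (as bs : Vec 𝔹 n) → Vec.map from as ≡ Vec.map from bs → as ≡ bs
  map-from-injective [] [] h = refl
  map-from-injective (a ∷ as) (b ∷ bs) h = cong₂ _∷_ (from-injective (Vecₚ.∷-injectiveˡ h)) (map-from-injective as bs (Vecₚ.∷-injectiveʳ h))

  map-from-to : ∀ {n} {xs : Vec ℕ n} → VAll.All Dom xs → Vec.map from (Vec.map to xs) ≡ xs
  map-from-to VAll.[] = refl
  map-from-to (d VAll.∷ ds) = cong₂ _∷_ (from-to _ d) (map-from-to ds)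

  copy-tree : PrefixTree 𝔹
  copy-tree = record
    { Dom = λ _ → ⊤
    ; R = λ n ys → R n (Vec.map from ys)
    ; root = to root
    ; root-dom = tt
    ; R-dom = λ n ys _ → VAll.universal (λ _ → tt) ys
    ; R₁-root = λ y → (λ r → trans (sym (to-from y)) (cong to (proj₁ (R₁-root (from y)) r)))
                    , (λ h → proj₂ (R₁-root (from y)) (trans (cong from h) (from-to root root-dom)))
    ; prefix = λ i j xs ys r → prefix i j (Vec.map from xs) (Vec.map from ys) (subst (R (i + j)) (Vecₚ.map-++ from xs ys) r)
    }

  copy-injective : Injective copy-tree
  copy-injective n k as bs c p q = lift _ _ as bs (injective n k (Vec.map from as) (Vec.map from bs) (from c)
      (subst (R n) (Vecₚ.map-∷ʳ from c as) p) (subst (R k) (Vecₚ.map-∷ʳ from c bs) q))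
    where
    lift : ∀ n k (as : Vec 𝔹 n) (bs : Vec 𝔹 k) → Σ (n ≡ k) (λ h → subst (Vec ℕ) h (Vec.map from as) ≡ Vec.map from bs)
      → Σ (n ≡ k) λ h → subst (Vec 𝔹) h as ≡ bs
    lift n .n as bs (refl , h) = refl , map-from-injective as bs h

  copy-unbounded : UnboundedDepth copy-tree
  copy-unbounded n = let xs , r = unbounded n in Vec.map to xs , subst (R n) (sym (map-from-to (R-dom n xs r))) r

  copy-iso : Iso S copy-tree
  copy-iso = record
    { to = to ; from = from
    ; to-dom = λ _ _ → tt
    ; from-dom = λ σ _ → e-dom (ixn σ)
    ; from-to = from-to
    ; to-from = λ σ _ → to-from σ
    ; to-root = refl
    ; to-R = λ n xs ds → subst (R n) (sym (map-from-to ds)) , subst (R n) (map-from-to ds)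
    }

  module Timed (M : TM) (P : Poly) (verdict : List Sym → Bool)
    (decides : ∀ w → 1 ≤ length w → HaltsWithin M (evalPoly P (length w)) w (verdict w))
    (accepts : ∀ w j → m j < length w → w ∈ wordList j → verdict w ≡ true)
    (rejects : ∀ w → (∀ j → ¬ w ∈ wordList j) → verdict w ≡ false) where

    indices : ∀ {n} → Vec 𝔹 n → List Ix
    indices ys = lmap ixn (toList ys)

    indices-path : ∀ {n} (ys : Vec 𝔹 (suc n)) → lmap e (indices ys) ≡ toList (Vec.map from ys)
    indices-path ys = trans (sym (Listₚ.map-∘ (toList ys))) (sym (Vecₚ.toList-map from ys))

    word-query : ∀ {n} (ys : Vec 𝔹 (suc n)) → word (indices ys) ≡ encQuery enc𝔹 n ys
    word-query {n} ys = cong₂ (λ k zs → replicate k sa +++ Blocks zs)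
      (trans (Listₚ.length-map ixn (toList ys)) (Vecₚ.length-toList ys)) (names-ixn (toList ys))

    query-sound : ∀ {n} (ys : Vec 𝔹 (suc n)) J → encQuery enc𝔹 n ys ∈ wordList J → R n (Vec.map from ys)
    query-sound {n} ys J h = let is , path , w∈ = wordList-sound J h in
      path-vec (Vec.map from ys) (subst Path (trans (cong (lmap e) (same is w∈)) (indices-path ys)) path)
      where
      same : ∀ is → encQuery enc𝔹 n ys ∈ word is ∷ constWords is → is ≡ indices ys
      same is (here w≡) = trans (sym (back is)) (cong (lmap ixn) (sym (query-injective (suc n) (length is) (toList ys) (lmap name is) w≡)))
        where
        back : ∀ is → lmap ixn (lmap name is) ≡ is
        back [] = refl
        back (i ∷ is) = cong₂ _∷_ (ixn-name i) (back is)
      -- A relation query begins with `sa`, a constant query with `sc`.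
      same (i ∷ []) (there (here ()))

    query-complete : ∀ {n} (ys : Vec 𝔹 (suc n)) → R n (Vec.map from ys) → verdict (encQuery enc𝔹 n ys) ≡ true
    query-complete {n} ys r = subst (λ w → verdict w ≡ true) (word-query ys)
      (let J , J∈ , ls = top-level (indices ys) path in
        accepts (word (indices ys)) J (long (indices ys) J∈) (wordList-complete J (indices ys) ls path (here refl)))
      where
      path : Path (lmap e (indices ys))
      path = n , Vec.map from ys , sym (indices-path ys) , r

    -- `rejects` asks that no stage lists the word, which concerns infinitely many stages. So the
    -- original relation is decided first; if it fails, soundness of the lists excludes every stage.
    decide-query : ∀ {n} (ys : Vec 𝔹 (suc n)) → verdict (encQuery enc𝔹 n ys) ≡ true → R n (Vec.map from ys)
    decide-query {n} ys h with relN ⌜ toList (Vec.map from ys) ⌝ ≟ 0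
    ... | yes z = path-vec (Vec.map from ys) (relN-sound (toList (Vec.map from ys)) z)
    ... | no ne = ⊥-elim (true≢false h (rejects (encQuery enc𝔹 n ys) λ J w∈ →
      ne (relN-complete (toList (Vec.map from ys)) (n , Vec.map from ys , refl , query-sound ys J w∈))))

    const-sound : ∀ x J → encConstQuery x ∈ wordList J → x ≡ to root
    const-sound x J h = let is , path , w∈ = wordList-sound J h in go is path w∈
      where
      go : ∀ is → Path (lmap e is) → encConstQuery x ∈ word is ∷ constWords is → x ≡ to root
      go [] (n , y ∷ v , () , r) _
      go (_ ∷ _) path (here ())
      go (i ∷ []) path (there (here w≡)) = trans (enc𝔹-injective x (name i) (Listₚ.∷-injectiveʳ w≡))
        (trans (sym (to-e i)) (cong to (proj₁ (R₁-root (e i)) (path-vec (e i ∷ []) path))))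

    -- The root is not among the `c k`, so it is some `b j` and its name is long enough to pay for
    -- the stage.
    const-complete : ∀ x → x ≡ to root → verdict (encConstQuery x) ≡ true
    const-complete x refl = let j , b≡ = b-surjective root root-dom root-not-c in
      accepts (encConstQuery (to root)) j
        (subst (λ y → m j < length (encConstQuery y)) (trans (sym (to-e (inj₁ j))) (cong to b≡)) (s≤s (≤-reflexive (sym (name-length j)))))
        (wordList-complete j (inj₁ j ∷ []) (≤-refl ∷ []) (subst (λ r → Path (r ∷ [])) (sym b≡) root-path)
          (there (here (cong (λ y → sc ∷ enc𝔹 y) (trans (cong to (sym b≡)) (to-e (inj₁ j)))))))

    decide-const : ∀ x → verdict (encConstQuery x) ≡ true → x ≡ to root
    decide-const x h with Listₚ.≡-dec Data.Bool._≟_ x (to root)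
    ... | yes x≡ = x≡
    ... | no ne = ⊥-elim (true≢false h (rejects (encConstQuery x) λ J w∈ → ne (const-sound x J w∈)))

    copy-fullyPTime : FullyPTime copy-tree
    copy-fullyPTime = (λ _ → tt) , M , P ,
      (λ n ys → verdict (encQuery enc𝔹 n ys) , decides (encQuery enc𝔹 n ys) (s≤s z≤n) , decide-query ys , query-complete ys) ,
      (λ x → verdict (encConstQuery x) , decides (encConstQuery x) (s≤s z≤n) , decide-const x , const-complete x)

theorem34 : (S : PrefixTree ℕ) → Computable S → Injective S → UnboundedDepth S
    → Σ (PrefixTree 𝔹) λ S' → FullyPTime S' × Injective S' × UnboundedDepth S' × Iso S S'
theorem34 S computable injective unbounded = copy-tree , copy-fullyPTime , copy-injective , copy-unbounded , copy-iso
  where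
  open Names S computable injective unbounded using (outs; outsC)
  open Stages outs outsC
  open Naming m 10≤m m-gap using () renaming (marks to marks')
  open Words S computable injective unbounded m 10≤m m-gap using (plays; wordList)
  open Copy S computable injective unbounded m 10≤m m-gap

  -- `Stages` builds the marks along with its clock, `Naming` from an abstract `m`; here the clock
  -- is put in for `m`.
  marks≡ : ∀ j → marks j ≡ marks' j
  marks≡ zero = refl
  marks≡ (suc j) = cong (m j ∷_) (marks≡ j)

  valid : ∀ j → Valid (marks (suc j)) (m j) 0 (outs j)
  valid j = subst (λ ms → Valid ms (m j) 0 (outs j)) (sym (marks≡ (suc j))) (proj₁ (plays j 0))

  words≡ : ∀ j → words j ≡ wordList j
  words≡ j = trans (cong (λ ms → play ms (m j) 0 [] (outs j)) (marks≡ (suc j))) (proj₂ (plays j 0))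

  open Decider stage

  open Timed decider timePoly verdictOf decides
    (λ w j m<w w∈ → Running.accepts valid w j m<w (subst (w ∈_) (sym (words≡ j)) w∈))
    (λ w w∉ → Running.rejects valid w (λ j w∈ → w∉ j (subst (w ∈_) (words≡ j) w∈)))
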